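{- For every signature $L$ and every query $Q$ over the finite $L$-structures which is decidable in nondeterministic logarithmic space, there is a quantifier-free interpretation $\gamma:\Gamma_6\to(L,S)$ such that for every sufficiently large finite $L$-structure $A$, every successor expansion $(A,S)$ of $A$, and every breadth-first traversal $<$ of the 6-pointed graph $(A,S)^\gamma$: $A\in Q$ if and only if $((A,S)^\gamma,<)\models\psi$, where $\psi$ is the sentence described in the context.
   Context: Graphs are finite and undirected. A linear order $<$ of the vertex set of a graph, listing vertices $v_1<\dots<v_n$, is a breadth-first traversal (BFT) if for each $i\ge2$, whenever some $v_j$ with $j<i$ has a neighbour outside $\{v_1,\dots,v_{i-1}\}$, $v_i$ is adjacent to $v_{j^*}$ for the least such $j^*$ (a visiting order of breadth-first search). Equivalently: for all $u<v<w$, $uEw$ implies some $x<v$ with $x\le u$ has $xEv$. $\Gamma_6$ is the signature with a binary relation symbol $E$ and six constants $x_1,y_1,z_1,x_2,y_2,z_2$. The sentence $\psi$ of $\Gamma_6\cup\{<\}$: writing $p(u)$ for the $<$-least neighbour of $u$, say $v,w$ lie in a common quasi-level if $(p(w)<v\le w)\vee(p(v)<w\le v)$ (a clause involving $p(u)$ is false if $u$ has no neighbour); $\psi$ asserts that all six constants lie in one connected component (expressed as: no vertex $w$ without a $<$-smaller neighbour satisfies $c<w\le c'$ for constants $c<c'$), that if $x_1<x_2$ then $y_2,z_2$ lie in a common quasi-level, and that if $x_2<x_1$ then $y_1,z_1$ lie in a common quasi-level. A query over finite $L$-structures is an isomorphism-closed class; it is decidable in nondeterministic logarithmic space if a nondeterministic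 logspace Turing machine, given the standard encoding of $(A,<)$ for a finite $L$-structure $A$ and any linear order $<$ of its domain, accepts iff $A$ is in the query. A successor expansion of a finite $L$-structure $A$ is $(A,\min,\max,S)$ where $S$ is the successor function of some linear order of the domain with endpoints $\min,\max$; $(L,S)$ is $L$ plus constants $\min,\max$ and unary function symbol $S$. A $k$-ary interpretation $\gamma:\Gamma_6\to K$ consists of a $K$-formula $\partial^\gamma(\bar x)$ in a $k$-tuple of variables, a $K$-formula $E^\gamma(\bar x,\bar y)$, and for each constant a definition by cases (cases $K$-formulas, values $k$-tuples of $K$-terms); it is quantifier-free if these formulas are. For a $K$-structure $B$, $B^\gamma$ has domain $\{\bar b\in B^k:B\models\partial^\gamma(\bar b)\}$ with $E$ and the constants interpreted by their translations. -}

module Defs where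

open import Data.Bool using (Bool; true; false; if_then_else_)
open import Data.Empty using (⊥)
open import Data.Fin using (Fin; zero; suc)
import Data.Fin as Fin
import Data.Fin.Properties as Fin
open import Data.Irrelevant using ([_])
open import Data.List using (List; []; _∷_; _++_; length; replicate; concatMap; cartesianProductWith; allFin; foldr)
import Data.List as List
open import Data.List.Membership.Propositional using (_∈_)
open import Data.List.Relation.Unary.Linked using (Linked)
open import Data.Nat using (ℕ; zero; suc; _+_; _*_; _<_; NonZero)
import Data.Nat as ℕ
open import Data.Nat.Logarithm using (⌈log₂_⌉)
open import Data.Product using (Σ; ∃; _×_; _,_; proj₁; proj₂)
open import Data.Refinement using (Refinement; value; _,_)
open import Data.Sum using (_⊎_)
open import Data.Vec using (Vec; []; _∷_)
import Data.Vec as Vec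
open import Function.Bundles using (_↔_; _⇔_; Inverse)
open import Function.Properties.Inverse using (↔⇒↣)
open import Level using (0ℓ)
open import Relation.Binary.Core using (Rel)
open import Relation.Binary.Construct.Closure.ReflexiveTransitive using (Star)
open import Relation.Binary.Definitions using (DecidableEquality)
open import Relation.Binary.Structures using (IsStrictTotalOrder)
open import Relation.Binary.PropositionalEquality using (_≡_; _≢_; sym; subst)
open import Relation.Nullary using (¬_; Dec; does; no)
open import Relation.Nullary.Decidable using (map′; _×-dec_; _⊎-dec_; _→-dec_)

-- Constant symbols are nullary function symbols.
record Signature : Set where
  field
    #rel     : ℕ
    relArity : Fin #rel → ℕ
    #fun     : ℕ
    funArity : Fin #fun → ℕ

open Signature public

record Structure (L : Signature) : Set₁ where
  field
    Carrier : Set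
    relI    : (R : Fin (#rel L)) → Vec Carrier (relArity L R) → Set
    funI    : (f : Fin (#fun L)) → Vec Carrier (funArity L f) → Carrier

open Structure public

record IsFinite {L : Signature} (A : Structure L) : Set where
  field
    size     : ℕ
    nonEmpty : NonZero size
    index    : Carrier A ↔ Fin size
    relI?    : ∀ R t → Dec (relI A R t)

  _≟_ : DecidableEquality (Carrier A)
  _≟_ = Fin.inj⇒≟ (↔⇒↣ index)

FiniteStructure : Signature → Set₁
FiniteStructure L = Σ (Structure L) IsFinite

card : {L : Signature} → FiniteStructure L → ℕ
card (_ , fin) = IsFinite.size fin

record _≅_ {L : Signature} (A B : Structure L) : Set where
  field
    bijection : Carrier A ↔ Carrier B
  open Inverse bijection using (to)
  field
    preserves-rel : ∀ R t → relI A R t ⇔ relI B R (Vec.map to t)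
    preserves-fun : ∀ f t → to (funI A f t) ≡ funI B f (Vec.map to t)

record Query (L : Signature) : Set₁ where
  field
    Member     : FiniteStructure L → Set
    iso-closed : ∀ (A B : FiniteStructure L) → proj₁ A ≅ proj₁ B → Member A → Member B

open Query public

data Term (L : Signature) (n : ℕ) : Set where
  var : Fin n → Term L n
  app : (f : Fin (#fun L)) → Vec (Term L n) (funArity L f) → Term L n

infix  7 _≐_
infixr 6 _∧'_
infixr 5 _∨'_
infixr 4 _⇒'_

data Formula (L : Signature) (n : ℕ) : Set where
  rel  : (R : Fin (#rel L)) → Vec (Term L n) (relArity L R) → Formula L n
  _≐_  : Term L n → Term L n → Formula L n
  ⊥'   : Formula L n
  _∧'_ _∨'_ _⇒'_ : Formula L n → Formula L n → Formula L n
  ∃' ∀' : Formula L (suc n) → Formula L n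

¬' : {L : Signature} {n : ℕ} → Formula L n → Formula L n
¬' φ = φ ⇒' ⊥'

Sentence : Signature → Set
Sentence L = Formula L 0

data QuantifierFree {L : Signature} {n : ℕ} : Formula L n → Set where
  rel  : ∀ R ts → QuantifierFree (rel R ts)
  _≐_  : ∀ s t → QuantifierFree (s ≐ t)
  ⊥'   : QuantifierFree ⊥'
  _∧'_ : ∀ {φ χ} → QuantifierFree φ → QuantifierFree χ → QuantifierFree (φ ∧' χ)
  _∨'_ : ∀ {φ χ} → QuantifierFree φ → QuantifierFree χ → QuantifierFree (φ ∨' χ)
  _⇒'_ : ∀ {φ χ} → QuantifierFree φ → QuantifierFree χ → QuantifierFree (φ ⇒' χ)

module _ {L : Signature} where

  mutual
    weaken : ∀ {n} → Term L n → Term L (suc n)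
    weaken (var i)    = var (suc i)
    weaken (app f ts) = app f (weakens ts)

    weakens : ∀ {n m} → Vec (Term L n) m → Vec (Term L (suc n)) m
    weakens []       = []
    weakens (t ∷ ts) = weaken t ∷ weakens ts

module _ {L : Signature} (A : Structure L) where

  mutual
    eval : ∀ {n} → Vec (Carrier A) n → Term L n → Carrier A
    eval ρ (var i)    = Vec.lookup ρ i
    eval ρ (app f ts) = funI A f (evals ρ ts)

    evals : ∀ {n m} → Vec (Carrier A) n → Vec (Term L n) m → Vec (Carrier A) m
    evals ρ []       = []
    evals ρ (t ∷ ts) = eval ρ t ∷ evals ρ ts

  Sat : ∀ {n} → Vec (Carrier A) n → Formula L n → Set
  Sat ρ (rel R ts) = relI A R (evals ρ ts)
  Sat ρ (s ≐ t)    = eval ρ s ≡ eval ρ t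
  Sat ρ ⊥'         = ⊥
  Sat ρ (φ ∧' χ)   = Sat ρ φ × Sat ρ χ
  Sat ρ (φ ∨' χ)   = Sat ρ φ ⊎ Sat ρ χ
  Sat ρ (φ ⇒' χ)   = Sat ρ φ → Sat ρ χ
  Sat ρ (∃' φ)     = ∃ λ a → Sat (a ∷ ρ) φ
  Sat ρ (∀' φ)     = ∀ a → Sat (a ∷ ρ) φ

infix 3 _⊨_

_⊨_ : {L : Signature} → Structure L → Sentence L → Set
A ⊨ φ = Sat A [] φ

module _ {L : Signature} {A : Structure L} (fin : IsFinite A) where
  open IsFinite fin
  open Inverse index using (to; from; strictlyInverseʳ)

  Sat? : ∀ {n} (ρ : Vec (Carrier A) n) (φ : Formula L n) → Dec (Sat A ρ φ)
  Sat? ρ (rel R ts) = relI? R (evals A ρ ts)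
  Sat? ρ (s ≐ t)    = eval A ρ s ≟ eval A ρ t
  Sat? ρ ⊥'         = no λ ()
  Sat? ρ (φ ∧' χ)   = Sat? ρ φ ×-dec Sat? ρ χ
  Sat? ρ (φ ∨' χ)   = Sat? ρ φ ⊎-dec Sat? ρ χ
  Sat? ρ (φ ⇒' χ)   = Sat? ρ φ →-dec Sat? ρ χ
  Sat? ρ (∃' φ)     = map′ (λ (i , s) → from i , s)
                           (λ (a , s) → to a , subst (λ b → Sat A (b ∷ ρ) φ) (sym (strictlyInverseʳ a)) s)
                           (Fin.any? λ i → Sat? (from i ∷ ρ) φ)
  Sat? ρ (∀' φ)     = map′ (λ s a → subst (λ b → Sat A (b ∷ ρ) φ) (strictlyInverseʳ a) (s (to a)))
                           (λ s i → s (from i))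
                           (Fin.all? λ i → Sat? (from i ∷ ρ) φ)

IsLinearOrder : {A : Set} → Rel A 0ℓ → Set
IsLinearOrder _≺_ = IsStrictTotalOrder _≡_ _≺_

pattern minSym    = zero
pattern maxSym    = suc zero
pattern succSym   = suc (suc zero)
pattern baseSym f = suc (suc (suc f))

withSuccessor : Signature → Signature
withSuccessor L .#rel                 = #rel L
withSuccessor L .relArity             = relArity L
withSuccessor L .#fun                 = 3 + #fun L
withSuccessor L .funArity minSym      = 0
withSuccessor L .funArity maxSym      = 0
withSuccessor L .funArity succSym     = 1
withSuccessor L .funArity (baseSym f) = funArity L f

-- S is a total function symbol, so it needs a value at the last element:
-- the usual convention S(max) = max is adopted.
record Successor (A : Set) : Set₁ where
  field
    _≺_       : Rel A 0ℓ
    isLinear  : IsLinearOrder _≺_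
    min max   : A
    S         : A → A
    min-least : ∀ a → ¬ (a ≺ min)
    max-last  : ∀ a → ¬ (max ≺ a)
    S-above   : ∀ a → a ≢ max → a ≺ S a
    S-next    : ∀ a b → a ≢ max → a ≺ b → ¬ (b ≺ S a)
    S-max     : S max ≡ max

module _ {L : Signature} where

  expand : (A : Structure L) → Successor (Carrier A) → Structure (withSuccessor L)
  expand A s .Carrier                 = Carrier A
  expand A s .relI                    = relI A
  expand A s .funI minSym      []      = Successor.min s
  expand A s .funI maxSym      []      = Successor.max s
  expand A s .funI succSym     (a ∷ []) = Successor.S s a
  expand A s .funI (baseSym f) t       = funI A f t

  successorExpansion : (A : FiniteStructure L) → Successor (Carrier (proj₁ A)) → FiniteStructure (withSuccessor L)
  successorExpansion (A , fin) s = expand A s , record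
    { size = size ; nonEmpty = nonEmpty ; index = index ; relI? = relI? }
    where open IsFinite fin

data Move : Set where
  left stay right : Move

data InputSymbol : Set where
  ▷ ◁ : InputSymbol
  bit : Bool → InputSymbol

-- One read-only input tape delimited by the end markers ▷ and ◁, and one
-- work tape, infinite to the right, whose blank symbol is zero.
record Machine : Set where
  field
    #states #symbols : ℕ
    start accept     : Fin #states

  State : Set
  State = Fin #states

  Symbol : Set
  Symbol = Fin (suc #symbols)

  Action : Set
  Action = State × Symbol × Move × Move

  field
    δ : State → InputSymbol → Symbol → List Action

readInput : (w : List Bool) → Fin (2 + length w) → InputSymbol
readInput w zero    = ▷
readInput w (suc i) = go w i
  where
  go : (w : List Bool) → Fin (suc (length w)) → InputSymbol
  go []      zero    = ◁
  go (b ∷ w) zero    = bit b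
  go (b ∷ w) (suc i) = go w i

nextFin : ∀ {n} → Fin n → Fin n
nextFin {suc zero}    zero    = zero
nextFin {suc (suc n)} zero    = suc zero
nextFin               (suc i) = suc (nextFin i)

-- A head moving off either end of the input tape, or off the left end of
-- the work tape, stays put.
moveInput : ∀ {n} → Move → Fin n → Fin n
moveInput left  i = Fin.pred i
moveInput stay  i = i
moveInput right i = nextFin i

moveWork : Move → ℕ → ℕ
moveWork left  h = ℕ.pred h
moveWork stay  h = h
moveWork right h = suc h

module _ (M : Machine) where
  open Machine M

  record Config (w : List Bool) : Set where
    constructor config
    field
      state     : State
      inputHead : Fin (2 + length w)
      workHead  : ℕ
      workTape  : ℕ → Symbol

  open Config

  initial : ∀ w → Config w
  initial w = config start zero 0 (λ _ → zero)

  enabled : ∀ {w} → Config w → List Action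
  enabled {w} c = δ (state c) (readInput w (inputHead c)) (workTape c (workHead c))

  perform : ∀ {w} → Action → Config w → Config w
  perform (q , s , mi , mw) c = config q (moveInput mi (inputHead c)) (moveWork mw (workHead c))
    (λ j → if does (j ℕ.≟ workHead c) then s else workTape c j)

  data _⟶_ {w : List Bool} (c : Config w) : Config w → Set where
    step : ∀ {a} → a ∈ enabled c → c ⟶ perform a c

  Reachable : ∀ {w} → Config w → Set
  Reachable {w} c = Star _⟶_ (initial w) c

  Accepts : List Bool → Set
  Accepts w = ∃ λ (c : Config w) → Reachable c × state c ≡ accept

  -- On every input, every computation path uses at most k(1 + ⌈log₂ |w|⌉)
  -- work tape cells; the cells used are those with index ≤ some workHead.
  LogSpace : Set
  LogSpace = ∃ λ k → ∀ w (c : Config w) → Reachable c → workHead c < k * suc ⌈log₂ length w ⌉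

tuples : {A : Set} → List A → (k : ℕ) → List (Vec A k)
tuples xs zero    = [] ∷ []
tuples xs (suc k) = cartesianProductWith _∷_ xs (tuples xs k)

-- The encoding of an ordered structure with increasing listing xs: 1ⁿ0, then
-- the characteristic string of each relation, then that of the graph
-- {(x̄,y) : f(x̄) = y} of each function, tuples in lexicographic order.
encode : {L : Signature} (A : FiniteStructure L) → List (Carrier (proj₁ A)) → List Bool
encode {L} (A , fin) xs =
     replicate (length xs) true ++ false ∷ []
  ++ concatMap (λ R → List.map (λ t → does (relI? R t)) (tuples xs (relArity L R))) (allFin (#rel L))
  ++ concatMap (λ f → cartesianProductWith (λ t y → does (funI A f t ≟ y)) (tuples xs (funArity L f)) xs) (allFin (#fun L))
  where open IsFinite fin

record IsIncreasingListing {A : Set} (_≺_ : Rel A 0ℓ) (xs : List A) : Set where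
  field
    increasing : Linked _≺_ xs
    complete   : ∀ a → a ∈ xs

Decides : {L : Signature} → Machine → Query L → Set₁
Decides {L} M Q = (A : FiniteStructure L) (_≺_ : Rel (Carrier (proj₁ A)) 0ℓ) → IsLinearOrder _≺_ →
  ∀ xs → IsIncreasingListing _≺_ xs → Accepts M (encode A xs) ⇔ Member Q A

NLDecidable : {L : Signature} → Query L → Set₁
NLDecidable Q = ∃ λ M → LogSpace M × Decides M Q

Γ₆ : Signature
Γ₆ = record { #rel = 1 ; relArity = λ _ → 2 ; #fun = 6 ; funArity = λ _ → 0 }

Constant : Set
Constant = Fin 6

pattern x₁ = zero
pattern y₁ = suc zero
pattern z₁ = suc (suc zero)
pattern x₂ = suc (suc (suc zero))
pattern y₂ = suc (suc (suc (suc zero)))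
pattern z₂ = suc (suc (suc (suc (suc zero))))

Adj : (G : Structure Γ₆) → Rel (Carrier G) 0ℓ
Adj G u v = relI G zero (u ∷ v ∷ [])

record IsGraph (G : Structure Γ₆) : Set where
  field
    symmetric   : ∀ u v → Adj G u v → Adj G v u
    irreflexive : ∀ u → ¬ Adj G u u

-- u ≺ v has a neighbour outside the set of vertices listed before v.
IsActive : (G : Structure Γ₆) → Rel (Carrier G) 0ℓ → (v u : Carrier G) → Set
IsActive G _≺_ v u = u ≺ v × ∃ λ w → Adj G u w × ¬ (w ≺ v)

record IsBFT (G : Structure Γ₆) (_≺_ : Rel (Carrier G) 0ℓ) : Set where
  field
    isLinear : IsLinearOrder _≺_
    visit    : ∀ v u → IsActive G _≺_ v u → (∀ u′ → IsActive G _≺_ v u′ → ¬ (u′ ≺ u)) → Adj G v u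

-- "t₁ if φ₁, else t₂ if φ₂, …, else the default tuple."
record ByCases (K : Signature) (k : ℕ) : Set where
  field
    cases   : List (Sentence K × Vec (Term K 0) k)
    default : Vec (Term K 0) k

record Interpretation (K : Signature) : Set where
  field
    k        : ℕ
    k≢0      : NonZero k
    ∂        : Formula K k
    edge     : Formula K (k + k)
    constant : Constant → ByCases K k

record IsQuantifierFree {K : Signature} (γ : Interpretation K) : Set where
  open Interpretation γ
  field
    ∂-qf     : QuantifierFree ∂
    edge-qf  : QuantifierFree edge
    cases-qf : ∀ c {φ t} → (φ , t) ∈ ByCases.cases (constant c) → QuantifierFree φ

module _ {K : Signature} (B : FiniteStructure K) where

  private
    ∣B∣ = Carrier (proj₁ B)

  caseValue : ∀ {k} → ByCases K k → Vec ∣B∣ k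
  caseValue d = foldr (λ (φ , t) rest → if does (Sat? (proj₂ B) [] φ) then evals (proj₁ B) [] t else rest)
                      (evals (proj₁ B) [] (ByCases.default d)) (ByCases.cases d)

  module _ (γ : Interpretation K) where
    open Interpretation γ

    -- The tuples defining the constants lie in the domain defined by ∂.
    ConstantsInDomain : Set
    ConstantsInDomain = ∀ c → Sat (proj₁ B) (caseValue (constant c)) ∂

    -- Refinement carries its membership proof irrelevantly, so equality of
    -- vertices is equality of tuples.
    interpret : ConstantsInDomain → Structure Γ₆
    interpret def .Carrier                = Refinement (Vec ∣B∣ k) (λ b → Sat (proj₁ B) b ∂)
    interpret def .relI zero (u ∷ v ∷ []) = Sat (proj₁ B) (value u Vec.++ value v) edge
    interpret def .funI c []              = caseValue (constant c) , [ def c ]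

withOrder : Signature → Signature
withOrder L .#rel             = suc (#rel L)
withOrder L .relArity zero    = 2
withOrder L .relArity (suc R) = relArity L R
withOrder L .#fun             = #fun L
withOrder L .funArity         = funArity L

expandOrder : {L : Signature} (A : Structure L) → Rel (Carrier A) 0ℓ → Structure (withOrder L)
expandOrder A _≺_ .Carrier                = Carrier A
expandOrder A _≺_ .relI zero (a ∷ b ∷ []) = a ≺ b
expandOrder A _≺_ .relI (suc R) t         = relI A R t
expandOrder A _≺_ .funI                   = funI A

Γ₆< : Signature
Γ₆< = withOrder Γ₆

infix 7 _E'_ _<'_ _≤'_

_E'_ _<'_ _≤'_ : ∀ {n} (s t : Term Γ₆< n) → Formula Γ₆< n
s E' t = rel (suc zero) (s ∷ t ∷ [])
s <' t = rel zero (s ∷ t ∷ [])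
s ≤' t = s <' t ∨' s ≐ t

con : ∀ {n} → Constant → Term Γ₆< n
con c = app c []

-- s = p(t)
isLeastNeighbour : ∀ {n} (s t : Term Γ₆< n) → Formula Γ₆< n
isLeastNeighbour s t = t E' s ∧' ∀' (weaken t E' var zero ⇒' weaken s ≤' var zero)

-- p(t) < s, which is false if t has no neighbour
p[_]<'_ : ∀ {n} (t s : Term Γ₆< n) → Formula Γ₆< n
p[ t ]<' s = ∃' (isLeastNeighbour (var zero) (weaken t) ∧' var zero <' weaken s)

commonQuasiLevel : ∀ {n} (v w : Term Γ₆< n) → Formula Γ₆< n
commonQuasiLevel v w = ((p[ w ]<' v) ∧' v ≤' w) ∨' ((p[ v ]<' w) ∧' w ≤' v)

hasSmallerNeighbour : ∀ {n} → Term Γ₆< n → Formula Γ₆< n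
hasSmallerNeighbour w = ∃' (weaken w E' var zero ∧' var zero <' weaken w)

noRootBetween : (c c′ : Constant) → Sentence Γ₆<
noRootBetween c c′ = con c <' con c′ ⇒'
  ¬' (∃' (¬' (hasSmallerNeighbour (var zero)) ∧' con c <' var zero ∧' var zero ≤' con c′))

⋀ : {L : Signature} {n : ℕ} → List (Formula L n) → Formula L n
⋀ = foldr _∧'_ (¬' ⊥')

sameComponent : Sentence Γ₆<
sameComponent = ⋀ (cartesianProductWith noRootBetween (allFin 6) (allFin 6))

ψ : Sentence Γ₆<
ψ = sameComponent
  ∧' (con x₁ <' con x₂ ⇒' commonQuasiLevel (con y₂) (con z₂))
  ∧' (con x₂ <' con x₁ ⇒' commonQuasiLevel (con y₁) (con z₁))

{-# OPTIONS --safe #-}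

-- A nondeterministic logspace computation is a reachability problem between
-- register contents: the work tape becomes two stacks coded by numbers below
-- |A|^W, the input head a position in one of finitely many sections of the
-- encoding, and each elementary step (increment, decrement, test for zero, bit
-- of the input) is quantifier-free in the successor. Adding a clock that
-- increases along every step gives a layered undirected graph, in which
-- (final, T) has distance T from (start, 0) if the machine accepts, and
-- distance at least T + 2 (or ∞) otherwise, while (start, T) has distance T.
--
-- Two copies of this graph are joined by an edge between their roots x₁, x₂.
-- A traversal visiting x₁ before x₂ enters the second copy through x₂, so there
-- the least neighbours form a breadth-first tree with root x₂. Vertices on one
-- level share a quasi-level, and vertices sharing a quasi-level are at most one
-- level apart; by parity, y₂ = (start, T) and z₂ = (final, T) share one iff they
-- are equally far from x₂.
module Submission where

open import Defs
open import Data.Bool using (Bool; true; false; if_then_else_)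
open import Data.Empty using (⊥; ⊥-elim)
open import Data.Fin using (Fin; zero; suc; toℕ; inject₁; fromℕ; _↑ˡ_; _↑ʳ_; combine)
import Data.Fin as Fin
import Data.Fin.Properties as Fin
open import Data.Fin.Induction using (spo-wellFounded)
open import Data.Fin.Relation.Unary.Top using (view; ‵fromℕ; ‵inject₁)
import Data.Irrelevant as Irrelevant
open import Data.List using (List; []; _∷_; _++_; length; concat; tabulate; _ʳ++_; allFin; concatMap; cartesianProductWith; replicate)
import Data.List as List
import Data.List.Properties as List
open import Data.List.Membership.Propositional using (_∈_)
open import Data.List.Membership.Propositional.Properties using (∈-lookup; ∈-applyUpTo⁺; ∈-allFin; ∈-cartesianProductWith⁺; ∈-cartesianProductWith⁻)
import Data.List.Relation.Unary.Any as Any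
import Data.List.Relation.Unary.Any.Properties as Any
import Data.List.Relation.Unary.Linked.Properties as Linked
open import Data.Maybe using (Maybe; just; nothing)
import Data.Maybe as Maybe
import Data.Maybe.Properties as Maybe
open import Data.Nat using (ℕ; zero; suc; _+_; _*_; _^_; _≤_; _<_; z≤n; s≤s; NonZero; _≤′_; ≤′-refl; ≤′-step)
import Data.Nat as ℕ
import Data.Nat.Properties as ℕ
open import Data.Nat.DivMod using (_/_; m%n<n; m≡m%n+[m/n]*n; m<n*o⇒m/o<n)
open import Data.Nat.Induction using (<-wellFounded)
open import Data.Nat.Logarithm using (⌈log₂_⌉; ⌈log₂⌉-mono-≤; ⌈log₂2^n⌉≡n)
open import Data.Nat.Tactic.RingSolver using (solve-∀)
open import Data.Product using (Σ; ∃; ∃₂; _×_; _,_; proj₁; proj₂)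
open import Data.Refinement using (_,_)
import Data.Refinement as Refinement
open import Data.Sum using (_⊎_; inj₁; inj₂; [_,_]′)
open import Data.Vec using (Vec; []; _∷_)
import Data.Vec as Vec
import Data.Vec.Properties as Vec
open import Data.Vec.Relation.Unary.All using (All; []; _∷_)
open import Function using (_∘_)
open import Function.Bundles using (_↔_; _⇔_; mk⇔; Inverse; Equivalence)
open import Function.Definitions using (Injective)
open import Induction.WellFounded using (WellFounded; Acc; acc)
open import Level using (0ℓ)
open import Relation.Binary.Construct.Closure.ReflexiveTransitive using (Star; ε; _◅_; _◅◅_; reverse)
open import Relation.Binary.Core using (Rel)
open import Relation.Binary.Definitions using (tri<; tri≈; tri>)
open import Relation.Binary.PropositionalEquality using (_≡_; _≢_; refl; sym; trans; cong; cong₂; subst; isEquivalence; module ≡-Reasoning)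
open import Relation.Binary.Structures using (IsStrictTotalOrder; IsStrictPartialOrder)
open import Relation.Nullary using (¬_; Dec; yes; no; does)
open import Relation.Nullary.Decidable using (_×-dec_; ¬?; map′)

open Equivalence using () renaming (to to ⇒; from to ⇐)

-- Breadth-first traversals

-- Two obstacles shape the construction. A traversal may start anywhere, so distances can be
-- controlled only in a part of the graph with a single entrance. Which copy that is depends on the
-- order of `x₁` and `x₂`; as both copies simulate the same machine, either can answer. Moreover a
-- quasi-level determines the level only up to one, so rejection must cause a gap of two. It does:
-- an edge changes the clock by one, so each tree edge that goes back in time makes the level exceed
-- the clock value by two more.
--
-- If the machine rejects, `z₁` or `z₂` may lie in a component other than that of `x₁`, where
-- quasi-levels say nothing about distances; hence the connectivity clause of `ψ`.
--
-- Every tuple is a vertex, including tuples that describe no configuration. They do no harm: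
-- acceptance is read off from a forward path out of a start vertex, and the simulation invariant is
-- preserved along such a path. For the same reason the loops of the program may be
-- nondeterministic, since a wrong choice only loses the run.

data Path {V : Set} (R : Rel V 0ℓ) (u : V) : ℕ → V → Set where
  []  : Path R u 0 u
  _▻_ : ∀ {n v w} → Path R u n v → R v w → Path R u (suc n) w

module _ {L : Signature} (A : Structure L) {n : ℕ} (ρ : Vec (Carrier A) n) where

  ⋀-intro : ∀ φs → (∀ {φ} → φ ∈ φs → Sat A ρ φ) → Sat A ρ (⋀ φs)
  ⋀-intro []       h = λ ()
  ⋀-intro (φ ∷ φs) h = h (Any.here refl) , ⋀-intro φs (λ φ∈ → h (Any.there φ∈))

  ⋀-elim : ∀ φs → Sat A ρ (⋀ φs) → ∀ {φ} → φ ∈ φs → Sat A ρ φ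
  ⋀-elim (φ ∷ φs) (h , _) (Any.here refl) = h
  ⋀-elim (φ ∷ φs) (_ , h) (Any.there φ∈)  = ⋀-elim φs h φ∈

sameComponent-sat : (H : Structure Γ₆<) → (∀ c c′ → H ⊨ noRootBetween c c′) ⇔ (H ⊨ sameComponent)
sameComponent-sat H = mk⇔ (λ h → ⋀-intro H [] φs (intro h)) (λ h c c′ → ⋀-elim H [] φs h (∈-cartesianProductWith⁺ noRootBetween (∈-allFin c) (∈-allFin c′)))
  where
  φs : List (Sentence Γ₆<)
  φs = cartesianProductWith noRootBetween (allFin 6) (allFin 6)
  intro : (∀ c c′ → H ⊨ noRootBetween c c′) → ∀ {φ} → φ ∈ φs → H ⊨ φ
  intro h φ∈ with c , c′ , _ , _ , refl ← ∈-cartesianProductWith⁻ noRootBetween (allFin 6) (allFin 6) φ∈ = h c c′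

module Traversal (G : Structure Γ₆) (graph : IsGraph G)
  (_~?_ : ∀ u v → Dec (Adj G u v))
  (search : ∀ {P : Carrier G → Set} → (∀ v → Dec (P v)) → Dec (∃ P))
  (_≺_ : Rel (Carrier G) 0ℓ) (bft : IsBFT G _≺_) (≺-wf : WellFounded _≺_) where

  open IsGraph graph
  open IsBFT bft
  open IsStrictTotalOrder isLinear using (compare; _<?_) renaming (trans to ≺-trans; irrefl to ≺-irrefl)

  infix 4 _~_ _≼_

  V : Set
  V = Carrier G

  _~_ _≼_ : Rel V 0ℓ
  u ~ v = Adj G u v
  u ≼ v = ¬ (v ≺ u)

  ~-sym : ∀ {u v} → u ~ v → v ~ u
  ~-sym = symmetric _ _

  ≼-cases : ∀ {u v} → u ≼ v → u ≺ v ⊎ u ≡ v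
  ≼-cases {u} {v} u≼v with compare u v
  ... | tri< u≺v _ _ = inj₁ u≺v
  ... | tri≈ _ u≡v _ = inj₂ u≡v
  ... | tri> _ _ v≺u = ⊥-elim (u≼v v≺u)

  cases-≼ : ∀ {u v} → u ≺ v ⊎ u ≡ v → u ≼ v
  cases-≼ (inj₁ u≺v) v≺u = ≺-irrefl refl (≺-trans u≺v v≺u)
  cases-≼ (inj₂ refl) v≺u = ≺-irrefl refl v≺u

  ≺⇒≼ : ∀ {u v} → u ≺ v → u ≼ v
  ≺⇒≼ u≺v = cases-≼ (inj₁ u≺v)

  ≼-≺-trans : ∀ {u v w} → u ≼ v → v ≺ w → u ≺ w
  ≼-≺-trans u≼v v≺w with ≼-cases u≼v
  ... | inj₁ u≺v = ≺-trans u≺v v≺w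
  ... | inj₂ refl = v≺w

  ≺-≼-trans : ∀ {u v w} → u ≺ v → v ≼ w → u ≺ w
  ≺-≼-trans u≺v v≼w with ≼-cases v≼w
  ... | inj₁ v≺w = ≺-trans u≺v v≺w
  ... | inj₂ refl = u≺v

  ≼-trans : ∀ {u v w} → u ≼ v → v ≼ w → u ≼ w
  ≼-trans u≼v v≼w w≺u = v≼w (≺-≼-trans w≺u u≼v)

  least : ∀ {P : V → Set} → (∀ v → Dec (P v)) → ∀ {v} → P v → ∃ λ u → P u × ∀ w → P w → u ≼ w
  least {P} P? {v} = go (≺-wf v)
    where
    go : ∀ {v} → Acc _≺_ v → P v → ∃ λ u → P u × ∀ w → P w → u ≼ w
    go {v} (acc rs) Pv with search (λ w → P? w ×-dec (w <? v))
    ... | yes (w , Pw , w≺v) = go (rs w≺v) Pw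
    ... | no none            = v , Pv , λ w Pw w≺v → none (w , Pw , w≺v)

  -- The pure order form of the traversal property. The vertex `u` is active at `v`, so the least
  -- active vertex is at most `u`, and `visit` makes it a neighbour of `v`. The case `v = w` is
  -- included.
  early-neighbour : ∀ {u v w} → u ≺ v → v ≼ w → u ~ w → ∃ λ x → v ~ x × x ≼ u
  early-neighbour {u} {v} u≺v v≼w u~w
    with x , active , minimal ← least (λ u → (u <? v) ×-dec search (λ w → (u ~? w) ×-dec ¬? (w <? v))) (u≺v , _ , u~w , v≼w)
    = x , visit v x active minimal , minimal u (u≺v , _ , u~w , v≼w)

  HasSmaller Root : V → Set
  HasSmaller v = ∃ λ u → v ~ u × u ≺ v
  Root v       = ¬ HasSmaller v

  hasSmaller? : ∀ v → Dec (HasSmaller v)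
  hasSmaller? v = search (λ u → (v ~? u) ×-dec (u <? v))

  Least : V → V → Set
  Least p v = v ~ p × ∀ u → v ~ u → p ≼ u

  parent : ∀ {v} → HasSmaller v → ∃ λ p → Least p v × p ≺ v
  parent {v} (u , v~u , u≺v) with p , v~p , p≼ ← least (v ~?_) v~u = p , (v~p , p≼) , ≼-≺-trans (p≼ u v~u) u≺v

  Least-unique : ∀ {p q v} → Least p v → Least q v → p ≡ q
  Least-unique {p} {q} (v~p , p≼) (v~q , q≼) with ≼-cases (p≼ q v~q)
  ... | inj₁ p≺q = ⊥-elim (q≼ p v~p p≺q)
  ... | inj₂ p≡q = p≡q

  -- Some edge of the walk leaves the set of vertices before `r`, and `early-neighbour` applied to
  -- that edge gives `r` a smaller neighbour. Since `r` need not lie on the walk, no walk ever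
  -- passes from before a root to after it.
  crossed : ∀ {u r w} → Star _~_ u w → u ≺ r → r ≼ w → HasSmaller r
  crossed ε u≺r r≼u = ⊥-elim (r≼u u≺r)
  crossed {r = r} (_◅_ {j = v} u~v v⋆w) u≺r r≼w with v <? r
  ... | yes v≺r = crossed v⋆w v≺r r≼w
  ... | no  r≼v with x , r~x , x≼u ← early-neighbour u≺r r≼v u~v = x , r~x , ≼-≺-trans x≼u u≺r

  -- Descent along smaller neighbours. The predicate `P` travels with it so that `outside` can
  -- confine the descent to one side of the bridge.
  rootBelow : (P : V → Set) → (∀ {u v} → P v → v ~ u → u ≺ v → P u) →
              ∀ {v} → P v → ∃ λ r → Root r × r ≼ v × Star _~_ r v × P r
  rootBelow P closed {v} = go (≺-wf v)
    where
    go : ∀ {v} → Acc _≺_ v → P v → ∃ λ r → Root r × r ≼ v × Star _~_ r v × P r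
    go {v} (acc rs) Pv with hasSmaller? v
    ... | no root = v , root , ≺-irrefl refl , ε , Pv
    ... | yes (u , v~u , u≺v) with r , root , r≼u , r⋆u , Pr ← go (rs u≺v) (closed Pv v~u u≺v)
      = r , root , ≼-trans r≼u (≺⇒≼ u≺v) , r⋆u ◅◅ (~-sym v~u ◅ ε) , Pr

  -- Components are intervals of the order. By `crossed`, `v` has a smaller neighbour `x`; it cannot
  -- precede `r`, since the edge from `x` to `v` would then give the root `r` a smaller neighbour.
  -- Induction on `v` finishes.
  contiguous : ∀ {r u} → Root r → Star _~_ r u → ∀ {v} → r ≼ v → v ≼ u → Star _~_ r v
  contiguous {r} {u} root r⋆u {v} = go (≺-wf v)
    where
    go : ∀ {v} → Acc _≺_ v → r ≼ v → v ≼ u → Star _~_ r v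
    go {v} (acc rs) r≼v v≼u with ≼-cases r≼v
    ... | inj₂ refl = ε
    ... | inj₁ r≺v with x , v~x , x≺v ← crossed r⋆u r≺v v≼u = go (rs x≺v) r≼x (≼-trans (≺⇒≼ x≺v) v≼u) ◅◅ (~-sym v~x ◅ ε)
      where
      r≼x : r ≼ x
      r≼x x≺r with y , r~y , y≼x ← early-neighbour x≺r r≼v (~-sym v~x) = root (y , r~y , ≼-≺-trans y≼x x≺r)

  -- Why the absence of roots expresses connectedness: the root below `v` cannot come after `u`, so
  -- `u` lies in the interval between that root and `v`.
  connected : ∀ {u v} → u ≼ v → (∀ {r} → Root r → u ≺ r → ¬ (r ≼ v)) → Star _~_ u v
  connected {u} {v} u≼v noRoot with rootBelow (λ _ → V) (λ p _ _ → p) {v} v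
  ... | r , root , r≼v , r⋆v , _ with u <? r
  ...   | yes u≺r = ⊥-elim (noRoot root u≺r r≼v)
  ...   | no r≼u  = reverse ~-sym (contiguous root r⋆v r≼u u≼v) ◅◅ r⋆v

  -- Stated with disjunctions, as in `isLeastNeighbour`, so that `Ψ` differs from the satisfaction
  -- of `ψ` only in the big conjunction.
  LeastNeighbour : V → V → Set
  LeastNeighbour p v = v ~ p × ∀ u → v ~ u → p ≺ u ⊎ p ≡ u

  Least⇒LeastNeighbour : ∀ {p v} → Least p v → LeastNeighbour p v
  Least⇒LeastNeighbour (v~p , p≼) = v~p , λ u v~u → ≼-cases (p≼ u v~u)

  LeastNeighbour⇒Least : ∀ {p v} → LeastNeighbour p v → Least p v
  LeastNeighbour⇒Least (v~p , p≼) = v~p , λ u v~u → cases-≼ (p≼ u v~u)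

  CommonQuasiLevel : V → V → Set
  CommonQuasiLevel v w = ((∃ λ p → LeastNeighbour p w × p ≺ v) × (v ≺ w ⊎ v ≡ w))
                       ⊎ ((∃ λ p → LeastNeighbour p v × p ≺ w) × (w ≺ v ⊎ w ≡ v))

  constantOf : Constant → V
  constantOf c = funI G c []

  SameComponent : Set
  SameComponent = ∀ c c′ → constantOf c ≺ constantOf c′ →
    ¬ (∃ λ r → Root r × constantOf c ≺ r × (r ≺ constantOf c′ ⊎ r ≡ constantOf c′))

  Ψ : Set
  Ψ = SameComponent
    × (constantOf x₁ ≺ constantOf x₂ → CommonQuasiLevel (constantOf y₂) (constantOf z₂))
    × (constantOf x₂ ≺ constantOf x₁ → CommonQuasiLevel (constantOf y₁) (constantOf z₁))

  Ψ⇔ψ : Ψ ⇔ (expandOrder G _≺_ ⊨ ψ)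
  Ψ⇔ψ = mk⇔ (λ (same , q) → ⇒ (sameComponent-sat (expandOrder G _≺_)) same , q)
            (λ (same , q) → ⇐ (sameComponent-sat (expandOrder G _≺_)) same , q)

  -- The part of the graph on the side of x′ is entered through the bridge
  -- x — x′, so there the least neighbours trace a breadth-first tree rooted at x′.
  module Entered (side time : V → ℕ) (_↝_ : Rel V 0ℓ) (x x′ : V)
    (~-cases : ∀ {u v} → u ~ v → (side u ≡ side v × (u ↝ v ⊎ v ↝ u)) ⊎ ((u ≡ x × v ≡ x′) ⊎ (u ≡ x′ × v ≡ x)))
    (↝-time : ∀ {u v} → u ↝ v → time v ≡ suc (time u))
    (↝-side : ∀ {u v} → u ↝ v → side v ≡ side u)
    (↝⇒~ : ∀ {u v} → u ↝ v → u ~ v)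
    (x~x′ : x ~ x′) (time-x′ : time x′ ≡ 0) (x≢x′ : side x ≢ side x′) (x≺x′ : x ≺ x′) where

    data AtLevel : ℕ → V → Set where
      root  : AtLevel 0 x′
      child : ∀ {n p v} → Least p v → p ≺ v → AtLevel n p → side v ≡ side x′ → AtLevel (suc n) v

    AtLevel⇒side : ∀ {n v} → AtLevel n v → side v ≡ side x′
    AtLevel⇒side root            = refl
    AtLevel⇒side (child _ _ _ s) = s

    AtLevel⇒≽ : ∀ {n v} → AtLevel n v → x′ ≼ v
    AtLevel⇒≽ root               = ≺-irrefl refl
    AtLevel⇒≽ (child _ p≺v lp _) = ≼-trans (AtLevel⇒≽ lp) (≺⇒≼ p≺v)

    -- The descent from `x` cannot use the bridge, because its other end `x′` comes after `x`. So
    -- the component has its root on the far side, and every vertex reached on the side of `x′` has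
    -- a parent.
    outside : ∃ λ r → Root r × r ≼ x × Star _~_ r x × (side r ≢ side x′ × r ≼ x)
    outside = rootBelow (λ v → side v ≢ side x′ × v ≼ x) closed (x≢x′ , ≺-irrefl refl)
      where
      closed : ∀ {u v} → side v ≢ side x′ × v ≼ x → v ~ u → u ≺ v → side u ≢ side x′ × u ≼ x
      closed (v≢ , v≼x) v~u u≺v with ~-cases v~u
      ... | inj₁ (v≡u , _)            = (λ u≡ → v≢ (trans v≡u u≡)) , ≼-trans (≺⇒≼ u≺v) v≼x
      ... | inj₂ (inj₁ (refl , refl)) = ⊥-elim (≺⇒≼ x≺x′ u≺v)
      ... | inj₂ (inj₂ (refl , refl)) = ⊥-elim (v≢ refl)

    -- The outside root precedes `v`, for otherwise a walk from `v` would give that root a smaller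
    -- neighbour. So `v` has a parent. If the parent lies across the bridge, then `v` is `x′`;
    -- otherwise the induction continues with it.
    level : ∀ {v} → Star _~_ x′ v → side v ≡ side x′ → ∃ λ n → AtLevel n v
    level {v} = go (≺-wf v)
      where
      go : ∀ {v} → Acc _≺_ v → Star _~_ x′ v → side v ≡ side x′ → ∃ λ n → AtLevel n v
      go {v} (acc rs) x′⋆v v≡ with r , root-r , r≼x , r⋆x , r≢ , _ ← outside with parent (crossed r⋆v r≺v (≺-irrefl refl))
        where
        r⋆v : Star _~_ r v
        r⋆v = r⋆x ◅◅ (x~x′ ◅ x′⋆v)
        r≺v : r ≺ v
        r≺v with compare r v
        ... | tri< r≺v _ _  = r≺v
        ... | tri≈ _ refl _ = ⊥-elim (r≢ v≡)
        ... | tri> _ _ v≺r  = ⊥-elim (root-r (crossed (reverse ~-sym r⋆v) v≺r (≺-irrefl refl)))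
      ... | p , (v~p , p≼) , p≺v with ~-cases v~p
      ...   | inj₁ (v≡p , _) with n , lp ← go (rs p≺v) (x′⋆v ◅◅ (v~p ◅ ε)) (trans (sym v≡p) v≡) = suc n , child (v~p , p≼) p≺v lp v≡
      ...   | inj₂ (inj₁ (refl , refl)) = ⊥-elim (x≢x′ v≡)
      ...   | inj₂ (inj₂ (refl , refl)) = 0 , root

    -- Earlier vertices have earlier parents: were the parent `q` of `w` before the parent `p` of
    -- `v`, `early-neighbour` would give `v` a neighbour no later than `q`, against the minimality
    -- of `p`.
    AtLevel-mono : ∀ {m n v w} → AtLevel m v → AtLevel n w → v ≼ w → m ≤ n
    AtLevel-mono root lw _ = z≤n
    AtLevel-mono (child _ p≺v lp _) root v≼x′ = ⊥-elim (AtLevel⇒≽ lp (≺-≼-trans p≺v v≼x′))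
    AtLevel-mono (child {p = p} {v} (v~p , p≼) p≺v lp _) (child {p = q} {w} (w~q , q≼) q≺w lq _) v≼w =
      s≤s (AtLevel-mono lp lq p≼q)
      where
      p≼q : p ≼ q
      p≼q q≺p with x , v~x , x≼q ← early-neighbour (≺-trans q≺p p≺v) v≼w (~-sym w~q) = p≼ x v~x (≼-≺-trans x≼q q≺p)

    -- The parent of `v` is at most its neighbour `u`, so by monotonicity its level is at most that
    -- of `u`.
    AtLevel-step : ∀ {m n u v} → AtLevel m u → u ~ v → AtLevel n v → n ≤ suc m
    AtLevel-step lu u~v root                      = z≤n
    AtLevel-step lu u~v (child (_ , p≼) _ lp _) = s≤s (AtLevel-mono lp lu (p≼ _ (~-sym u~v)))

    -- Time changes by one along every edge, so it has the parity of the level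
    -- and agrees with it only along paths directed forwards in time.
    AtLevel-time : ∀ {n v} → AtLevel n v → ∃ λ e → n ≡ time v + 2 * e × (e ≡ 0 → Path _↝_ x′ (time v) v)
    AtLevel-time root = 0 , sym (trans (ℕ.+-identityʳ _) time-x′) , λ _ → subst (λ n → Path _↝_ x′ n x′) (sym time-x′) []
    AtLevel-time (child {n} {p} {v} (v~p , _) p≺v lp v≡) with AtLevel-time lp
    ... | e , n≡ , path with ~-cases v~p
    ... | inj₂ (inj₁ (refl , refl)) = ⊥-elim (x≢x′ v≡)
    ... | inj₂ (inj₂ (refl , refl)) = ⊥-elim (x≢x′ (AtLevel⇒side lp))
    ... | inj₁ (_ , inj₂ p↝v) = e , trans (cong suc n≡) (cong (_+ 2 * e) (sym (↝-time p↝v))) ,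
            λ e≡0 → subst (λ n → Path _↝_ x′ n v) (sym (↝-time p↝v)) (path e≡0 ▻ p↝v)
    ... | inj₁ (_ , inj₁ v↝p) = suc e , eq , λ ()
      where
      eq : suc n ≡ time v + 2 * suc e
      eq rewrite n≡ | ↝-time v↝p | ℕ.+-suc e (e + 0) | ℕ.+-suc (time v) (suc (e + (e + 0))) | ℕ.+-suc (time v) (e + (e + 0)) = refl

    Path-side : ∀ {n v} → Path _↝_ x′ n v → side v ≡ side x′
    Path-side []       = refl
    Path-side (π ▻ e) = trans (↝-side e) (Path-side π)

    Path-time : ∀ {n v} → Path _↝_ x′ n v → time v ≡ n
    Path-time []       = time-x′
    Path-time (π ▻ e) = trans (↝-time e) (cong suc (Path-time π))

    Path-Star : ∀ {n v} → Path _↝_ x′ n v → Star _~_ x′ v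
    Path-Star []      = ε
    Path-Star (π ▻ e) = Path-Star π ◅◅ (↝⇒~ e ◅ ε)

    -- Two bounds meet: `AtLevel-step` bounds the level from above by the length of the path, and
    -- `AtLevel-time` bounds it from below by the clock value, which equals that length.
    Path-AtLevel : ∀ {n v} → Path _↝_ x′ n v → AtLevel n v
    Path-AtLevel [] = root
    Path-AtLevel (_▻_ {n} {v} {w} π e) with m , lw ← level (Path-Star (π ▻ e)) (Path-side (π ▻ e)) =
      subst (λ m → AtLevel m w) (ℕ.≤-antisym (AtLevel-step (Path-AtLevel π) (↝⇒~ e) lw) n<m) lw
      where
      n<m : suc n ≤ m
      n<m with k , m≡ , _ ← AtLevel-time lw = subst (suc n ≤_) (sym m≡) (subst (λ t → suc n ≤ t + 2 * k) (sym (Path-time (π ▻ e))) (ℕ.m≤m+n _ _))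

    -- The parent of the later vertex lies one level higher up in the tree, so by monotonicity it
    -- cannot come at or after the earlier vertex.
    sameLevel⇒common : ∀ {n v w} → AtLevel (suc n) v → AtLevel (suc n) w → CommonQuasiLevel v w
    sameLevel⇒common {v = v} {w} lv lw with compare v w
    ... | tri< v≺w _ _ = inj₁ (below lv lw , inj₁ v≺w)
      where
      below : ∀ {n v w} → AtLevel (suc n) v → AtLevel (suc n) w → ∃ λ p → LeastNeighbour p w × p ≺ v
      below {v = v} lv (child {p = p} least-p _ lp _) with p <? v
      ... | yes p≺v = p , Least⇒LeastNeighbour least-p , p≺v
      ... | no  v≼p = ⊥-elim (ℕ.<-irrefl refl (AtLevel-mono lv lp v≼p))
    ... | tri≈ _ refl _ with lw
    ...   | child least-p p≺w _ _ = inj₁ ((_ , Least⇒LeastNeighbour least-p , p≺w) , inj₂ refl)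
    sameLevel⇒common {v = v} {w} lv@(child {p = p} least-p _ lp _) lw | tri> _ _ w≺v with p <? w
    ... | yes p≺w = inj₂ ((p , Least⇒LeastNeighbour least-p , p≺w) , inj₁ w≺v)
    ... | no  w≼p = ⊥-elim (ℕ.<-irrefl refl (AtLevel-mono lw lp w≼p))

    -- A one-sided bound suffices, because the level of the target is already at least its clock
    -- value.
    common⇒close : ∀ {m n v w} → AtLevel (suc m) v → AtLevel (suc n) w → CommonQuasiLevel v w → n ≤ suc m
    common⇒close lv (child least-q _ lq _) (inj₁ ((p , least-p , p≺v) , _)) with refl ← Least-unique (LeastNeighbour⇒Least least-p) least-q = AtLevel-mono lq lv (≺⇒≼ p≺v)
    common⇒close lv lw (inj₂ (_ , w≼v)) = ℕ.m≤n⇒m≤1+n (ℕ.≤-pred (AtLevel-mono lw lv (cases-≼ w≼v)))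

    paths⇒common : ∀ {n v w} → Path _↝_ x′ (suc n) v → Path _↝_ x′ (suc n) w → CommonQuasiLevel v w
    paths⇒common π ρ = sameLevel⇒common (Path-AtLevel π) (Path-AtLevel ρ)

    common⇒path : ∀ {n v w} → Path _↝_ x′ (suc n) v → Star _~_ x′ w → side w ≡ side x′ → time w ≡ suc n →
                  CommonQuasiLevel v w → Path _↝_ x′ (suc n) w
    common⇒path {n} {v} {w} π x′⋆w w≡ t≡ common with level x′⋆w w≡
    ... | zero , root with () ← trans (sym time-x′) t≡
    ... | suc m , lw with AtLevel-time lw
    ...   | zero , _ , path = subst (λ k → Path _↝_ x′ k w) t≡ (path refl)
    -- A backward edge would put `w` at level `n + 3` or more, while `common⇒close` allows at most
    -- `n + 2`.
    ...   | suc e , m≡ , _ = ⊥-elim (ℕ.<-irrefl refl (ℕ.≤-<-trans (s≤s (common⇒close (Path-AtLevel π) lw common)) bound))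
      where
      bound : suc (suc n) < suc m
      bound rewrite m≡ | t≡ | ℕ.+-suc e (e + 0) | ℕ.+-suc n (suc (e + (e + 0))) | ℕ.+-suc n (e + (e + 0)) = s≤s (s≤s (s≤s (ℕ.m≤m+n n _)))

  -- The two copies, in either order of their roots

  module Criterion (side time : V → ℕ) (_↝_ : Rel V 0ℓ)
    (~-cases : ∀ {u v} → u ~ v → (side u ≡ side v × (u ↝ v ⊎ v ↝ u)) ⊎
                 ((u ≡ constantOf x₁ × v ≡ constantOf x₂) ⊎ (u ≡ constantOf x₂ × v ≡ constantOf x₁)))
    (↝-time : ∀ {u v} → u ↝ v → time v ≡ suc (time u))
    (↝-side : ∀ {u v} → u ↝ v → side v ≡ side u)
    (↝⇒~ : ∀ {u v} → u ↝ v → u ~ v)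
    (bridge : constantOf x₁ ~ constantOf x₂) (sides≢ : side (constantOf x₁) ≢ side (constantOf x₂))
    (side-z₁ : side (constantOf z₁) ≡ side (constantOf x₁)) (side-z₂ : side (constantOf z₂) ≡ side (constantOf x₂))
    (time-x₁ : time (constantOf x₁) ≡ 0) (time-x₂ : time (constantOf x₂) ≡ 0)
    {n : ℕ} (time-z₁ : time (constantOf z₁) ≡ suc n) (time-z₂ : time (constantOf z₂) ≡ suc n)
    (xy₁ : Path _↝_ (constantOf x₁) (suc n) (constantOf y₁)) (xy₂ : Path _↝_ (constantOf x₂) (suc n) (constantOf y₂)) where

    swap-cases : ∀ {u v} → u ~ v → (side u ≡ side v × (u ↝ v ⊎ v ↝ u)) ⊎
      ((u ≡ constantOf x₂ × v ≡ constantOf x₁) ⊎ (u ≡ constantOf x₁ × v ≡ constantOf x₂))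
    swap-cases u~v with ~-cases u~v
    ... | inj₁ h        = inj₁ h
    ... | inj₂ (inj₁ h) = inj₂ (inj₂ h)
    ... | inj₂ (inj₂ h) = inj₂ (inj₁ h)

    module Second = Entered side time _↝_ (constantOf x₁) (constantOf x₂) ~-cases ↝-time ↝-side ↝⇒~ bridge time-x₂ sides≢
    module First  = Entered side time _↝_ (constantOf x₂) (constantOf x₁) swap-cases ↝-time ↝-side ↝⇒~ (~-sym bridge) time-x₁ (λ eq → sides≢ (sym eq))

    path-star : ∀ {u v m} → Path _↝_ u m v → Star _~_ u v
    path-star []      = ε
    path-star (π ▻ e) = path-star π ◅◅ (↝⇒~ e ◅ ε)

    component : SameComponent → ∀ c c′ → Star _~_ (constantOf c) (constantOf c′)
    component same c c′ with compare (constantOf c) (constantOf c′)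
    ... | tri< c≺ _ _ = connected (≺⇒≼ c≺) (λ {r} root c≺r r≼ → same c c′ c≺ (r , root , c≺r , ≼-cases r≼))
    ... | tri≈ _ c≡ _ = subst (Star _~_ (constantOf c)) c≡ ε
    ... | tri> _ _ ≺c = reverse ~-sym (connected (≺⇒≼ ≺c) (λ {r} root c≺r r≼ → same c′ c ≺c (r , root , c≺r , ≼-cases r≼)))

    module _ (xz₁ : Path _↝_ (constantOf x₁) (suc n) (constantOf z₁)) (xz₂ : Path _↝_ (constantOf x₂) (suc n) (constantOf z₂)) where

      from-x₁ : ∀ c → Star _~_ (constantOf x₁) (constantOf c)
      from-x₁ x₁ = ε
      from-x₁ y₁ = path-star xy₁
      from-x₁ z₁ = path-star xz₁
      from-x₁ x₂ = bridge ◅ ε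
      from-x₁ y₂ = bridge ◅ path-star xy₂
      from-x₁ z₂ = bridge ◅ path-star xz₂

      paths⇒Ψ : Ψ
      paths⇒Ψ = (λ c c′ _ (r , root-r , c≺r , r≼c′) → root-r (crossed (reverse ~-sym (from-x₁ c) ◅◅ from-x₁ c′) c≺r (cases-≼ r≼c′))) ,
                (λ x≺ → Second.paths⇒common x≺ xy₂ xz₂) , (λ x≺ → First.paths⇒common x≺ xy₁ xz₁)

    -- Only the copy whose root is visited second is known to be traversed breadth-first from that
    -- root, so the path is obtained in that copy alone.
    Ψ⇒path : Ψ → Path _↝_ (constantOf x₁) (suc n) (constantOf z₁) ⊎ Path _↝_ (constantOf x₂) (suc n) (constantOf z₂)
    Ψ⇒path (same , q₂ , q₁) with compare (constantOf x₁) (constantOf x₂)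
    ... | tri< x≺ _ _ = inj₂ (Second.common⇒path x≺ xy₂ (component same x₂ z₂) side-z₂ time-z₂ (q₂ x≺))
    ... | tri≈ _ x≡ _ = ⊥-elim (sides≢ (cong side x≡))
    ... | tri> _ _ x≺ = inj₁ (First.common⇒path x≺ xy₁ (component same x₁ z₁) side-z₁ time-z₁ (q₁ x≺))

-- Simulating a machine by bounded registers

infix 9 _‼_

_‼_ : {A : Set} → List A → ℕ → Maybe A
[]       ‼ _     = nothing
(x ∷ xs) ‼ zero  = just x
(x ∷ xs) ‼ suc i = xs ‼ i

‼-++ˡ : {A : Set} (xs ys : List A) {i : ℕ} → i < length xs → (xs ++ ys) ‼ i ≡ xs ‼ i
‼-++ˡ (x ∷ xs) ys {zero}  _       = refl
‼-++ˡ (x ∷ xs) ys {suc i} (s≤s p) = ‼-++ˡ xs ys p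

‼-++ʳ : {A : Set} (xs ys : List A) (i : ℕ) → (xs ++ ys) ‼ (length xs + i) ≡ ys ‼ i
‼-++ʳ []       ys i = refl
‼-++ʳ (x ∷ xs) ys i = ‼-++ʳ xs ys i

‼-map : {A B : Set} (f : A → B) (xs : List A) (i : ℕ) → List.map f xs ‼ i ≡ Maybe.map f (xs ‼ i)
‼-map f []       i       = refl
‼-map f (x ∷ xs) zero    = refl
‼-map f (x ∷ xs) (suc i) = ‼-map f xs i

‼⇒< : {A : Set} (xs : List A) (i : ℕ) {x : A} → xs ‼ i ≡ just x → i < length xs
‼⇒< (x ∷ xs) zero    _ = s≤s z≤n
‼⇒< (x ∷ xs) (suc i) p = s≤s (‼⇒< xs i p)

offset : {A : Set} {m : ℕ} → (Fin m → List A) → Fin m → ℕ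
offset F zero    = 0
offset F (suc i) = length (F zero) + offset (F ∘ suc) i

module _ {A : Set} where

  offset-‼ : ∀ {m} (F : Fin m → List A) i {v} → v < length (F i) → concat (tabulate F) ‼ (offset F i + v) ≡ F i ‼ v
  offset-‼ F zero    v< = ‼-++ˡ (F zero) _ v<
  offset-‼ F (suc i) {v} v<
    rewrite ℕ.+-assoc (length (F zero)) (offset (F ∘ suc) i) v
    = trans (‼-++ʳ (F zero) _ (offset (F ∘ suc) i + v)) (offset-‼ (F ∘ suc) i v<)

  offset-suc : ∀ {m} (F : Fin (suc m) → List A) k → offset F (suc k) ≡ offset F (inject₁ k) + length (F (inject₁ k))
  offset-suc F zero    = ℕ.+-comm (length (F zero)) 0
  offset-suc F (suc k) = trans (cong (length (F zero) +_) (offset-suc (F ∘ suc) k)) (sym (ℕ.+-assoc (length (F zero)) _ _))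

  offset-≤ : ∀ {m} (F : Fin m → List A) i → offset F i + length (F i) ≤ length (concat (tabulate F))
  offset-≤ F zero    rewrite List.length-++ (F zero) {concat (tabulate (F ∘ suc))} = ℕ.m≤m+n _ _
  offset-≤ F (suc i) rewrite List.length-++ (F zero) {concat (tabulate (F ∘ suc))} | ℕ.+-assoc (length (F zero)) (offset (F ∘ suc) i) (length (F (suc i)))
    = ℕ.+-monoʳ-≤ (length (F zero)) (offset-≤ (F ∘ suc) i)

  offset-last : ∀ {m} (F : Fin (suc m) → List A) → offset F (fromℕ m) + length (F (fromℕ m)) ≡ length (concat (tabulate F))
  offset-last {zero}  F = cong length (sym (List.++-identityʳ (F zero)))
  offset-last {suc m} F = trans (ℕ.+-assoc (length (F zero)) _ _) (trans (cong (length (F zero) +_) (offset-last (F ∘ suc))) (sym (List.length-++ (F zero))))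

toℕ-nextFin-< : ∀ {n} (p : Fin n) → suc (toℕ p) < n → toℕ (nextFin p) ≡ suc (toℕ p)
toℕ-nextFin-< {suc zero}    zero    (s≤s ())
toℕ-nextFin-< {suc (suc n)} zero    _       = refl
toℕ-nextFin-< {suc (suc n)} (suc i) (s≤s p) = cong suc (toℕ-nextFin-< i p)

nextFin-last : ∀ {n} (p : Fin n) → suc (toℕ p) ≡ n → nextFin p ≡ p
nextFin-last {suc zero}    zero    _  = refl
nextFin-last {suc (suc n)} (suc i) eq = cong suc (nextFin-last i (ℕ.suc-injective eq))

toℕ-pred : ∀ {n} (p : Fin n) → toℕ (Fin.pred p) ≡ ℕ.pred (toℕ p)
toℕ-pred zero    = refl
toℕ-pred (suc i) = Fin.toℕ-inject₁ i

tapeSymbols : List Bool → List InputSymbol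
tapeSymbols w = ▷ ∷ List.map bit w ++ ◁ ∷ []

readInput-‼ : ∀ w p → tapeSymbols w ‼ toℕ p ≡ just (readInput w p)
readInput-‼ w       zero          = refl
readInput-‼ []      (suc zero)    = refl
readInput-‼ (b ∷ w) (suc zero)    = refl
readInput-‼ (b ∷ w) (suc (suc i)) = readInput-‼ w (suc i)

length-tapeSymbols : ∀ w → length (tapeSymbols w) ≡ 2 + length w
length-tapeSymbols w rewrite List.length-++ (List.map bit w) {◁ ∷ []} | List.length-map bit w | ℕ.+-comm (length w) 1 = refl

-- Register contents, conditions on them, and the program

Node : Set
Node = Vec ℕ 10

pattern copyR  = zero
pattern modeR  = suc zero
pattern stateR = suc (suc zero)
pattern secR   = suc (suc (suc zero))
pattern auxR   = suc (suc (suc (suc zero)))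
pattern dirR   = suc (suc (suc (suc (suc zero))))
pattern headR  = suc (suc (suc (suc (suc (suc zero)))))
pattern xR     = suc (suc (suc (suc (suc (suc (suc zero))))))
pattern yR     = suc (suc (suc (suc (suc (suc (suc (suc zero)))))))
pattern tempR  = suc (suc (suc (suc (suc (suc (suc (suc (suc zero))))))))

data Ref : Set where
  old new : Fin 10 → Ref

infixr 6 _∧ᶜ_
infixr 5 _∨ᶜ_
infix  7 _≈ᶜ_

-- Numerals are below the constant bound, so that they denote elements of
-- every structure with at least bound elements.
data Cond (#sec bound : ℕ) : Set where
  is        : ∀ {m} → m ≤ bound → Ref → Fin m → Cond #sec bound
  _≈ᶜ_ sucᶜ : Ref → Ref → Cond #sec bound
  topᶜ      : Fin #sec → Ref → Cond #sec bound
  readᶜ     : Fin #sec → InputSymbol → Ref → Cond #sec bound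
  ¬ᶜ        : Cond #sec bound → Cond #sec bound
  _∧ᶜ_ _∨ᶜ_ : Cond #sec bound → Cond #sec bound → Cond #sec bound
  ⋁ᶜ        : ∀ m → (Fin m → Cond #sec bound) → Cond #sec bound

registerValue : Node → Node → Ref → ℕ
registerValue u u′ (old r) = Vec.lookup u r
registerValue u u′ (new r) = Vec.lookup u′ r

module _ {#sec bound : ℕ} (section : Fin #sec → List InputSymbol) where

  Holds : Cond #sec bound → Node → Node → Set
  Holds (is _ r i)    u u′ = registerValue u u′ r ≡ toℕ i
  Holds (r ≈ᶜ r′)     u u′ = registerValue u u′ r ≡ registerValue u u′ r′
  Holds (sucᶜ r r′)   u u′ = registerValue u u′ r′ ≡ suc (registerValue u u′ r)
  Holds (topᶜ i r)    u u′ = suc (registerValue u u′ r) ≡ length (section i)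
  Holds (readᶜ i ι r) u u′ = section i ‼ registerValue u u′ r ≡ just ι
  Holds (¬ᶜ c)        u u′ = ¬ Holds c u u′
  Holds (c ∧ᶜ d)      u u′ = Holds c u u′ × Holds d u u′
  Holds (c ∨ᶜ d)      u u′ = Holds c u u′ ⊎ Holds d u u′
  Holds (⋁ᶜ m c)      u u′ = ∃ λ i → Holds (c i) u u′

inputSymbol : Fin 4 → InputSymbol
inputSymbol zero                   = ▷
inputSymbol (suc zero)             = ◁
inputSymbol (suc (suc zero))       = bit true
inputSymbol (suc (suc (suc zero))) = bit false

inputSymbol⁻¹ : ∀ ι → ∃ λ i → inputSymbol i ≡ ι
inputSymbol⁻¹ ▷           = zero , refl
inputSymbol⁻¹ ◁           = suc zero , refl
inputSymbol⁻¹ (bit true)  = suc (suc zero) , refl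
inputSymbol⁻¹ (bit false) = suc (suc (suc zero)) , refl

-- The work tape is kept as two stacks, coded in base B with the digit suc a
-- for the symbol a, so that 0 codes the empty stack only. In mode 0 the
-- registers X, Y hold the cells left and right of the head and aux the scanned
-- symbol. Mode 1 pushes the digit initially in temp on X by iterating
-- X ≔ X − 1, temp ≔ temp + B; mode 2 pops Y by iterating Y ≔ Y − B,
-- temp ≔ temp + 1; aux counts from 0 to B in both. For a move to the left
-- (dir = 1) the two stacks are exchanged before and after.
module Program (M : Machine) (#sec′ : ℕ) where
  open Machine M

  -- `bound` is a sum so that each range of numerals (modes, states, sections, digits) is below it
  -- by dropping summands. It later serves as the threshold for sufficiently large structures.
  B #sec bound : ℕ
  B     = 2 + #symbols
  #sec  = suc #sec′
  bound = 4 + (#states + (#sec + B))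

  C : Set
  C = Cond #sec bound

  mode≤ : 4 ≤ bound
  mode≤ = ℕ.m≤m+n 4 _

  dir≤ : 2 ≤ bound
  dir≤ = ℕ.m≤m+n 2 _

  state≤ : #states ≤ bound
  state≤ = ℕ.≤-trans (ℕ.m≤m+n #states _) (ℕ.m≤n+m _ 4)

  sec≤ : #sec ≤ bound
  sec≤ = ℕ.≤-trans (ℕ.m≤m+n #sec _) (ℕ.≤-trans (ℕ.m≤n+m _ #states) (ℕ.m≤n+m _ 4))

  B≤ : B ≤ bound
  B≤ = ℕ.≤-trans (ℕ.m≤n+m B #sec) (ℕ.≤-trans (ℕ.m≤n+m _ #states) (ℕ.m≤n+m _ 4))

  symbol≤ : suc #symbols ≤ bound
  symbol≤ = ℕ.≤-trans (ℕ.n≤1+n _) B≤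

  isMode : Ref → Fin 4 → C
  isMode = is mode≤

  is0 : Ref → C
  is0 r = is dir≤ r zero

  keep : Fin 10 → C
  keep r = new r ≈ᶜ old r

  reads : InputSymbol → C
  reads ι = ⋁ᶜ #sec λ i → is sec≤ (old secR) i ∧ᶜ readᶜ i ι (old headR)

  -- The two positions are parameters, so a move to the left is `next` with old and new exchanged.
  -- The first alternative stays within a section, the second crosses to the start of the following
  -- one. In `moves`, the alternatives beside `next` treat a head stopped by an end of the tape.
  next : (Fin 10 → Ref) → (Fin 10 → Ref) → C
  next here there =
       (⋁ᶜ #sec λ i → is sec≤ (here secR) i ∧ᶜ is sec≤ (there secR) i ∧ᶜ ¬ᶜ (topᶜ i (here headR)) ∧ᶜ sucᶜ (here headR) (there headR))
    ∨ᶜ (⋁ᶜ #sec′ λ k → is sec≤ (here secR) (inject₁ k) ∧ᶜ topᶜ (inject₁ k) (here headR) ∧ᶜ is sec≤ (there secR) (suc k) ∧ᶜ is0 (there headR))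

  moves : Move → C
  moves left  = next new old ∨ᶜ is0 (old secR) ∧ᶜ is0 (old headR) ∧ᶜ is0 (new secR) ∧ᶜ is0 (new headR)
  moves stay  = keep secR ∧ᶜ keep headR
  moves right = next old new ∨ᶜ is sec≤ (old secR) (fromℕ #sec′) ∧ᶜ topᶜ (fromℕ #sec′) (old headR) ∧ᶜ keep secR ∧ᶜ keep headR

  settled : Symbol → C
  settled s = isMode (new modeR) zero ∧ᶜ is symbol≤ (new auxR) s ∧ᶜ keep xR ∧ᶜ keep yR ∧ᶜ is0 (new tempR)

  pushing : Symbol → Fin 2 → C
  pushing s d = isMode (new modeR) (suc zero) ∧ᶜ is0 (new auxR) ∧ᶜ is dir≤ (new dirR) d ∧ᶜ is B≤ (new tempR) (suc s)

  works : Symbol → Move → C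
  works s stay  = settled s
  works s right = pushing s zero ∧ᶜ keep xR ∧ᶜ keep yR
  -- An empty left stack means that the head is at the left end of the work tape, where a left move
  -- leaves it.
  works s left  = is0 (old xR) ∧ᶜ settled s
               ∨ᶜ ¬ᶜ (is0 (old xR)) ∧ᶜ pushing s (suc zero) ∧ᶜ new xR ≈ᶜ old yR ∧ᶜ new yR ≈ᶜ old xR

  acts : State → Symbol → InputSymbol → Action → C
  acts q a ι (q′ , s , mi , mw) =
    isMode (old modeR) zero ∧ᶜ is state≤ (old stateR) q ∧ᶜ is symbol≤ (old auxR) a ∧ᶜ reads ι ∧ᶜ
    is state≤ (new stateR) q′ ∧ᶜ moves mi ∧ᶜ works s mw ∧ᶜ keep copyR

  fromMain : C
  fromMain = ⋁ᶜ #states λ q → ⋁ᶜ (suc #symbols) λ a → ⋁ᶜ 4 λ ι →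
    ⋁ᶜ (length (δ q (inputSymbol ι) a)) λ k → acts q a (inputSymbol ι) (List.lookup (δ q (inputSymbol ι) a) k)

  keepControl : C
  keepControl = keep copyR ∧ᶜ keep stateR ∧ᶜ keep secR ∧ᶜ keep headR

  lastDigit : Fin B
  lastDigit = fromℕ (suc #symbols)

  -- Counting remains possible at the last digit. A run that counts past it can never reset `aux`,
  -- and leaving the phase requires `aux` to be 0, so such a run never completes the push.
  fromPush : C
  fromPush = isMode (old modeR) (suc zero) ∧ᶜ keepControl ∧ᶜ keep dirR ∧ᶜ keep yR ∧ᶜ
    (  isMode (new modeR) (suc zero) ∧ᶜ sucᶜ (old auxR) (new auxR) ∧ᶜ sucᶜ (old tempR) (new tempR) ∧ᶜ keep xR
    ∨ᶜ isMode (new modeR) (suc zero) ∧ᶜ is B≤ (old auxR) lastDigit ∧ᶜ is0 (new auxR) ∧ᶜ sucᶜ (old tempR) (new tempR) ∧ᶜ sucᶜ (new xR) (old xR)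
    ∨ᶜ isMode (new modeR) (suc (suc zero)) ∧ᶜ is0 (old auxR) ∧ᶜ is0 (new auxR) ∧ᶜ is0 (old xR) ∧ᶜ new xR ≈ᶜ old tempR ∧ᶜ is0 (new tempR))

  exchanges : C
  exchanges = is dir≤ (old dirR) zero ∧ᶜ new xR ≈ᶜ old xR ∧ᶜ new yR ≈ᶜ old tempR
           ∨ᶜ is dir≤ (old dirR) (suc zero) ∧ᶜ new xR ≈ᶜ old tempR ∧ᶜ new yR ≈ᶜ old xR

  -- Here `temp` is the quotient by `B` and `Y` the remainder. Digits are nonzero, so remainder 0 is
  -- legitimate only together with quotient 0: the stack was empty and the cell is blank.
  popped : C
  popped = (⋁ᶜ (suc #symbols) λ a → is B≤ (old yR) (suc a) ∧ᶜ is symbol≤ (new auxR) a)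
        ∨ᶜ is0 (old yR) ∧ᶜ is0 (old tempR) ∧ᶜ is0 (new auxR)

  fromPop : C
  fromPop = isMode (old modeR) (suc (suc zero)) ∧ᶜ keepControl ∧ᶜ
    (  isMode (new modeR) (suc (suc zero)) ∧ᶜ keep dirR ∧ᶜ keep xR ∧ᶜ sucᶜ (old auxR) (new auxR) ∧ᶜ sucᶜ (new yR) (old yR) ∧ᶜ keep tempR
    ∨ᶜ isMode (new modeR) (suc (suc zero)) ∧ᶜ keep dirR ∧ᶜ keep xR ∧ᶜ is B≤ (old auxR) lastDigit ∧ᶜ is0 (new auxR) ∧ᶜ sucᶜ (new yR) (old yR) ∧ᶜ sucᶜ (old tempR) (new tempR)
    ∨ᶜ isMode (new modeR) zero ∧ᶜ is0 (old auxR) ∧ᶜ is0 (new tempR) ∧ᶜ exchanges ∧ᶜ popped)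

  -- Clearing the registers lets all accepting runs of a copy end in one vertex, which a constant
  -- can name.
  halts : C
  halts = isMode (old modeR) zero ∧ᶜ is state≤ (old stateR) accept ∧ᶜ keep copyR ∧ᶜ isMode (new modeR) (suc (suc (suc zero))) ∧ᶜ
    is0 (new stateR) ∧ᶜ is0 (new secR) ∧ᶜ is0 (new auxR) ∧ᶜ is0 (new dirR) ∧ᶜ is0 (new headR) ∧ᶜ is0 (new xR) ∧ᶜ is0 (new yR) ∧ᶜ is0 (new tempR)

  stepᶜ : C
  stepᶜ = fromMain ∨ᶜ fromPush ∨ᶜ fromPop ∨ᶜ halts

  startNode finalNode : ℕ → Node
  startNode c = c ∷ 0 ∷ toℕ start ∷ 0 ∷ 0 ∷ 0 ∷ 0 ∷ 0 ∷ 0 ∷ 0 ∷ []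
  finalNode c = c ∷ 3 ∷ 0 ∷ 0 ∷ 0 ∷ 0 ∷ 0 ∷ 0 ∷ 0 ∷ 0 ∷ []

-- Configurations as zippers

module Zipper (M : Machine) (w : List Bool) where
  open Machine M
  open Config

  cell : List Symbol → ℕ → Symbol
  cell []       _       = zero
  cell (a ∷ as) zero    = a
  cell (a ∷ as) (suc j) = cell as j

  record Zip : Set where
    constructor zip
    field
      st    : State
      pos   : Fin (2 + length w)
      lefts : List Symbol
      here  : Symbol
      rights : List Symbol

  record Represents (z : Zip) (c : Config M w) : Set where
    constructor reps
    open Zip z
    field
      state≡ : state c ≡ st
      head≡  : inputHead c ≡ pos
      work≡  : workHead c ≡ length lefts
      tape≡  : ∀ j → workTape c j ≡ cell (lefts ʳ++ here ∷ rights) j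

  -- The outcome of a push followed by a pop: the scanned cell comes off the second stack, blank if
  -- that is empty, and `d` tells whether the stacks are exchanged back.
  settle : Fin 2 → State → Fin (2 + length w) → List Symbol → List Symbol → Zip
  settle zero       q p xs []       = zip q p xs zero []
  settle zero       q p xs (a ∷ ys) = zip q p xs a ys
  settle (suc zero) q p xs []       = zip q p [] zero xs
  settle (suc zero) q p xs (a ∷ ys) = zip q p ys a xs

  performZ : Action → Zip → Zip
  performZ (q′ , s , mi , stay)  (zip q p ls a rs)        = zip q′ (moveInput mi p) ls s rs
  performZ (q′ , s , mi , right) (zip q p ls a rs)        = settle zero q′ (moveInput mi p) (s ∷ ls) rs
  performZ (q′ , s , mi , left)  (zip q p [] a rs)        = zip q′ (moveInput mi p) [] s rs
  performZ (q′ , s , mi , left)  (zip q p (a′ ∷ ls) a rs) = settle (suc zero) q′ (moveInput mi p) (s ∷ rs) (a′ ∷ ls)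

  cell-ʳ++ : ∀ ls ys k → cell (ls ʳ++ ys) (length ls + k) ≡ cell ys k
  cell-ʳ++ []       ys k = refl
  cell-ʳ++ (a ∷ ls) ys k = trans (cong (cell (ls ʳ++ a ∷ ys)) (sym (ℕ.+-suc (length ls) k))) (cell-ʳ++ ls (a ∷ ys) (suc k))

  cell-here : ∀ ls a rs → cell (ls ʳ++ a ∷ rs) (length ls) ≡ a
  cell-here ls a rs = trans (cong (cell (ls ʳ++ a ∷ rs)) (sym (ℕ.+-identityʳ (length ls)))) (cell-ʳ++ ls (a ∷ rs) 0)

  cell-cong : ∀ ls {ys ys′} → (∀ j → cell ys j ≡ cell ys′ j) → ∀ j → cell (ls ʳ++ ys) j ≡ cell (ls ʳ++ ys′) j
  cell-cong []       eq = eq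
  cell-cong (a ∷ ls) eq = cell-cong ls λ { zero → refl ; (suc j) → eq j }

  cell-write : ∀ ls {ys ys′ s} k → (∀ j → (if does (j ℕ.≟ k) then s else cell ys j) ≡ cell ys′ j) →
               ∀ j → (if does (j ℕ.≟ length ls + k) then s else cell (ls ʳ++ ys) j) ≡ cell (ls ʳ++ ys′) j
  cell-write []       k eq = eq
  cell-write (a ∷ ls) {ys} {ys′} {s} k eq j = subst (λ m → (if does (j ℕ.≟ m) then s else cell (ls ʳ++ a ∷ ys) j) ≡ cell (ls ʳ++ a ∷ ys′) j)
    (ℕ.+-suc (length ls) k) (cell-write ls (suc k) (λ { zero → refl ; (suc j) → eq j }) j)

  written : ∀ {z c} → Represents z c → let open Zip z in ∀ s j →
            (if does (j ℕ.≟ workHead c) then s else workTape c j) ≡ cell (lefts ʳ++ s ∷ rights) j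
  written {zip q p ls a rs} {config _ _ _ tape} (reps refl refl refl tape≡) s j
    rewrite tape≡ j
    = subst (λ m → (if does (j ℕ.≟ m) then s else cell (ls ʳ++ a ∷ rs) j) ≡ cell (ls ʳ++ s ∷ rs) j)
            (ℕ.+-identityʳ (length ls)) (cell-write ls 0 (λ { zero → refl ; (suc j) → refl }) j)

  represents-perform : ∀ act {z c} → Represents z c → Represents (performZ act z) (perform M act c)
  represents-perform (q′ , s , mi , stay)  {zip q p ls a rs} r@(reps refl refl refl _) = reps refl refl refl (written r s)
  represents-perform (q′ , s , mi , right) {zip q p ls a []} r@(reps refl refl refl _) =
    reps refl refl refl λ j → trans (written r s j) (cell-cong ls {s ∷ []} {s ∷ zero ∷ []} (λ { zero → refl ; (suc zero) → refl ; (suc (suc _)) → refl }) j)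
  represents-perform (q′ , s , mi , right) {zip q p ls a (b ∷ rs)} r@(reps refl refl refl _) = reps refl refl refl (written r s)
  represents-perform (q′ , s , mi , left) {zip q p [] a rs} r@(reps refl refl refl _) = reps refl refl refl (written r s)
  represents-perform (q′ , s , mi , left) {zip q p (b ∷ ls) a rs} r@(reps refl refl refl _) = reps refl refl refl (written r s)

  represents-scan : ∀ {z c} → Represents z c → workTape c (workHead c) ≡ Zip.here z
  represents-scan {zip q p ls a rs} (reps refl refl refl tape≡) = trans (tape≡ _) (cell-here ls a rs)

  represents-enabled : ∀ {z c} → Represents z c → let open Zip z in enabled M c ≡ δ st (readInput w pos) here
  represents-enabled {zip q p ls a rs} {config _ _ _ tape} r@(reps refl refl refl _) = cong (δ q (readInput w p)) (represents-scan r)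

  represents-initial : Represents (zip start zero [] zero []) (initial M w)
  represents-initial = reps refl refl refl λ { zero → refl ; (suc j) → refl }

  Runs : Zip → Set
  Runs z = ∃ λ c → Reachable M c × Represents z c

  runs-perform : ∀ {act z} → act ∈ δ (Zip.st z) (readInput w (Zip.pos z)) (Zip.here z) → Runs z → Runs (performZ act z)
  runs-perform {act} act∈ (c , reachable , r) =
    perform M act c , reachable ◅◅ (step (subst (act ∈_) (sym (represents-enabled r)) act∈) ◅ ε) , represents-perform act r

  cells : Zip → ℕ
  cells (zip _ _ ls _ rs) = suc (length ls + length rs)

  -- The zipper grows only when the head moves right from its last cell. The new number of cells is
  -- then one more than the new head position, which the space bound keeps below `ℓ`.
  cells-perform : ∀ act {z c} ℓ → Represents z c → cells z ≤ ℓ → workHead (perform M act c) < ℓ → cells (performZ act z) ≤ ℓ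
  cells-perform (q′ , s , mi , stay)  {zip q p ls a rs} ℓ _ fits _ = fits
  cells-perform (q′ , s , mi , right) {zip q p ls a []} ℓ (reps refl refl refl _) fits h< = subst (_≤ ℓ) (cong suc (sym (ℕ.+-identityʳ _))) h<
  cells-perform (q′ , s , mi , right) {zip q p ls a (b ∷ rs)} ℓ _ fits _ = subst (_≤ ℓ) (cong suc (ℕ.+-suc (length ls) (length rs))) fits
  cells-perform (q′ , s , mi , left) {zip q p [] a rs} ℓ _ fits _ = fits
  cells-perform (q′ , s , mi , left) {zip q p (b ∷ ls) a rs} ℓ _ fits _ = subst (_≤ ℓ) (cong suc (sym (ℕ.+-suc (length ls) (length rs)))) fits

-- Stacks as numbers

carry : ∀ B r t → B + (r + B * t) ≡ r + B * suc t
carry = solve-∀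

-- Uniqueness of remainder and quotient. It serves both for stacks in base `B` and for tuples, where
-- the base is a power of the size of the structure.
digit-unique : ∀ B {r r′} t t′ → r < B → r′ < B → r + B * t ≡ r′ + B * t′ → r ≡ r′ × t ≡ t′
digit-unique B {r} {r′} zero zero _ _ eq = ℕ.+-cancelʳ-≡ (B * 0) r r′ eq , refl
digit-unique B {r} {r′} zero (suc t′) r< _ eq = ⊥-elim (ℕ.<⇒≱ (subst (_< B) (sym (trans (cong (r +_) (ℕ.*-zeroʳ B)) (ℕ.+-identityʳ r))) r<)
  (subst (B ≤_) (trans (carry B r′ t′) (sym eq)) (ℕ.m≤m+n B _)))
digit-unique B (suc t) zero r< r′< eq with () ← proj₂ (digit-unique B zero (suc t) r′< r< (sym eq))
digit-unique B {r} {r′} (suc t) (suc t′) r< r′< eq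
  with r≡ , t≡ ← digit-unique B t t′ r< r′< (ℕ.+-cancelˡ-≡ B _ _ (trans (carry B r t) (trans eq (sym (carry B r′ t′))))) = r≡ , cong suc t≡

module Coding (#symbols : ℕ) where

  B : ℕ
  B = 2 + #symbols

  code : List (Fin (suc #symbols)) → ℕ
  code []       = 0
  code (a ∷ as) = suc (toℕ a) + B * code as

  code-< : ∀ as → code as < B ^ length as
  code-< []       = s≤s z≤n
  code-< (a ∷ as) = begin-strict
    suc (toℕ a) + B * code as <⟨ ℕ.+-monoˡ-< (B * code as) (s≤s (Fin.toℕ<n a)) ⟩
    B + B * code as           ≡⟨ ℕ.*-suc B (code as) ⟨
    B * suc (code as)         ≤⟨ ℕ.*-monoʳ-≤ B (code-< as) ⟩
    B * B ^ length as         ∎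
    where open ℕ.≤-Reasoning

  code-pop : ∀ as a t → suc (toℕ a) + B * t ≡ code as → ∃ λ as′ → as ≡ a ∷ as′ × t ≡ code as′
  code-pop (a′ ∷ as) a t eq with a≡ , t≡ ← digit-unique B t (code as) (s≤s (Fin.toℕ<n a)) (s≤s (Fin.toℕ<n a′)) eq
    = as , cong (_∷ as) (Fin.toℕ-injective (sym (ℕ.suc-injective a≡))) , t≡

  code-empty : ∀ as → 0 ≡ code as → as ≡ []
  code-empty []       _ = refl

-- Soundness: the program reaches only what the machine reaches

module Simulation (M : Machine) (w : List Bool) (#sec′ : ℕ) (section : Fin (suc #sec′) → List InputSymbol)
  (tape≡ : tapeSymbols w ≡ concat (tabulate section)) (nonempty : ∀ i → 0 < length (section i)) where
  open Machine M
  open Program M #sec′ hiding (B)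
  open Zipper M w
  open Coding #symbols

  _⊢_⇒_ : C → Node → Node → Set
  c ⊢ u ⇒ u′ = Holds section c u u′

  record Located (i : Fin #sec) (v : ℕ) (p : Fin (2 + length w)) : Set where
    constructor located
    field
      inside : v < length (section i)
      place  : toℕ p ≡ offset section i + v

  length-tape : length (concat (tabulate section)) ≡ 2 + length w
  length-tape = trans (cong length (sym tape≡)) (length-tapeSymbols w)

  located-read : ∀ {i v p} → Located i v p → section i ‼ v ≡ just (readInput w p)
  located-read {i} {v} {p} (located v< p≡) = trans (sym (offset-‼ section i v<))
    (trans (cong₂ _‼_ (sym tape≡) (sym p≡)) (readInput-‼ w p))

  located-start : Located zero 0 zero
  located-start = located (nonempty zero) refl

  inside-tape : ∀ i {v} → v < length (section i) → offset section i + v < 2 + length w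
  inside-tape i v< = ℕ.<-≤-trans (ℕ.+-monoʳ-< _ v<) (ℕ.≤-trans (offset-≤ section i) (ℕ.≤-reflexive length-tape))

  Next : (i v i′ v′ : ℕ) → Set
  Next x v x′ v′ = (∃ λ i → x ≡ toℕ i × x′ ≡ toℕ i × ¬ (suc v ≡ length (section i)) × v′ ≡ suc v)
                 ⊎ (∃ λ k → x ≡ toℕ (inject₁ k) × suc v ≡ length (section (inject₁ k)) × x′ ≡ toℕ {#sec} (suc k) × v′ ≡ 0)

  offset-cross : ∀ k {v} → suc v ≡ length (section (inject₁ k)) → offset section (suc k) + 0 ≡ suc (offset section (inject₁ k) + v)
  offset-cross k {v} top rewrite offset-suc section k | sym top | ℕ.+-identityʳ (offset section (inject₁ k) + suc v) = ℕ.+-suc _ v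

  next-forward : ∀ {i v x′ v′} → v < length (section i) → Next (toℕ i) v x′ v′ →
    ∃ λ i′ → x′ ≡ toℕ i′ × v′ < length (section i′) × offset section i′ + v′ ≡ suc (offset section i + v)
  next-forward v< (inj₁ (i′ , i≡ , x′≡ , ¬top , refl)) with refl ← Fin.toℕ-injective i≡ =
    i′ , x′≡ , ℕ.≤∧≢⇒< v< ¬top , ℕ.+-suc _ _
  next-forward v< (inj₂ (k , i≡ , top , x′≡ , refl)) with refl ← Fin.toℕ-injective i≡ =
    suc k , x′≡ , nonempty (suc k) , offset-cross k top

  next-backward : ∀ {i v x′ v′} → v < length (section i) → Next x′ v′ (toℕ i) v →
    ∃ λ i′ → x′ ≡ toℕ i′ × v′ < length (section i′) × suc (offset section i′ + v′) ≡ offset section i + v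
  next-backward v< (inj₁ (i′ , x′≡ , i≡ , _ , refl)) with refl ← Fin.toℕ-injective i≡ =
    i′ , x′≡ , ℕ.<-trans (ℕ.n<1+n _) v< , sym (ℕ.+-suc _ _)
  next-backward v< (inj₂ (k , x′≡ , top , i≡ , refl)) with refl ← Fin.toℕ-injective i≡ =
    inject₁ k , x′≡ , ℕ.≤-reflexive top , sym (offset-cross k top)

  moves-sound : ∀ mi {u u′ i v p} → Located i v p → Vec.lookup u secR ≡ toℕ i → Vec.lookup u headR ≡ v → moves mi ⊢ u ⇒ u′ →
    ∃ λ i′ → Vec.lookup u′ secR ≡ toℕ i′ × Located i′ (Vec.lookup u′ headR) (moveInput mi p)
  moves-sound left {u} {u′} {p = p} (located v< p≡) i≡ refl (inj₁ nx) rewrite i≡ with next-backward v< nx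
  ... | i′ , x′≡ , v′< , eq = i′ , x′≡ , located v′< (trans (toℕ-pred p) (trans (cong ℕ.pred p≡) (cong ℕ.pred (sym eq))))
  moves-sound left {u} {u′} {i} {p = p} (located v< p≡) i≡ refl (inj₂ (sec≡ , head≡ , sec′≡ , head′≡)) with refl ← Fin.toℕ-injective {j = zero} (trans (sym i≡) sec≡) =
    zero , sec′≡ , subst (λ v → Located zero v (Fin.pred p)) (sym head′≡) (located (nonempty zero) (trans (toℕ-pred p) (cong ℕ.pred (trans p≡ head≡))))
  moves-sound stay l i≡ refl (sec≡ , head≡) = _ , trans sec≡ i≡ , subst (λ v → Located _ v _) (sym head≡) l
  moves-sound right {u} {u′} {p = p} (located v< p≡) i≡ refl (inj₁ nx) rewrite i≡ with next-forward v< nx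
  ... | i′ , x′≡ , v′< , eq = i′ , x′≡ , located v′< (trans (toℕ-nextFin-< p p<) (trans (cong suc p≡) (sym eq)))
    where
    p< : suc (toℕ p) < 2 + length w
    p< = subst (_< 2 + length w) (trans eq (cong suc (sym p≡))) (inside-tape i′ v′<)
  moves-sound right {u} {u′} {i} {p = p} l@(located v< p≡) i≡ refl (inj₂ (sec≡ , top , sec′≡ , head′≡)) with refl ← Fin.toℕ-injective {i = i} (trans (sym i≡) sec≡) =
    _ , trans sec′≡ sec≡ , subst (λ v → Located _ v (nextFin p)) (sym head′≡) (subst (Located _ _) (sym (nextFin-last p p-last)) l)
    where
    p-last : suc (toℕ p) ≡ 2 + length w
    p-last = trans (cong suc p≡) (trans (sym (ℕ.+-suc _ _)) (trans (cong (offset section (fromℕ #sec′) +_) top) (trans (offset-last section) length-tape)))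

  -- During a loop the recorded configuration is the one in which the phase will end; for `push`,
  -- `xs` already contains the pushed symbol. The equations state the quantity that each loop keeps
  -- constant, with `j` counting the increments not yet settled by a wrap.
  data Invariant : Node → Set where
    main  : ∀ {c q p ls a rs i v d} → Runs (zip q p ls a rs) → Located i v p →
            Invariant (c ∷ 0 ∷ toℕ q ∷ toℕ i ∷ toℕ a ∷ d ∷ v ∷ code ls ∷ code rs ∷ 0 ∷ [])
    push  : ∀ {c q p xs ys i v d j x t} → Runs (settle d q p xs ys) → Located i v p → t + B * x ≡ code xs + j →
            Invariant (c ∷ 1 ∷ toℕ q ∷ toℕ i ∷ j ∷ toℕ d ∷ v ∷ x ∷ code ys ∷ t ∷ [])
    pop   : ∀ {c q p xs ys i v d j y t} → Runs (settle d q p xs ys) → Located i v p → y + j + B * t ≡ code ys →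
            Invariant (c ∷ 2 ∷ toℕ q ∷ toℕ i ∷ j ∷ toℕ d ∷ v ∷ code xs ∷ y ∷ t ∷ [])
    final : ∀ {c q i j d v x y t} → Accepts M w → Invariant (c ∷ 3 ∷ q ∷ i ∷ j ∷ d ∷ v ∷ x ∷ y ∷ t ∷ [])

  push-start : ∀ xs (s : Symbol) → suc (toℕ s) + B * code xs ≡ code (s ∷ xs) + 0
  push-start xs s = sym (ℕ.+-identityʳ _)

  acts-sound : ∀ act {c q p ls a rs i v d u′} → Runs (zip q p ls a rs) → Located i v p →
    act ∈ δ q (readInput w p) a → ∀ {q₁ a₁ ι} →
    acts q₁ a₁ ι act ⊢ (c ∷ 0 ∷ toℕ q ∷ toℕ i ∷ toℕ a ∷ d ∷ v ∷ code ls ∷ code rs ∷ 0 ∷ []) ⇒ u′ → Invariant u′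
  acts-sound (q′ , s , mi , mw) {u′ = c′ ∷ m′ ∷ q″ ∷ i′ ∷ a′ ∷ d′ ∷ v′ ∷ x′ ∷ y′ ∷ t′ ∷ []} run loc act∈ (_ , _ , _ , _ , refl , mv , wk , refl)
    with moves-sound mi loc refl refl mv
  acts-sound (q′ , s , mi , stay) run loc act∈ (_ , _ , _ , _ , refl , mv , (refl , refl , refl , refl , refl) , refl)
    | i″ , refl , loc′ = main (runs-perform act∈ run) loc′
  acts-sound (q′ , s , mi , right) {ls = ls} run loc act∈ (_ , _ , _ , _ , refl , mv , ((refl , refl , refl , refl) , refl , refl) , refl)
    | i″ , refl , loc′ = push (runs-perform act∈ run) loc′ (push-start ls s)
  acts-sound (q′ , s , mi , left) {ls = []} run loc act∈ (_ , _ , _ , _ , refl , mv , inj₁ (_ , refl , refl , refl , refl , refl) , refl)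
    | i″ , refl , loc′ = main (runs-perform act∈ run) loc′
  acts-sound (q′ , s , mi , left) {ls = []} run loc act∈ (_ , _ , _ , _ , refl , mv , inj₂ (x≢0 , _) , refl)
    | i″ , refl , loc′ = ⊥-elim (x≢0 refl)
  acts-sound (q′ , s , mi , left) {ls = _ ∷ _} {rs = rs} run loc act∈ (_ , _ , _ , _ , refl , mv , inj₂ (_ , (refl , refl , refl , refl) , refl , refl) , refl)
    | i″ , refl , loc′ = push (runs-perform act∈ run) loc′ (push-start rs s)

  lastDigit≡ : toℕ lastDigit ≡ suc #symbols
  lastDigit≡ = Fin.toℕ-fromℕ _

  -- Lowering `x` loses `B`, which is repaid by the `B - 1` increments already counted and the
  -- present one.
  push-wrap : ∀ t x e → t + B * suc x ≡ e + suc #symbols → suc t + B * x ≡ e + 0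
  push-wrap t x e eq = ℕ.+-cancelʳ-≡ (suc #symbols) _ _ (trans (lemma #symbols t x) (trans eq (cong (_+ suc #symbols) (sym (ℕ.+-identityʳ e)))))
    where
    lemma : ∀ b t x → suc t + (2 + b) * x + suc b ≡ t + (2 + b) * suc x
    lemma = solve-∀

  pop-wrap : ∀ y t → suc y + suc #symbols + B * t ≡ y + 0 + B * suc t
  pop-wrap = lemma #symbols
    where
    lemma : ∀ b y t → suc y + suc b + (2 + b) * t ≡ y + 0 + (2 + b) * suc t
    lemma = solve-∀

  popped-sound : ∀ {c q p xs ys i v d y t u′} → Runs (settle d q p xs ys) → Located i v p → y + 0 + B * t ≡ code ys →
    ∀ {c′ d′ x′ y′ a′} → u′ ≡ c′ ∷ 0 ∷ toℕ q ∷ toℕ i ∷ a′ ∷ d′ ∷ v ∷ x′ ∷ y′ ∷ 0 ∷ [] →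
    let u = c ∷ 2 ∷ toℕ q ∷ toℕ i ∷ 0 ∷ toℕ d ∷ v ∷ code xs ∷ y ∷ t ∷ [] in
    exchanges ⊢ u ⇒ u′ → popped ⊢ u ⇒ u′ → Invariant u′
  popped-sound {xs = xs} {ys} {d = d} {t = t} run loc eq refl ex (inj₁ (a , refl , refl))
    with ys′ , refl , refl ← code-pop ys a t (trans (cong (_+ B * t) (sym (ℕ.+-identityʳ (suc (toℕ a))))) eq) with d | ex
  ... | zero     | inj₁ (_ , refl , refl) = main run loc
  ... | suc zero | inj₂ (_ , refl , refl) = main run loc
  popped-sound {ys = ys} {d = d} run loc eq refl ex (inj₂ (refl , refl , refl))
    with refl ← code-empty ys (trans (sym (ℕ.*-zeroʳ B)) eq) with d | ex
  ... | zero     | inj₁ (_ , refl , refl) = main run loc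
  ... | suc zero | inj₂ (_ , refl , refl) = main run loc

  sound : ∀ {u u′} → Invariant u → stepᶜ ⊢ u ⇒ u′ → Invariant u′
  sound (main run loc) (inj₁ (q , a , ι , k , h@(_ , q≡ , a≡ , (i , i≡ , rd) , _)))
    with refl ← Fin.toℕ-injective q≡ | refl ← Fin.toℕ-injective a≡ | refl ← Fin.toℕ-injective i≡
    -- The branch of `fromMain` guesses an input symbol; the reading condition forces the guess to
    -- be the symbol under the head.
    with ι≡ ← Maybe.just-injective (trans (sym rd) (located-read loc))
    = acts-sound _ run loc (subst (λ ι′ → List.lookup (δ q (inputSymbol ι) a) k ∈ δ q ι′ a) ι≡ (∈-lookup k)) h
  sound {u′ = _ ∷ _ ∷ _ ∷ _ ∷ _ ∷ _ ∷ _ ∷ _ ∷ _ ∷ _ ∷ []} (push {xs = xs} {j = j} {x} {t} run loc eq)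
    (inj₂ (inj₁ (_ , (refl , refl , refl , refl) , refl , refl , inj₁ (refl , refl , refl , refl)))) =
    push run loc (trans (cong suc eq) (sym (ℕ.+-suc (code xs) j)))
  sound {u′ = _ ∷ _ ∷ _ ∷ _ ∷ _ ∷ _ ∷ _ ∷ x′ ∷ _ ∷ _ ∷ []} (push {xs = xs} {j = j} {t = t} run loc eq)
    (inj₂ (inj₁ (_ , (refl , refl , refl , refl) , refl , refl , inj₂ (inj₁ (refl , j≡ , refl , refl , refl))))) =
    push run loc (push-wrap t x′ (code xs) (trans eq (cong (code xs +_) (trans j≡ lastDigit≡))))
  sound {u′ = _ ∷ _ ∷ _ ∷ _ ∷ _ ∷ _ ∷ _ ∷ _ ∷ _ ∷ _ ∷ []} (push {xs = xs} {ys} {t = t} run loc eq)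
    (inj₂ (inj₁ (_ , (refl , refl , refl , refl) , refl , refl , inj₂ (inj₂ (refl , refl , refl , refl , refl , refl))))) =
    subst (λ x → Invariant (_ ∷ 2 ∷ _ ∷ _ ∷ 0 ∷ _ ∷ _ ∷ x ∷ code ys ∷ 0 ∷ [])) (sym t≡) (pop run loc total)
    where
    t≡ : t ≡ code xs
    t≡ = trans (sym (trans (cong (t +_) (ℕ.*-zeroʳ B)) (ℕ.+-identityʳ t))) (trans eq (ℕ.+-identityʳ _))
    total : code ys + 0 + B * 0 ≡ code ys
    total = trans (cong (code ys + 0 +_) (ℕ.*-zeroʳ B)) (trans (ℕ.+-identityʳ _) (ℕ.+-identityʳ _))
  sound {u′ = _ ∷ _ ∷ _ ∷ _ ∷ _ ∷ _ ∷ _ ∷ _ ∷ y′ ∷ _ ∷ []} (pop {j = j} {t = t} run loc eq)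
    (inj₂ (inj₂ (inj₁ (_ , (refl , refl , refl , refl) , inj₁ (refl , refl , refl , refl , refl , refl))))) =
    pop run loc (trans (cong (_+ B * t) (ℕ.+-suc y′ j)) eq)
  sound {u′ = _ ∷ _ ∷ _ ∷ _ ∷ _ ∷ _ ∷ _ ∷ _ ∷ y′ ∷ _ ∷ []} (pop {j = j} {t = t} run loc eq)
    (inj₂ (inj₂ (inj₁ (_ , (refl , refl , refl , refl) , inj₂ (inj₁ (refl , refl , refl , j≡ , refl , refl , refl)))))) =
    pop run loc (trans (sym (pop-wrap y′ t)) (trans (cong (λ j → suc y′ + j + B * t) (sym (trans j≡ lastDigit≡))) eq))
  sound {u′ = _ ∷ _ ∷ _ ∷ _ ∷ _ ∷ _ ∷ _ ∷ _ ∷ _ ∷ _ ∷ []} (pop {c} run loc eq)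
    (inj₂ (inj₂ (inj₁ (_ , (refl , refl , refl , refl) , inj₂ (inj₂ (refl , refl , refl , ex , pp)))))) =
    popped-sound {c} run loc eq refl ex pp
  sound {u′ = _ ∷ _ ∷ _ ∷ _ ∷ _ ∷ _ ∷ _ ∷ _ ∷ _ ∷ _ ∷ []} (main (c , reachable , reps refl _ _ _) loc)
    (inj₂ (inj₂ (inj₂ (_ , q≡ , _ , refl , _)))) = final (c , reachable , Fin.toℕ-injective q≡)

  invariant-start : ∀ c → Invariant (startNode c)
  invariant-start c = main {i = zero} {d = 0} (initial M w , ε , represents-initial) located-start

  invariant-final : ∀ {c} → Invariant (finalNode c) → Accepts M w
  invariant-final (final accepts) = accepts

-- Completeness: runs of the machine are simulated within the bound

module Completeness (M : Machine) (w : List Bool) (#sec′ : ℕ) (section : Fin (suc #sec′) → List InputSymbol)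
  (tape≡ : tapeSymbols w ≡ concat (tabulate section)) (nonempty : ∀ i → 0 < length (section i))
  (N ℓ : ℕ) (bound≤N : Program.bound M #sec′ ≤ N) (section≤N : ∀ i → length (section i) ≤ N)
  (codes≤N : Coding.B (Machine.#symbols M) ^ ℓ ≤ N)
  (space : ∀ (c : Config M w) → Reachable M c → Config.workHead c < ℓ) where
  open Machine M
  open Program M #sec′ hiding (B)
  open Zipper M w
  open Coding #symbols
  open Simulation M w #sec′ section tape≡ nonempty

  -- Bounding the registers by `N`, later a power of the size, ensures that each node on the run is
  -- represented by a tuple. Only the target carries the bound; the source inherits it from the step
  -- before.
  record _⇛_ (u u′ : Node) : Set where
    constructor _,_
    field
      steps   : stepᶜ ⊢ u ⇒ u′
      bounded : All (_< N) u′

  fin< : ∀ {m} → m ≤ bound → (i : Fin m) → toℕ i < N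
  fin< m≤ i = ℕ.<-≤-trans (Fin.toℕ<n i) (ℕ.≤-trans m≤ bound≤N)

  0<N : 0 < N
  0<N = fin< mode≤ zero

  1<N : 1 < N
  1<N = fin< mode≤ (suc zero)

  2<N : 2 < N
  2<N = fin< mode≤ (suc (suc zero))

  B≤N : B ≤ N
  B≤N = ℕ.≤-trans B≤ bound≤N

  moves-possible : ∀ mi {i v p} → Located i v p → ∃₂ λ i′ v′ → ∀ {u u′} →
    Vec.lookup u secR ≡ toℕ i → Vec.lookup u headR ≡ v → Vec.lookup u′ secR ≡ toℕ {#sec} i′ → Vec.lookup u′ headR ≡ v′ → moves mi ⊢ u ⇒ u′
  moves-possible left {zero}  {zero} l = zero , 0 , λ s h s′ h′ → inj₂ (s , h , s′ , h′)
  moves-possible left {suc k} {zero} l = inject₁ k , ℕ.pred (length (section (inject₁ k))) ,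
    λ s h s′ h′ → inj₁ (inj₂ (k , s′ , trans (cong suc h′) (ℕ.suc-pred _ {{ℕ.>-nonZero (nonempty (inject₁ k))}}) , s , h))
  moves-possible left {i} {suc v} (located v< _) = i , v ,
    λ s h s′ h′ → inj₁ (inj₁ (i , s′ , s , (λ top → ℕ.<-irrefl (trans (cong suc (sym h′)) top) v<) , trans h (cong suc (sym h′))))
  moves-possible stay {i} {v} l = i , v , λ s h s′ h′ → trans s′ (sym s) , trans h′ (sym h)
  moves-possible right {i} {v} l with suc v ℕ.≟ length (section i)
  ... | no ¬top = i , suc v , λ s h s′ h′ → inj₁ (inj₁ (i , s , s′ , (λ top → ¬top (trans (cong suc (sym h)) top)) , trans h′ (cong suc (sym h))))
  ... | yes top with view i
  ...   | ‵inject₁ k = suc k , 0 , λ s h s′ h′ → inj₁ (inj₂ (k , s , trans (cong suc h) top , s′ , h′))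
  ...   | ‵fromℕ     = i , v , λ s h s′ h′ → inj₂ (s , trans (cong suc h) top , trans s′ (sym s) , trans h′ (sym h))

  moves-complete : ∀ mi {i v p} → Located i v p → ∃₂ λ i′ v′ → Located i′ v′ (moveInput mi p) × ∀ {u u′} →
    Vec.lookup u secR ≡ toℕ i → Vec.lookup u headR ≡ v → Vec.lookup u′ secR ≡ toℕ i′ → Vec.lookup u′ headR ≡ v′ → moves mi ⊢ u ⇒ u′
  moves-complete mi {i} {v} loc with moves-possible mi loc
  -- That the new position is located correctly follows from soundness, applied to two dummy nodes
  -- with these sections and offsets.
  ... | i′ , v′ , mv with moves-sound mi {at i v} {at i′ v′} loc refl refl (mv refl refl refl refl)
    where
    at : Fin #sec → ℕ → Node
    at i v = 0 ∷ 0 ∷ 0 ∷ toℕ i ∷ 0 ∷ 0 ∷ v ∷ 0 ∷ 0 ∷ 0 ∷ []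
  ... | i″ , i≡ , loc′ with refl ← Fin.toℕ-injective {i = i′} i≡ = i′ , v′ , loc′ , mv

  module Loops {c : ℕ} {q : State} {i : Fin #sec} {v : ℕ} (d : Fin 2) (c< : c < N) (v< : v < N) where

    pushNode popNode : (j x y t : ℕ) → Node
    pushNode j x y t = c ∷ 1 ∷ toℕ q ∷ toℕ i ∷ j ∷ toℕ d ∷ v ∷ x ∷ y ∷ t ∷ []
    popNode  j x y t = c ∷ 2 ∷ toℕ q ∷ toℕ i ∷ j ∷ toℕ d ∷ v ∷ x ∷ y ∷ t ∷ []

    push-bounded : ∀ {j x y t} → j < N → x < N → y < N → t < N → All (_< N) (pushNode j x y t)
    push-bounded j< x< y< t< = c< ∷ 1<N ∷ fin< state≤ q ∷ fin< sec≤ i ∷ j< ∷ fin< dir≤ d ∷ v< ∷ x< ∷ y< ∷ t< ∷ []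

    pop-bounded : ∀ {j x y t} → j < N → x < N → y < N → t < N → All (_< N) (popNode j x y t)
    pop-bounded j< x< y< t< = c< ∷ 2<N ∷ fin< state≤ q ∷ fin< sec≤ i ∷ j< ∷ fin< dir≤ d ∷ v< ∷ x< ∷ y< ∷ t< ∷ []

    push-count : ∀ k {x y t} → k < N → x < N → y < N → k + t < N → Star _⇛_ (pushNode 0 x y t) (pushNode k x y (k + t))
    push-count zero    _  _  _  _  = ε
    push-count (suc k) k< x< y< t< = push-count k (ℕ.<-trans (ℕ.n<1+n k) k<) x< y< (ℕ.<-trans (ℕ.n<1+n _) t<) ◅◅
      ((inj₂ (inj₁ (refl , (refl , refl , refl , refl) , refl , refl , inj₁ (refl , refl , refl , refl))) , push-bounded k< x< y< t<) ◅ ε)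

    push-round : ∀ {x y t} → suc x < N → y < N → B + t < N → Star _⇛_ (pushNode 0 (suc x) y t) (pushNode 0 x y (B + t))
    push-round x< y< t< = push-count (suc #symbols) B≤N x< y< (ℕ.<-trans (ℕ.n<1+n _) t<) ◅◅
      ((inj₂ (inj₁ (refl , (refl , refl , refl , refl) , refl , refl , inj₂ (inj₁ (refl , sym lastDigit≡ , refl , refl , refl)))) ,
        push-bounded 0<N (ℕ.<-trans (ℕ.n<1+n _) x<) y< t<) ◅ ε)

    push-total : ∀ t x → B + t + B * x ≡ t + B * suc x
    push-total = lemma B
      where
      lemma : ∀ B t x → B + t + B * x ≡ t + B * suc x
      lemma = solve-∀

    -- The register `temp` only grows, towards `t + B * x`, the code of the stack after the push. A
    -- bound on this final value therefore bounds every intermediate one.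
    push-loop : ∀ x {y t} → x < N → y < N → t + B * x < N → Star _⇛_ (pushNode 0 x y t) (pushNode 0 0 y (t + B * x))
    push-loop zero {y} {t} _ _ _ = subst (λ k → Star _⇛_ (pushNode 0 0 y t) (pushNode 0 0 y k)) (sym (trans (cong (t +_) (ℕ.*-zeroʳ B)) (ℕ.+-identityʳ t))) ε
    push-loop (suc x) {y} {t} x< y< t< =
      push-round x< y< (ℕ.≤-<-trans (ℕ.m≤m+n _ (B * x)) t<′) ◅◅
      subst (λ k → Star _⇛_ (pushNode 0 x y (B + t)) (pushNode 0 0 y k)) (push-total t x) (push-loop x (ℕ.<-trans (ℕ.n<1+n x) x<) y< t<′)
      where
      t<′ : B + t + B * x < N
      t<′ = subst (_< N) (sym (push-total t x)) t<

    push-phase : ∀ {x y t} → x < N → y < N → t + B * x < N → Star _⇛_ (pushNode 0 x y t) (popNode 0 (t + B * x) y 0)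
    push-phase {x} x< y< t< = push-loop x x< y< t< ◅◅
      ((inj₂ (inj₁ (refl , (refl , refl , refl , refl) , refl , refl , inj₂ (inj₂ (refl , refl , refl , refl , refl , refl)))) ,
        pop-bounded 0<N t< y< 0<N) ◅ ε)

    pop-count : ∀ k {j x y t} → k + j < N → x < N → k + y < N → t < N → Star _⇛_ (popNode j x (k + y) t) (popNode (k + j) x y t)
    pop-count zero    _ _ _ _ = ε
    pop-count (suc k) {j} {x} {y} {t} j< x< y< t< =
      (inj₂ (inj₂ (inj₁ (refl , (refl , refl , refl , refl) , inj₁ (refl , refl , refl , refl , refl , refl)))) ,
        pop-bounded (ℕ.≤-<-trans (s≤s (ℕ.m≤n+m j k)) j<) x< y<′ t<) ◅
      subst (λ l → Star _⇛_ (popNode (suc j) x (k + y) t) (popNode l x y t)) (ℕ.+-suc k j) (pop-count k (subst (_< N) (sym (ℕ.+-suc k j)) j<) x< y<′ t<)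
      where
      y<′ : k + y < N
      y<′ = ℕ.<-trans (ℕ.n<1+n _) y<

    pop-round : ∀ {x y t} → x < N → B + y < N → suc t < N → Star _⇛_ (popNode 0 x (B + y) t) (popNode 0 x y (suc t))
    pop-round {x} {y} {t} x< y< t< =
      subst (λ k → Star _⇛_ (popNode 0 x k t) (popNode (suc #symbols + 0) x (suc y) t)) (ℕ.+-suc (suc #symbols) y)
        (pop-count (suc #symbols) (subst (_< N) (sym (ℕ.+-identityʳ _)) B≤N) x< (subst (_< N) (sym (ℕ.+-suc (suc #symbols) y)) y<) (ℕ.<-trans (ℕ.n<1+n t) t<)) ◅◅
      ((inj₂ (inj₂ (inj₁ (refl , (refl , refl , refl , refl) , inj₂ (inj₁ (refl , refl , refl , trans (ℕ.+-identityʳ _) (sym lastDigit≡) , refl , refl , refl))))) ,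
        pop-bounded 0<N x< (ℕ.≤-<-trans (ℕ.m≤n+m y B) y<) t<) ◅ ε)

    pop-loop : ∀ m {x y t} → x < N → y + B * m < N → m + t < N → Star _⇛_ (popNode 0 x (y + B * m) t) (popNode 0 x y (m + t))
    pop-loop zero {x} {y} {t} _ _ _ = subst (λ k → Star _⇛_ (popNode 0 x k t) (popNode 0 x y t)) (sym (trans (cong (y +_) (ℕ.*-zeroʳ B)) (ℕ.+-identityʳ y))) ε
    pop-loop (suc m) {x} {y} {t} x< y< t< =
      subst (λ k → Star _⇛_ (popNode 0 x k t) (popNode 0 x (y + B * m) (suc t))) (carry B y m)
        (pop-round x< y<′ (ℕ.≤-<-trans (s≤s (ℕ.m≤n+m t m)) t<)) ◅◅
      subst (λ k → Star _⇛_ (popNode 0 x (y + B * m) (suc t)) (popNode 0 x y k)) (ℕ.+-suc m t)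
        (pop-loop m x< (ℕ.≤-<-trans (ℕ.m≤n+m _ B) y<′) (subst (_< N) (sym (ℕ.+-suc m t)) t<))
      where
      y<′ : B + (y + B * m) < N
      y<′ = subst (_< N) (sym (carry B y m)) y<

  mainNode : ℕ → ℕ → Fin #sec → ℕ → Zip → Node
  mainNode c d i v (zip q p ls a rs) = c ∷ 0 ∷ toℕ q ∷ toℕ i ∷ toℕ a ∷ d ∷ v ∷ code ls ∷ code rs ∷ 0 ∷ []

  stack< : ∀ xs {m} → length xs ≤ m → m ≤ ℓ → code xs < N
  stack< xs {m} ≤m m≤ℓ = ℕ.<-≤-trans (code-< xs) (ℕ.≤-trans (ℕ.^-monoʳ-≤ B (ℕ.≤-trans ≤m m≤ℓ)) codes≤N)

  main-bounded : ∀ {c i v p} z → c < N → Located i v p → cells z ≤ ℓ → All (_< N) (mainNode c 0 i v z)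
  main-bounded {i = i} (zip q p ls a rs) c< (located v< _) fits =
    c< ∷ 0<N ∷ fin< state≤ q ∷ fin< sec≤ i ∷ fin< symbol≤ a ∷ 0<N ∷ ℕ.<-≤-trans v< (section≤N i) ∷
    stack< ls (ℕ.m≤n⇒m≤1+n (ℕ.m≤m+n _ _)) fits ∷ stack< rs (ℕ.m≤n⇒m≤1+n (ℕ.m≤n+m _ (length ls))) fits ∷ 0<N ∷ []

  pop-phase : ∀ {c q i v p} d xs ys → c < N → Located i v p → length xs + length ys ≤ ℓ → cells (settle d q p xs ys) ≤ ℓ →
    Star _⇛_ (c ∷ 2 ∷ toℕ q ∷ toℕ i ∷ 0 ∷ toℕ d ∷ v ∷ code xs ∷ code ys ∷ 0 ∷ []) (mainNode c 0 i v (settle d q p xs ys))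
  pop-phase {c} {q} {i} {v} {p} d xs (a ∷ ys) c< loc@(located v< _) fits fits′ =
    subst (λ k → Star _⇛_ (popNode 0 (code xs) (code (a ∷ ys)) 0) (popNode 0 (code xs) (suc (toℕ a)) k)) (ℕ.+-identityʳ (code ys))
      (pop-loop (code ys) (stack< xs (ℕ.m≤m+n _ _) fits) (stack< (a ∷ ys) (ℕ.m≤n+m _ (length xs)) fits)
        (subst (_< N) (sym (ℕ.+-identityʳ _)) (stack< ys (ℕ.≤-trans (ℕ.n≤1+n _) (ℕ.m≤n+m _ (length xs))) fits))) ◅◅
    (exit d (main-bounded (settle d q p xs (a ∷ ys)) c< loc fits′) ◅ ε)
    where
    open Loops {c} {q} {i} {v} d c< (ℕ.<-≤-trans v< (section≤N i))
    exit : ∀ d → All (_< N) (mainNode c 0 i v (settle d q p xs (a ∷ ys))) →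
      (c ∷ 2 ∷ toℕ q ∷ toℕ i ∷ 0 ∷ toℕ d ∷ v ∷ code xs ∷ suc (toℕ a) ∷ code ys ∷ []) ⇛ mainNode c 0 i v (settle d q p xs (a ∷ ys))
    exit zero       b = inj₂ (inj₂ (inj₁ (refl , (refl , refl , refl , refl) , inj₂ (inj₂ (refl , refl , refl , inj₁ (refl , refl , refl) , inj₁ (a , refl , refl)))))) , b
    exit (suc zero) b = inj₂ (inj₂ (inj₁ (refl , (refl , refl , refl , refl) , inj₂ (inj₂ (refl , refl , refl , inj₂ (refl , refl , refl) , inj₁ (a , refl , refl)))))) , b
  pop-phase {c} {q} {i} {v} {p} zero xs [] c< loc fits fits′ =
    (inj₂ (inj₂ (inj₁ (refl , (refl , refl , refl , refl) , inj₂ (inj₂ (refl , refl , refl , inj₁ (refl , refl , refl) , inj₂ (refl , refl , refl)))))) ,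
      main-bounded (settle zero q p xs []) c< loc fits′) ◅ ε
  pop-phase {c} {q} {i} {v} {p} (suc zero) xs [] c< loc fits fits′ =
    (inj₂ (inj₂ (inj₁ (refl , (refl , refl , refl , refl) , inj₂ (inj₂ (refl , refl , refl , inj₂ (refl , refl , refl) , inj₂ (refl , refl , refl)))))) ,
      main-bounded (settle (suc zero) q p xs []) c< loc fits′) ◅ ε

  push-pop : ∀ {c q i v p} d s xs ys → c < N → Located i v p → suc (length xs + length ys) ≤ ℓ → cells (settle d q p (s ∷ xs) ys) ≤ ℓ →
    Star _⇛_ (c ∷ 1 ∷ toℕ q ∷ toℕ i ∷ 0 ∷ toℕ d ∷ v ∷ code xs ∷ code ys ∷ suc (toℕ s) ∷ []) (mainNode c 0 i v (settle d q p (s ∷ xs) ys))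
  push-pop {c} {q} {i} {v} {p} d s xs ys c< loc@(located v< _) fits fits′ =
    push-phase (stack< xs (ℕ.m≤n⇒m≤1+n (ℕ.m≤m+n _ _)) fits) (stack< ys (ℕ.m≤n⇒m≤1+n (ℕ.m≤n+m _ (length xs))) fits) (stack< (s ∷ xs) (s≤s (ℕ.m≤m+n _ _)) fits) ◅◅
    pop-phase {p = p} d (s ∷ xs) ys c< loc fits fits′
    where open Loops {c} {q} {i} {v} d c< (ℕ.<-≤-trans v< (section≤N i))

  push-start-bounded : ∀ {c q i v p} (d : Fin 2) (s : Symbol) xs ys → c < N → Located i v p → suc (length xs + length ys) ≤ ℓ →
    All (_< N) (c ∷ 1 ∷ toℕ {#states} q ∷ toℕ i ∷ 0 ∷ toℕ d ∷ v ∷ code xs ∷ code ys ∷ suc (toℕ s) ∷ [])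
  push-start-bounded {c} {q} {i} {v} d s xs ys c< (located v< _) fits = push-bounded 0<N
    (stack< xs (ℕ.m≤n⇒m≤1+n (ℕ.m≤m+n _ _)) fits) (stack< ys (ℕ.m≤n⇒m≤1+n (ℕ.m≤n+m _ (length xs))) fits) (fin< B≤ (suc s))
    where open Loops {c} {q} {i} {v} d c< (ℕ.<-≤-trans v< (section≤N i))

  perform-complete : ∀ act {c d i v} z → c < N → Located i v (Zip.pos z) → cells z ≤ ℓ → cells (performZ act z) ≤ ℓ →
    act ∈ δ (Zip.st z) (readInput w (Zip.pos z)) (Zip.here z) →
    ∃₂ λ i′ v′ → Located i′ v′ (Zip.pos (performZ act z)) × Star _⇛_ (mainNode c d i v z) (mainNode c 0 i′ v′ (performZ act z))
  perform-complete act@(q′ , s , mi , mw) {c} {d} {i} {v} z@(zip q p ls a rs) c< loc fits fits′ act∈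
    with ι , ι≡ ← inputSymbol⁻¹ (readInput w p) with moves-complete mi loc
  ... | i′ , v′ , loc′ , mv = go mw ls refl refl
    where
    act∈′ : act ∈ δ q (inputSymbol ι) a
    act∈′ = subst (λ ι → act ∈ δ q ι a) (sym ι≡) act∈
    fire : ∀ {u u′} → acts q a (inputSymbol ι) act ⊢ u ⇒ u′ → stepᶜ ⊢ u ⇒ u′
    fire {u} {u′} h = inj₁ (q , a , ι , Any.index act∈′ , subst (λ act → acts q a (inputSymbol ι) act ⊢ u ⇒ u′) (Any.lookup-index act∈′) h)
    rd : ∃ λ i′ → toℕ i ≡ toℕ i′ × section i′ ‼ v ≡ just (inputSymbol ι)
    rd = i , refl , trans (located-read loc) (cong just (sym ι≡))
    Goal : Zip → Set
    Goal z′ = ∃₂ λ i′ v′ → Located i′ v′ (Zip.pos z′) × Star _⇛_ (mainNode c d i v z) (mainNode c 0 i′ v′ z′)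
    go : ∀ mw₁ ls₁ → mw₁ ≡ mw → ls₁ ≡ ls → Goal (performZ (q′ , s , mi , mw₁) (zip q p ls₁ a rs))
    go stay _ refl refl = i′ , v′ , loc′ ,
      (fire (refl , refl , refl , rd , refl , mv refl refl refl refl , (refl , refl , refl , refl , refl) , refl) , main-bounded (performZ act z) c< loc′ fits′) ◅ ε
    go right _ refl refl = i′ , v′ , subst (Located i′ v′) (sym (settle-pos zero (s ∷ ls) rs)) loc′ ,
      (fire (refl , refl , refl , rd , refl , mv refl refl refl refl , ((refl , refl , refl , refl) , refl , refl) , refl) , push-start-bounded zero s ls rs c< loc′ fits) ◅
      push-pop zero s ls rs c< loc′ fits fits′
      where
      settle-pos : ∀ d {q p} xs ys → Zip.pos (settle d q p xs ys) ≡ p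
      settle-pos zero       xs []      = refl
      settle-pos zero       xs (_ ∷ _) = refl
      settle-pos (suc zero) xs []      = refl
      settle-pos (suc zero) xs (_ ∷ _) = refl
    go left [] refl refl = i′ , v′ , loc′ ,
      (fire (refl , refl , refl , rd , refl , mv refl refl refl refl , inj₁ (refl , refl , refl , refl , refl , refl) , refl) , main-bounded (performZ act z) c< loc′ fits′) ◅ ε
    go left (b ∷ ls₁) refl refl = i′ , v′ , loc′ ,
      (fire (refl , refl , refl , rd , refl , mv refl refl refl refl , inj₂ ((λ ()) , (refl , refl , refl , refl) , refl , refl) , refl) , push-start-bounded (suc zero) s rs ls c< loc′ fits⁻) ◅
      push-pop (suc zero) s rs ls c< loc′ fits⁻ fits′
      where
      fits⁻ : suc (length rs + length ls) ≤ ℓ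
      fits⁻ = subst (λ k → suc k ≤ ℓ) (ℕ.+-comm (length ls) (length rs)) fits

  run-complete : ∀ {c d i v z k k′} → c < N → Represents z k → Located i v (Zip.pos z) → cells z ≤ ℓ → Reachable M k → Star (_⟶_ M) k k′ →
    ∃₂ λ i′ v′ → ∃₂ λ d′ z′ → Represents z′ k′ × Star _⇛_ (mainNode c d i v z) (mainNode c d′ i′ v′ z′)
  run-complete c< r loc fits reachable ε = _ , _ , _ , _ , r , ε
  run-complete {z = z} {k} c< r loc fits reachable (step {act} act∈ ◅ rest)
    with reachable′ ← reachable ◅◅ (step act∈ ◅ ε)
    with fits′ ← cells-perform act ℓ r fits (space _ reachable′)
    with i₁ , v₁ , loc₁ , path₁ ← perform-complete act z c< loc fits fits′ (subst (act ∈_) (represents-enabled r) act∈)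
    with i₂ , v₂ , d₂ , z′ , r₂ , path₂ ← run-complete c< (represents-perform act r) loc₁ fits′ reachable′ rest
    = i₂ , v₂ , d₂ , z′ , r₂ , path₁ ◅◅ path₂

  complete : ∀ {c} → c < N → Accepts M w → Star _⇛_ (startNode c) (finalNode c)
  complete c< (k , reachable , accepting)
    with i , v , d , zip q p ls a rs , reps refl _ _ _ , path ← run-complete {d = 0} {z = zip start zero [] zero []} c< represents-initial located-start (space _ ε) ε reachable
    = path ◅◅ ((inj₂ (inj₂ (inj₂ (refl , cong toℕ accepting , refl , refl , refl , refl , refl , refl , refl , refl , refl , refl))) ,
        (c< ∷ fin< mode≤ (suc (suc (suc zero))) ∷ 0<N ∷ 0<N ∷ 0<N ∷ 0<N ∷ 0<N ∷ 0<N ∷ 0<N ∷ 0<N ∷ [])) ◅ ε)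

-- Tuples over an ordered structure as numbers

module Ranking {A : Set} {n : ℕ} (index : A ↔ Fin n) (s : Successor A) where
  open Successor s
  open IsStrictTotalOrder isLinear using (compare; _≟_) renaming (trans to ≺-trans; irrefl to ≺-irrefl)
  open Inverse index using (to; from; strictlyInverseˡ; strictlyInverseʳ)

  to-injective : ∀ {a b} → to a ≡ to b → a ≡ b
  to-injective eq = trans (sym (strictlyInverseʳ _)) (trans (cong from eq) (strictlyInverseʳ _))

  el : ℕ → A
  el zero    = min
  el (suc i) = S (el i)

  -- The second alternative also records that the maximum has not been met, since `S` is strictly
  -- increasing only before it.
  search : ∀ a i → (∃ λ j → j ≤ i × a ≡ el j) ⊎ (el i ≺ a × ∀ j → j ≤ i → el j ≢ max)
  search a zero with compare min a
  ... | tri< min≺a _ _ = inj₂ (min≺a , λ { .0 z≤n min≡max → max-last a (subst (_≺ a) min≡max min≺a) })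
  ... | tri≈ _ min≡a _ = inj₁ (0 , z≤n , sym min≡a)
  ... | tri> _ _ a≺min = ⊥-elim (min-least a a≺min)
  search a (suc i) with search a i
  ... | inj₁ (j , j≤i , a≡) = inj₁ (j , ℕ.m≤n⇒m≤1+n j≤i , a≡)
  ... | inj₂ (eᵢ≺a , <max) with compare (S (el i)) a
  ...   | tri≈ _ Se≡a _ = inj₁ (suc i , ℕ.≤-refl , sym Se≡a)
  ...   | tri> _ _ a≺Se = ⊥-elim (S-next (el i) a (<max i ℕ.≤-refl) eᵢ≺a a≺Se)
  ...   | tri< Se≺a _ _ = inj₂ (Se≺a , below)
    where
    below : ∀ j → j ≤ suc i → el j ≢ max
    below j j≤ e≡max with ℕ.m≤n⇒m<n∨m≡n j≤
    ... | inj₁ (s≤s j≤i) = <max j j≤i e≡max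
    ... | inj₂ refl      = max-last a (subst (_≺ a) e≡max Se≺a)

  increasing-below : ∀ {j} i → (∀ k → k < i → el k ≢ max) → j < i → el j ≺ el i
  increasing-below {j} (suc i) <max (s≤s j≤i) with ℕ.m≤n⇒m<n∨m≡n j≤i
  ... | inj₁ j<i  = ≺-trans (increasing-below i (λ k k<i → <max k (ℕ.m≤n⇒m≤1+n k<i)) j<i) (S-above (el i) (<max i ℕ.≤-refl))
  ... | inj₂ refl = S-above (el i) (<max i ℕ.≤-refl)

  -- If the search up to `n - 1` failed, then `el 0`, ..., `el n` would be `n + 1` distinct
  -- elements.
  enumerated : ∀ a → ∃ λ j → j < n × a ≡ el j
  enumerated a with search a (ℕ.pred n)
  ... | inj₁ (j , j≤ , a≡) = j , ℕ.≤-<-trans j≤ (ℕ.≤-reflexive (ℕ.suc-pred n {{nonZero}})) , a≡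
    where
    nonZero : NonZero n
    nonZero = Fin.nonZeroIndex (to a)
  ... | inj₂ (e≺a , <max) with i , j , i<j , eq ← Fin.pigeonhole (ℕ.n<1+n n) (λ i → to (el (toℕ i)))
    = ⊥-elim (≺-irrefl (to-injective eq) (increasing-below (toℕ j) (λ k k<j → <max k (ℕ.<⇒≤pred (ℕ.<-≤-trans k<j (ℕ.≤-pred (Fin.toℕ<n j))))) i<j))

  saturated : ∀ j k → el j ≡ max → el (k + j) ≡ max
  saturated j zero    eq = eq
  saturated j (suc k) eq = trans (cong S (saturated j k eq)) S-max

  truncated : ∀ j → el j ≡ max → ∀ a → ∃ λ (i : Fin (suc j)) → a ≡ el (toℕ i)
  truncated j e≡max a with i , _ , a≡ ← enumerated a with i ℕ.≤? j
  ... | yes i≤j = Fin.fromℕ< (s≤s i≤j) , trans a≡ (cong el (sym (Fin.toℕ-fromℕ< (s≤s i≤j))))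
  ... | no  i≰j = fromℕ j , trans a≡ (trans (cong el (sym (ℕ.m∸n+n≡m (ℕ.<⇒≤ (ℕ.≰⇒> i≰j)))))
                    (trans (saturated j (i ℕ.∸ j) e≡max) (trans (sym e≡max) (cong el (sym (Fin.toℕ-fromℕ j))))))

  -- The iterates of `S` are constant from the maximum on, so meeting it at `j` would leave at most
  -- `j + 1` elements, fewer than `n`.
  not-max : ∀ j → suc j < n → el j ≢ max
  not-max j j< e≡max with i , i′ , i<i′ , eq ← Fin.pigeonhole j< (λ i → proj₁ (truncated j e≡max (from i))) =
    Fin.<⇒≢ i<i′ (trans (sym (strictlyInverseˡ i)) (trans (cong to same) (strictlyInverseˡ i′)))
    where
    same : from i ≡ from i′
    same = trans (proj₂ (truncated j e≡max (from i))) (trans (cong (el ∘ toℕ) eq) (sym (proj₂ (truncated j e≡max (from i′)))))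

  rank : A → ℕ
  rank a = proj₁ (enumerated a)

  rank< : ∀ a → rank a < n
  rank< a = proj₁ (proj₂ (enumerated a))

  el-rank : ∀ a → el (rank a) ≡ a
  el-rank a = sym (proj₂ (proj₂ (enumerated a)))

  rank-injective : ∀ {a b} → rank a ≡ rank b → a ≡ b
  rank-injective eq = trans (sym (el-rank _)) (trans (cong el eq) (el-rank _))

  increasing : ∀ {i j} → i < j → j < n → el i ≺ el j
  increasing {i} {j} i<j j<n = increasing-below j (λ k k<j → not-max k (ℕ.≤-<-trans k<j j<n)) i<j

  rank-el : ∀ {i} → i < n → rank (el i) ≡ i
  rank-el {i} i<n with ℕ.<-cmp (rank (el i)) i
  ... | tri≈ _ eq _ = eq
  ... | tri< r<i _ _ = ⊥-elim (≺-irrefl (el-rank (el i)) (increasing r<i i<n))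
  ... | tri> _ _ i<r = ⊥-elim (≺-irrefl (sym (el-rank (el i))) (increasing i<r (rank< (el i))))

  rank-min : rank min ≡ 0
  rank-min = rank-el (ℕ.≤-<-trans z≤n (rank< min))

  rank-max : suc (rank max) ≡ n
  rank-max with ℕ.m≤n⇒m<n∨m≡n (rank< max)
  ... | inj₂ eq = eq
  ... | inj₁ r< = ⊥-elim (not-max (rank max) r< (el-rank max))

  rank≡⇒max : ∀ {a} → suc (rank a) ≡ n → a ≡ max
  rank≡⇒max eq = rank-injective (ℕ.suc-injective (trans eq (sym rank-max)))

  rank-S : ∀ a → a ≢ max → rank (S a) ≡ suc (rank a)
  rank-S a a≢max = trans (cong (rank ∘ S) (sym (el-rank a))) (rank-el (ℕ.≤∧≢⇒< (rank< a) (λ eq → a≢max (rank≡⇒max eq))))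

  listing : List A
  listing = List.applyUpTo el n

  isIncreasingListing : IsIncreasingListing _≺_ listing
  isIncreasingListing = record
    { increasing = Linked.applyUpTo⁺₁ el n (λ i< → increasing ℕ.≤-refl i<)
    ; complete   = λ a → subst (_∈ listing) (el-rank a) (∈-applyUpTo⁺ el (rank< a)) }

  listing-‼ : ∀ a → listing ‼ rank a ≡ just a
  listing-‼ a = trans (applyUpTo-‼ el (rank< a)) (cong just (el-rank a))
    where
    applyUpTo-‼ : ∀ {n i} (f : ℕ → A) → i < n → List.applyUpTo f n ‼ i ≡ just (f i)
    applyUpTo-‼ {suc n} {zero}  f _        = refl
    applyUpTo-‼ {suc n} {suc i} f (s≤s i<) = applyUpTo-‼ (f ∘ suc) i<

  length-listing : length listing ≡ n
  length-listing = List.length-applyUpTo el n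

  -- The head is the most significant digit, which makes `val` the lexicographic rank, that is, the
  -- index of the tuple in `tuples listing w`.
  val : ∀ {w} → Vec A w → ℕ
  val []            = 0
  val {suc w} (a ∷ v) = val v + n ^ w * rank a

  val-< : ∀ {w} (v : Vec A w) → val v < n ^ w
  val-< []              = s≤s z≤n
  val-< {suc w} (a ∷ v) = begin-strict
    val v + n ^ w * rank a <⟨ ℕ.+-monoˡ-< (n ^ w * rank a) (val-< v) ⟩
    n ^ w + n ^ w * rank a ≡⟨ ℕ.*-suc (n ^ w) (rank a) ⟨
    n ^ w * suc (rank a)   ≤⟨ ℕ.*-monoʳ-≤ (n ^ w) (rank< a) ⟩
    n ^ w * n              ≡⟨ ℕ.*-comm (n ^ w) n ⟩
    n * n ^ w              ∎
    where open ℕ.≤-Reasoning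

  val-injective : ∀ {w} (v v′ : Vec A w) → val v ≡ val v′ → v ≡ v′
  val-injective []      []        _  = refl
  val-injective {suc w} (a ∷ v) (b ∷ v′) eq with v≡ , a≡ ← digit-unique (n ^ w) (rank a) (rank b) (val-< v) (val-< v′) eq
    = cong₂ _∷_ (rank-injective a≡) (val-injective v v′ v≡)

  power-nonZero : ∀ w → NonZero (n ^ w)
  power-nonZero w = ℕ.m^n≢0 n w {{Fin.nonZeroIndex (to min)}}

  val-surjective : ∀ w {m} → m < n ^ w → ∃ λ (v : Vec A w) → val v ≡ m
  val-surjective zero {zero}  _ = [] , refl
  val-surjective zero {suc m} (s≤s ())
  val-surjective (suc w) {m} m< with v , v≡ ← val-surjective w (m%n<n m (n ^ w) {{power-nonZero w}}) =
    el (m / n ^ w) ∷ v , trans (cong₂ _+_ v≡ (trans (cong (n ^ w *_) (rank-el (m<n*o⇒m/o<n m<))) (ℕ.*-comm (n ^ w) _))) (sym (m≡m%n+[m/n]*n m (n ^ w)))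
    where
    instance
      nonZero : NonZero (n ^ w)
      nonZero = power-nonZero w

  val-min : ∀ w → val (Vec.replicate w min) ≡ 0
  val-min zero    = refl
  val-min (suc w) = trans (cong₂ (λ x y → x + n ^ w * y) (val-min w) rank-min) (ℕ.*-zeroʳ (n ^ w))

  val-max : ∀ w → suc (val (Vec.replicate w max)) ≡ n ^ w
  val-max zero    = refl
  val-max (suc w) = trans (cong (_+ n ^ w * rank max) (val-max w)) (trans (sym (ℕ.*-suc (n ^ w) (rank max))) (trans (cong (n ^ w *_) rank-max) (ℕ.*-comm (n ^ w) n)))

-- The encoding of a structure as a sequence of sections

front : {A : Set} {k : ℕ} → Vec A (suc k) → Vec A k
front {k = zero}  _       = []
front {k = suc k} (a ∷ v) = a ∷ front v

back : {A : Set} {k : ℕ} → Vec A (suc k) → A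
back {k = zero}  (a ∷ []) = a
back {k = suc k} (a ∷ v)  = back v

-- The tape is cut so that each piece has length a power of the size. A position in a piece is then
-- a tuple of `arity` many elements, and the symbol there is quantifier-free definable from that
-- tuple.
data Section (L : Signature) : Set where
  leftMark units separator rightMark : Section L
  relation : Fin (#rel L) → Section L
  function : Fin (#fun L) → Section L

module _ {L : Signature} where

  arity : Section L → ℕ
  arity leftMark     = 0
  arity units        = 1
  arity separator    = 0
  arity rightMark    = 0
  arity (relation R) = relArity L R
  arity (function f) = suc (funArity L f)

  content : (A : FiniteStructure L) (σ : Section L) → Vec (Carrier (proj₁ A)) (arity σ) → InputSymbol
  content A leftMark             _ = ▷
  content A units                _ = bit true
  content A separator            _ = bit false
  content A rightMark            _ = ◁
  content (A , fin) (relation R) t = bit (does (IsFinite.relI? fin R t))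
  content (A , fin) (function f) t = bit (does (IsFinite._≟_ fin (funI A f (front t)) (back t)))

sectionsʳ : (L : Signature) → List (Section L)
sectionsʳ L = units ∷ separator ∷ List.map relation (allFin (#rel L)) ++ List.map function (allFin (#fun L)) ++ rightMark ∷ []

sectionOf : (L : Signature) → Fin (suc (length (sectionsʳ L))) → Section L
sectionOf L = List.lookup (leftMark ∷ sectionsʳ L)

sectionSymbols : {L : Signature} (A : FiniteStructure L) → List (Carrier (proj₁ A)) → Section L → List InputSymbol
sectionSymbols A xs σ = List.map (content A σ) (tuples xs (arity σ))

length-cartesianProductWith : {A B C : Set} (f : A → B → C) (xs : List A) (ys : List B) →
  length (cartesianProductWith f xs ys) ≡ length xs * length ys
length-cartesianProductWith f []       ys = refl
length-cartesianProductWith f (x ∷ xs) ys = trans (List.length-++ (List.map (f x) ys)) (cong₂ _+_ (List.length-map (f x) ys) (length-cartesianProductWith f xs ys))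

length-tuples : {A : Set} (xs : List A) (k : ℕ) → length (tuples xs k) ≡ length xs ^ k
length-tuples xs zero    = refl
length-tuples xs (suc k) = trans (length-cartesianProductWith _∷_ xs (tuples xs k)) (cong (length xs *_) (length-tuples xs k))

cartesianProductWith-‼ : {A B C : Set} (f : A → B → C) (xs : List A) (ys : List B) {i j : ℕ} {a : A} {b : B} →
  xs ‼ i ≡ just a → ys ‼ j ≡ just b → cartesianProductWith f xs ys ‼ (j + length ys * i) ≡ just (f a b)
cartesianProductWith-‼ f (x ∷ xs) ys {zero} {j} {b = b} refl j≡
  rewrite ℕ.*-zeroʳ (length ys) | ℕ.+-identityʳ j
  = trans (‼-++ˡ (List.map (f x) ys) _ (subst (j <_) (sym (List.length-map (f x) ys)) (‼⇒< ys j j≡))) (trans (‼-map (f x) ys j) (cong (Maybe.map (f x)) j≡))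
cartesianProductWith-‼ f (x ∷ xs) ys {suc i} {j} i≡ j≡ =
  trans (cong (cartesianProductWith f (x ∷ xs) ys ‼_) (trans (sym (carry (length ys) j i)) (cong (_+ (j + length ys * i)) (sym (List.length-map (f x) ys)))))
    (trans (‼-++ʳ (List.map (f x) ys) _ _) (cartesianProductWith-‼ f xs ys i≡ j≡))

-- In the encoding of a function graph the value varies fastest, as the last component does in
-- lexicographic order; so the graph is a section indexed by tuples one longer.
tuples-snoc : {A C : Set} (xs : List A) (k : ℕ) (g : Vec A k → A → C) →
  cartesianProductWith g (tuples xs k) xs ≡ List.map (λ t → g (front t) (back t)) (tuples xs (suc k))
tuples-snoc xs zero g = trans (List.++-identityʳ _) (single xs)
  where
  single : ∀ ys → List.map (g []) ys ≡ List.map (λ t → g (front t) (back t)) (cartesianProductWith _∷_ ys ([] ∷ []))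
  single []       = refl
  single (y ∷ ys) = cong (g [] y ∷_) (single ys)
tuples-snoc xs (suc k) g = blocks xs
  where
  blocks : ∀ ys → cartesianProductWith g (cartesianProductWith _∷_ ys (tuples xs k)) xs ≡
                  List.map (λ t → g (front t) (back t)) (cartesianProductWith _∷_ ys (tuples xs (suc k)))
  blocks []       = refl
  blocks (y ∷ ys) = begin
    cartesianProductWith g (List.map (y ∷_) (tuples xs k) ++ cartesianProductWith _∷_ ys (tuples xs k)) xs
      ≡⟨ List.cartesianProductWith-distribʳ-++ g (List.map (y ∷_) (tuples xs k)) _ xs ⟩
    cartesianProductWith g (List.map (y ∷_) (tuples xs k)) xs ++ cartesianProductWith g (cartesianProductWith _∷_ ys (tuples xs k)) xs
      ≡⟨ cong₂ _++_ (prefixed (tuples xs k)) (blocks ys) ⟩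
    cartesianProductWith (λ t → g (y ∷ t)) (tuples xs k) xs ++ rest
      ≡⟨ cong (_++ rest) (tuples-snoc xs k (λ t → g (y ∷ t))) ⟩
    List.map (λ t → g (y ∷ front t) (back t)) (tuples xs (suc k)) ++ rest
      ≡⟨ cong (_++ rest) (List.map-∘ (tuples xs (suc k))) ⟩
    List.map (λ t → g (front t) (back t)) (List.map (y ∷_) (tuples xs (suc k))) ++ rest
      ≡⟨ List.map-++ _ (List.map (y ∷_) (tuples xs (suc k))) _ ⟨
    List.map (λ t → g (front t) (back t)) (cartesianProductWith _∷_ (y ∷ ys) (tuples xs (suc k))) ∎
    where
    open ≡-Reasoning
    rest = List.map (λ t → g (front t) (back t)) (cartesianProductWith _∷_ ys (tuples xs (suc k)))
    prefixed : ∀ ts → cartesianProductWith g (List.map (y ∷_) ts) xs ≡ cartesianProductWith (λ t → g (y ∷ t)) ts xs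
    prefixed []       = refl
    prefixed (t ∷ ts) = cong (List.map (g (y ∷ t)) xs ++_) (prefixed ts)

map-constant : {A B : Set} (b : B) (xs : List A) → List.map (λ _ → b) xs ≡ replicate (length xs) b
map-constant b []       = refl
map-constant b (x ∷ xs) = cong (b ∷_) (map-constant b xs)

tabulate-sections : {A B : Set} (f : A → List B) (xs : List A) → concat (tabulate (λ i → f (List.lookup xs i))) ≡ concatMap f xs
tabulate-sections f xs = cong concat (trans (sym (List.map-tabulate (List.lookup xs) f)) (cong (List.map f) (List.tabulate-lookup xs)))

tape-sections : {L : Signature} (A : FiniteStructure L) (xs : List (Carrier (proj₁ A))) →
  tapeSymbols (encode A xs) ≡ concat (tabulate (λ i → sectionSymbols A xs (sectionOf L i)))
tape-sections {L} A′@(A , fin) xs = sym (begin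
  concat (tabulate (λ i → F (sectionOf L i)))
    ≡⟨ tabulate-sections F (leftMark ∷ sectionsʳ L) ⟩
  ▷ ∷ F units ++ bit false ∷ concatMap F (List.map relation (allFin (#rel L)) ++ List.map function (allFin (#fun L)) ++ rightMark ∷ [])
    ≡⟨ cong (λ ys → ▷ ∷ F units ++ bit false ∷ ys) tail≡ ⟩
  ▷ ∷ F units ++ bit false ∷ List.map bit (rels ++ funs) ++ ◁ ∷ []
    ≡⟨ cong (λ ys → ▷ ∷ ys ++ bit false ∷ List.map bit (rels ++ funs) ++ ◁ ∷ []) units≡ ⟩
  ▷ ∷ List.map bit (replicate (length xs) true) ++ List.map bit (false ∷ rels ++ funs) ++ ◁ ∷ []
    ≡⟨ cong (▷ ∷_) (List.++-assoc (List.map bit (replicate (length xs) true)) _ _) ⟨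
  ▷ ∷ (List.map bit (replicate (length xs) true) ++ List.map bit (false ∷ rels ++ funs)) ++ ◁ ∷ []
    ≡⟨ cong (λ ys → ▷ ∷ ys ++ ◁ ∷ []) (List.map-++ bit (replicate (length xs) true) _) ⟨
  tapeSymbols (encode A′ xs) ∎)
  where
  open ≡-Reasoning
  open IsFinite fin
  F = sectionSymbols A′ xs
  relBits : Fin (#rel L) → List Bool
  relBits R = List.map (λ t → does (relI? R t)) (tuples xs (relArity L R))
  funBits : Fin (#fun L) → List Bool
  funBits f = cartesianProductWith (λ t y → does (funI A f t ≟ y)) (tuples xs (funArity L f)) xs
  rels = concatMap relBits (allFin (#rel L))
  funs = concatMap funBits (allFin (#fun L))
  units≡ : F units ≡ List.map bit (replicate (length xs) true)
  units≡ = begin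
    List.map (λ _ → bit true) (tuples xs 1)     ≡⟨ map-constant (bit true) (tuples xs 1) ⟩
    replicate (length (tuples xs 1)) (bit true) ≡⟨ cong (λ m → replicate m (bit true)) (trans (length-tuples xs 1) (ℕ.*-identityʳ (length xs))) ⟩
    replicate (length xs) (bit true)            ≡⟨ List.map-replicate bit (length xs) true ⟨
    List.map bit (replicate (length xs) true)   ∎
  rels≡ : concatMap F (List.map relation (allFin (#rel L))) ≡ List.map bit rels
  rels≡ = trans (List.concatMap-map F relation (allFin (#rel L)))
    (trans (List.concatMap-cong (λ R → List.map-∘ (tuples xs (relArity L R))) (allFin (#rel L))) (sym (List.map-concatMap bit relBits (allFin (#rel L)))))
  funs≡ : concatMap F (List.map function (allFin (#fun L))) ≡ List.map bit funs
  funs≡ = trans (List.concatMap-map F function (allFin (#fun L)))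
    (trans (List.concatMap-cong (λ f → trans (List.map-∘ (tuples xs (suc (funArity L f)))) (cong (List.map bit) (sym (tuples-snoc xs (funArity L f) (λ t y → does (funI A f t ≟ y)))))) (allFin (#fun L)))
      (sym (List.map-concatMap bit funBits (allFin (#fun L)))))
  tail≡ : concatMap F (List.map relation (allFin (#rel L)) ++ List.map function (allFin (#fun L)) ++ rightMark ∷ []) ≡ List.map bit (rels ++ funs) ++ ◁ ∷ []
  tail≡ = begin
    concatMap F (List.map relation (allFin (#rel L)) ++ List.map function (allFin (#fun L)) ++ rightMark ∷ [])
      ≡⟨ List.concatMap-++ F (List.map relation (allFin (#rel L))) _ ⟩
    concatMap F (List.map relation (allFin (#rel L))) ++ concatMap F (List.map function (allFin (#fun L)) ++ rightMark ∷ [])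
      ≡⟨ cong₂ _++_ rels≡ (trans (List.concatMap-++ F (List.map function (allFin (#fun L))) _) (cong (_++ ◁ ∷ []) funs≡)) ⟩
    List.map bit rels ++ List.map bit funs ++ ◁ ∷ []
      ≡⟨ List.++-assoc (List.map bit rels) _ _ ⟨
    (List.map bit rels ++ List.map bit funs) ++ ◁ ∷ []
      ≡⟨ cong (_++ ◁ ∷ []) (List.map-++ bit rels funs) ⟨
    List.map bit (rels ++ funs) ++ ◁ ∷ [] ∎

-- Quantifier-free formulas

module Formulas {L : Signature} where

  private
    K = withSuccessor L

  module _ {m : ℕ} where

    minT maxT : Term K m
    minT = app minSym []
    maxT = app maxSym []

    sucT : Term K m → Term K m
    sucT t = app succSym (t ∷ [])

    numeral : ℕ → Term K m
    numeral zero    = minT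
    numeral (suc c) = sucT (numeral c)

    -- The number occupies the least significant digit alone, so it denotes what it should only in
    -- structures larger than `c`.
    numerals : ℕ → ∀ w → Vec (Term K m) w
    numerals c zero          = []
    numerals c (suc zero)    = numeral c ∷ []
    numerals c (suc (suc w)) = minT ∷ numerals c (suc w)

    -- With `n` elements this denotes `n ^ a - 1`, the last position of a section of arity `a`. Each
    -- step of `a ≤′ w` contributes one leading zero.
    tops : ∀ {a w} → a ≤′ w → Vec (Term K m) w
    tops {w = w} ≤′-refl = Vec.replicate w maxT
    tops (≤′-step h)     = minT ∷ tops h

    eqF : ∀ {w} → Vec (Term K m) w → Vec (Term K m) w → Formula K m
    eqF []       []       = ¬' ⊥'
    eqF (s ∷ ss) (t ∷ ts) = s ≐ t ∧' eqF ss ts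

    -- An odometer: either the leading digit stays and the rest advances, or the rest turns over
    -- from all maximal to all minimal and the leading digit advances. The exclusion of `maxT` is
    -- essential, because `S` fixes the maximum.
    sucF : ∀ {w} → Vec (Term K m) w → Vec (Term K m) w → Formula K m
    sucF []       []       = ⊥'
    sucF {suc w} (s ∷ ss) (t ∷ ts) = s ≐ t ∧' sucF ss ts
      ∨' eqF ss (Vec.replicate w maxT) ∧' eqF ts (Vec.replicate w minT) ∧' ¬' (s ≐ maxT) ∧' t ≐ sucT s

    -- The digits in front of the last a must vanish: a number beyond the section reads no symbol.
    readF : ∀ {a w} → a ≤′ w → (Vec (Term K m) a → Formula K m) → Vec (Term K m) w → Formula K m
    readF ≤′-refl     φ ts       = φ ts
    readF (≤′-step h) φ (t ∷ ts) = t ≐ minT ∧' readF h φ ts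

    bitF : Formula K m → InputSymbol → Formula K m
    bitF φ ▷           = ⊥'
    bitF φ ◁           = ⊥'
    bitF φ (bit true)  = φ
    bitF φ (bit false) = ¬' φ

    contentF : (σ : Section L) → InputSymbol → Vec (Term K m) (arity σ) → Formula K m
    contentF leftMark     ▷ _  = ¬' ⊥'
    contentF leftMark     _ _  = ⊥'
    contentF rightMark    ◁ _  = ¬' ⊥'
    contentF rightMark    _ _  = ⊥'
    contentF units        ι _  = bitF (¬' ⊥') ι
    contentF separator    ι _  = bitF ⊥' ι
    contentF (relation R) ι ts = bitF (rel R ts) ι
    contentF (function f) ι ts = bitF (app (baseSym f) (front ts) ≐ back ts) ι

    ⋁F : ∀ k → (Fin k → Formula K m) → Formula K m
    ⋁F zero    φ = ⊥'
    ⋁F (suc k) φ = φ zero ∨' ⋁F k (φ ∘ suc)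

    ⊤-qf : QuantifierFree {K} {m} (¬' ⊥')
    ⊤-qf = ⊥' ⇒' ⊥'

    eqF-qf : ∀ {w} (ss ts : Vec (Term K m) w) → QuantifierFree (eqF ss ts)
    eqF-qf []       []       = ⊤-qf
    eqF-qf (s ∷ ss) (t ∷ ts) = (s ≐ t) ∧' eqF-qf ss ts

    sucF-qf : ∀ {w} (ss ts : Vec (Term K m) w) → QuantifierFree (sucF ss ts)
    sucF-qf []       []       = ⊥'
    sucF-qf (s ∷ ss) (t ∷ ts) = ((s ≐ t) ∧' sucF-qf ss ts)
      ∨' (eqF-qf ss _ ∧' (eqF-qf ts _ ∧' (((s ≐ maxT) ⇒' ⊥') ∧' (t ≐ sucT s))))

    readF-qf : ∀ {a w} (h : a ≤′ w) {φ} → (∀ ts → QuantifierFree (φ ts)) → ∀ ts → QuantifierFree (readF h φ ts)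
    readF-qf ≤′-refl     qf ts       = qf ts
    readF-qf (≤′-step h) qf (t ∷ ts) = (t ≐ minT) ∧' readF-qf h qf ts

    bitF-qf : ∀ {φ} → QuantifierFree φ → ∀ ι → QuantifierFree (bitF φ ι)
    bitF-qf qf ▷           = ⊥'
    bitF-qf qf ◁           = ⊥'
    bitF-qf qf (bit true)  = qf
    bitF-qf qf (bit false) = qf ⇒' ⊥'

    contentF-qf : ∀ σ ι ts → QuantifierFree (contentF σ ι ts)
    contentF-qf leftMark     ▷       _  = ⊤-qf
    contentF-qf leftMark     ◁       _  = ⊥'
    contentF-qf leftMark     (bit _) _  = ⊥'
    contentF-qf rightMark    ▷       _  = ⊥'
    contentF-qf rightMark    ◁       _  = ⊤-qf
    contentF-qf rightMark    (bit _) _  = ⊥'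
    contentF-qf units        ι       _  = bitF-qf ⊤-qf ι
    contentF-qf separator    ι       _  = bitF-qf ⊥' ι
    contentF-qf (relation R) ι       ts = bitF-qf (rel R ts) ι
    contentF-qf (function f) ι       ts = bitF-qf (_ ≐ _) ι

    ⋁F-qf : ∀ k {φ} → (∀ i → QuantifierFree (φ i)) → QuantifierFree (⋁F k φ)
    ⋁F-qf zero    qf = ⊥'
    ⋁F-qf (suc k) qf = qf zero ∨' ⋁F-qf k (qf ∘ suc)

  module Compile {m w : ℕ} {#sec bound : ℕ} (section : Fin #sec → Section L) (fits : ∀ i → arity (section i) ≤′ w)
    (block : Ref → Vec (Term K m) w) where

    compile : Cond #sec bound → Formula K m
    compile (is _ r i)    = eqF (block r) (numerals (toℕ i) w)
    compile (r ≈ᶜ r′)     = eqF (block r) (block r′)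
    compile (sucᶜ r r′)   = sucF (block r) (block r′)
    compile (topᶜ i r)    = eqF (block r) (tops (fits i))
    compile (readᶜ i ι r) = readF (fits i) (contentF (section i) ι) (block r)
    compile (¬ᶜ c)        = ¬' (compile c)
    compile (c ∧ᶜ d)      = compile c ∧' compile d
    compile (c ∨ᶜ d)      = compile c ∨' compile d
    compile (⋁ᶜ k c)      = ⋁F k (λ i → compile (c i))

    compile-qf : ∀ c → QuantifierFree (compile c)
    compile-qf (is _ r i)    = eqF-qf _ _
    compile-qf (r ≈ᶜ r′)     = eqF-qf _ _
    compile-qf (sucᶜ r r′)   = sucF-qf _ _
    compile-qf (topᶜ i r)    = eqF-qf _ _
    compile-qf (readᶜ i ι r) = readF-qf (fits i) (contentF-qf (section i) ι) _
    compile-qf (¬ᶜ c)        = compile-qf c ⇒' ⊥'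
    compile-qf (c ∧ᶜ d)      = compile-qf c ∧' compile-qf d
    compile-qf (c ∨ᶜ d)      = compile-qf c ∨' compile-qf d
    compile-qf (⋁ᶜ k c)      = ⋁F-qf k (λ i → compile-qf (c i))

  -- Meaning of the compiled formulas

  module Semantics (A : FiniteStructure L) (s : Successor (Carrier (proj₁ A))) where
    open IsFinite (proj₂ A) using (size; index; relI?; _≟_)
    open Successor s using (min; max; S)
    open Ranking index s

    private
      𝔸 = expand (proj₁ A) s

    tuples-‼ : ∀ {w} (v : Vec (Carrier (proj₁ A)) w) → tuples listing w ‼ val v ≡ just v
    tuples-‼ []              = refl
    tuples-‼ {suc w} (a ∷ v) = trans (cong (λ k → tuples listing (suc w) ‼ (val v + k * rank a)) (sym (trans (length-tuples listing w) (cong (_^ w) length-listing))))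
      (cartesianProductWith-‼ _∷_ listing (tuples listing w) (listing-‼ a) (tuples-‼ v))

    length-section : ∀ σ → length (sectionSymbols A listing σ) ≡ size ^ arity σ
    length-section σ = trans (List.length-map _ (tuples listing (arity σ))) (trans (length-tuples listing (arity σ)) (cong (_^ arity σ) length-listing))

    module _ {m : ℕ} (ρ : Vec (Carrier (proj₁ A)) m) where

      private
        ⟪_⟫ : ∀ {w} → Vec (Term K m) w → Vec (Carrier (proj₁ A)) w
        ⟪ ts ⟫ = evals 𝔸 ρ ts

      eval-numeral : ∀ c → eval 𝔸 ρ (numeral c) ≡ el c
      eval-numeral zero    = refl
      eval-numeral (suc c) = cong S (eval-numeral c)

      val-numerals : ∀ {c w} → 0 < w → c < size → val ⟪ numerals c w ⟫ ≡ c
      val-numerals {c} {suc zero}    _ c< = trans (ℕ.+-identityʳ _) (trans (cong rank (eval-numeral c)) (rank-el c<))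
      val-numerals {c} {suc (suc w)} _ c< = trans (cong₂ (λ x y → x + size ^ suc w * y) (val-numerals {c} {suc w} (s≤s z≤n) c<) rank-min)
        (trans (cong (c +_) (ℕ.*-zeroʳ (size ^ suc w))) (ℕ.+-identityʳ c))

      evals-replicate : ∀ w t → ⟪ Vec.replicate w t ⟫ ≡ Vec.replicate w (eval 𝔸 ρ t)
      evals-replicate zero    t = refl
      evals-replicate (suc w) t = cong (_ ∷_) (evals-replicate w t)

      val-maxs : ∀ w → suc (val ⟪ Vec.replicate w maxT ⟫) ≡ size ^ w
      val-maxs w = trans (cong (suc ∘ val) (evals-replicate w maxT)) (val-max w)

      val-mins : ∀ w → val ⟪ Vec.replicate w minT ⟫ ≡ 0
      val-mins w = trans (cong val (evals-replicate w minT)) (val-min w)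

      val-zero∷ : ∀ {w} (v : Vec (Carrier (proj₁ A)) w) → val (min ∷ v) ≡ val v
      val-zero∷ {w} v = trans (cong (λ r → val v + size ^ w * r) rank-min) (trans (cong (val v +_) (ℕ.*-zeroʳ (size ^ w))) (ℕ.+-identityʳ _))

      val-tops : ∀ {a w} (h : a ≤′ w) → suc (val ⟪ tops h ⟫) ≡ size ^ a
      val-tops {a} ≤′-refl = val-maxs a
      val-tops (≤′-step h) = trans (cong suc (val-zero∷ ⟪ tops h ⟫)) (val-tops h)

      evals-front : ∀ {k} (ts : Vec (Term K m) (suc k)) → ⟪ front ts ⟫ ≡ front ⟪ ts ⟫
      evals-front {zero}  (t ∷ []) = refl
      evals-front {suc k} (t ∷ ts) = cong (_ ∷_) (evals-front ts)

      eval-back : ∀ {k} (ts : Vec (Term K m) (suc k)) → eval 𝔸 ρ (back ts) ≡ back ⟪ ts ⟫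
      eval-back {zero}  (t ∷ []) = refl
      eval-back {suc k} (t ∷ ts) = eval-back ts

      eqF-sat : ∀ {w} (ss ts : Vec (Term K m) w) → Sat 𝔸 ρ (eqF ss ts) ⇔ val ⟪ ss ⟫ ≡ val ⟪ ts ⟫
      eqF-sat ss ts = mk⇔ (λ h → cong val (forth ss ts h)) (λ eq → back′ ss ts (val-injective ⟪ ss ⟫ ⟪ ts ⟫ eq))
        where
        forth : ∀ {w} (ss ts : Vec (Term K m) w) → Sat 𝔸 ρ (eqF ss ts) → ⟪ ss ⟫ ≡ ⟪ ts ⟫
        forth []       []       _        = refl
        forth (s ∷ ss) (t ∷ ts) (eq , h) = cong₂ _∷_ eq (forth ss ts h)
        back′ : ∀ {w} (ss ts : Vec (Term K m) w) → ⟪ ss ⟫ ≡ ⟪ ts ⟫ → Sat 𝔸 ρ (eqF ss ts)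
        back′ []       []       _  = λ ()
        back′ (s ∷ ss) (t ∷ ts) eq = cong Vec.head eq , back′ ss ts (cong Vec.tail eq)

      eqF-sat′ : ∀ {w} (ss ts : Vec (Term K m) w) {k} → val ⟪ ts ⟫ ≡ k → Sat 𝔸 ρ (eqF ss ts) ⇔ val ⟪ ss ⟫ ≡ k
      eqF-sat′ ss ts refl = eqF-sat ss ts

      sucF-sat : ∀ {w} (ss ts : Vec (Term K m) w) → Sat 𝔸 ρ (sucF ss ts) ⇔ val ⟪ ts ⟫ ≡ suc (val ⟪ ss ⟫)
      sucF-sat []       []       = mk⇔ (λ ()) (λ ())
      sucF-sat {suc w} (s ∷ ss) (t ∷ ts) = mk⇔ forth back′
        where
        a b : Carrier (proj₁ A)
        a = eval 𝔸 ρ s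
        b = eval 𝔸 ρ t
        p = size ^ w
        forth : Sat 𝔸 ρ (sucF (s ∷ ss) (t ∷ ts)) → val ⟪ ts ⟫ + p * rank b ≡ suc (val ⟪ ss ⟫ + p * rank a)
        forth (inj₁ (a≡b , h)) = cong₂ _+_ (⇒ (sucF-sat ss ts) h) (cong (λ c → p * rank c) (sym a≡b))
        forth (inj₂ (tops-ss , zeros-ts , a≢max , b≡Sa)) = trans
          (cong₂ _+_ (trans (⇒ (eqF-sat ts _) zeros-ts) (val-mins w)) (trans (cong (p *_) (trans (cong rank b≡Sa) (rank-S a a≢max))) (ℕ.*-suc p (rank a))))
          (cong (_+ p * rank a) (trans (sym (val-maxs w)) (cong suc (sym (⇒ (eqF-sat ss _) tops-ss)))))
        back′ : val ⟪ ts ⟫ + p * rank b ≡ suc (val ⟪ ss ⟫ + p * rank a) → Sat 𝔸 ρ (sucF (s ∷ ss) (t ∷ ts))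
        -- The successor of the lower part is a remainder modulo `p` unless a carry occurs. With a
        -- carry the remainder is 0 and the quotient increases, which is impossible at the maximal
        -- leading digit.
        back′ eq with ℕ.m≤n⇒m<n∨m≡n (val-< ⟪ ss ⟫)
        ... | inj₁ ss< with ts≡ , b≡a ← digit-unique p (rank b) (rank a) (val-< ⟪ ts ⟫) ss< eq =
          inj₁ (rank-injective (sym b≡a) , ⇐ (sucF-sat ss ts) ts≡)
        ... | inj₂ ss≡ with ts≡ , b≡Sa ← digit-unique p (rank b) (suc (rank a)) (val-< ⟪ ts ⟫) (ℕ.≤-<-trans z≤n (val-< ⟪ ts ⟫)) (trans eq (trans (cong (_+ p * rank a) ss≡) (sym (ℕ.*-suc p (rank a))))) =
          inj₂ (⇐ (eqF-sat ss _) (ℕ.suc-injective (trans ss≡ (sym (val-maxs w)))) , ⇐ (eqF-sat ts _) (trans ts≡ (sym (val-mins w))) , a≢max ,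
            rank-injective (trans b≡Sa (sym (rank-S a a≢max))))
          where
          a≢max : a ≢ max
          a≢max a≡max = ℕ.<-irrefl (trans b≡Sa (trans (cong (suc ∘ rank) a≡max) rank-max)) (rank< b)

      bitF-sat : ∀ {P : Set} (P? : Dec P) φ ι → Sat 𝔸 ρ φ ⇔ P → Sat 𝔸 ρ (bitF φ ι) ⇔ bit (does P?) ≡ ι
      bitF-sat P?      φ ▷           φ⇔ = mk⇔ (λ ()) (λ ())
      bitF-sat P?      φ ◁           φ⇔ = mk⇔ (λ ()) (λ ())
      bitF-sat (yes p) φ (bit true)  φ⇔ = mk⇔ (λ _ → refl) (λ _ → ⇐ φ⇔ p)
      bitF-sat (no ¬p) φ (bit true)  φ⇔ = mk⇔ (λ h → ⊥-elim (¬p (⇒ φ⇔ h))) (λ ())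
      bitF-sat (yes p) φ (bit false) φ⇔ = mk⇔ (λ h → ⊥-elim (h (⇐ φ⇔ p))) (λ ())
      bitF-sat (no ¬p) φ (bit false) φ⇔ = mk⇔ (λ _ → refl) (λ _ h → ¬p (⇒ φ⇔ h))

      contentF-sat : ∀ σ ι ts → Sat 𝔸 ρ (contentF σ ι ts) ⇔ content A σ ⟪ ts ⟫ ≡ ι
      contentF-sat leftMark     ▷           ts = mk⇔ (λ _ → refl) (λ _ ())
      contentF-sat leftMark     ◁           ts = mk⇔ (λ ()) (λ ())
      contentF-sat leftMark     (bit _)     ts = mk⇔ (λ ()) (λ ())
      contentF-sat rightMark    ▷           ts = mk⇔ (λ ()) (λ ())
      contentF-sat rightMark    ◁           ts = mk⇔ (λ _ → refl) (λ _ ())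
      contentF-sat rightMark    (bit _)     ts = mk⇔ (λ ()) (λ ())
      -- Units and separator are constant bits, treated as the truth values of truth and falsity.
      contentF-sat units        ι           ts = bitF-sat (yes (λ (e : ⊥) → e)) (¬' ⊥') ι (mk⇔ (λ h → h) (λ h → h))
      contentF-sat separator    ι           ts = bitF-sat (no (λ (e : ⊥) → e)) ⊥' ι (mk⇔ (λ e → e) (λ e → e))
      contentF-sat (relation R) ι           ts = bitF-sat (relI? R ⟪ ts ⟫) (rel R ts) ι (mk⇔ (λ h → h) (λ h → h))
      contentF-sat (function f) ι           ts = bitF-sat (funI (proj₁ A) f (front ⟪ ts ⟫) ≟ back ⟪ ts ⟫) _ ι
        (mk⇔ (λ h → trans (cong (funI (proj₁ A) f) (sym (evals-front ts))) (trans h (eval-back ts)))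
             (λ h → trans (cong (funI (proj₁ A) f) (evals-front ts)) (trans h (sym (eval-back ts)))))

      readF-sat : ∀ σ ι {w} (h : arity σ ≤′ w) ts → Sat 𝔸 ρ (readF h (contentF σ ι) ts) ⇔ sectionSymbols A listing σ ‼ val ⟪ ts ⟫ ≡ just ι
      readF-sat σ ι ≤′-refl ts = mk⇔ (λ h → trans here (cong just (⇒ (contentF-sat σ ι ts) h)))
                                     (λ eq → ⇐ (contentF-sat σ ι ts) (Maybe.just-injective (trans (sym here) eq)))
        where
        here : sectionSymbols A listing σ ‼ val ⟪ ts ⟫ ≡ just (content A σ ⟪ ts ⟫)
        here = trans (‼-map (content A σ) (tuples listing (arity σ)) (val ⟪ ts ⟫)) (cong (Maybe.map (content A σ)) (tuples-‼ ⟪ ts ⟫))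
      readF-sat σ ι {suc w} (≤′-step h) (t ∷ ts) = mk⇔
        (λ (t≡ , rd) → trans (cong (sectionSymbols A listing σ ‼_) (trans (cong (λ a → val (a ∷ ⟪ ts ⟫)) t≡) (val-zero∷ ⟪ ts ⟫))) (⇒ (readF-sat σ ι h ts) rd))
        (λ eq → let t≡ = leading eq in
                t≡ , ⇐ (readF-sat σ ι h ts) (trans (cong (sectionSymbols A listing σ ‼_) (sym (trans (cong (λ a → val (a ∷ ⟪ ts ⟫)) t≡) (val-zero∷ ⟪ ts ⟫)))) eq))
        where
        leading : sectionSymbols A listing σ ‼ val ⟪ t ∷ ts ⟫ ≡ just ι → eval 𝔸 ρ t ≡ min
        leading eq with rank (eval 𝔸 ρ t) in r≡
        ... | zero  = rank-injective (trans r≡ (sym rank-min))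
        -- A nonzero leading digit makes the number at least `size ^ w`, hence at least the length
        -- of the section.
        ... | suc r = ⊥-elim (ℕ.<⇒≱ (‼⇒< (sectionSymbols A listing σ) _ eq) (ℕ.≤-trans (ℕ.≤-reflexive (length-section σ))
          (ℕ.≤-trans (ℕ.^-monoʳ-≤ size {{Fin.nonZeroIndex (Inverse.to index min)}} (ℕ.≤′⇒≤ h)) (ℕ.≤-trans (ℕ.m≤m*n (size ^ w) (suc r)) (ℕ.m≤n+m _ (val ⟪ ts ⟫))))))

      ⋁F-sat : ∀ k {φ : Fin k → Formula K m} {P : Fin k → Set} → (∀ i → Sat 𝔸 ρ (φ i) ⇔ P i) → Sat 𝔸 ρ (⋁F k φ) ⇔ ∃ P
      ⋁F-sat zero    φ⇔ = mk⇔ (λ ()) (λ ())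
      ⋁F-sat (suc k) φ⇔ = mk⇔
        (λ { (inj₁ h) → zero , ⇒ (φ⇔ zero) h ; (inj₂ h) → let i , p = ⇒ (⋁F-sat k (φ⇔ ∘ suc)) h in suc i , p })
        (λ { (zero , p) → inj₁ (⇐ (φ⇔ zero) p) ; (suc i , p) → inj₂ (⇐ (⋁F-sat k (φ⇔ ∘ suc)) (i , p)) })

      module _ {w #sec bound : ℕ} (section : Fin #sec → Section L) (fits : ∀ i → arity (section i) ≤′ w)
        (block : Ref → Vec (Term K m) w) (0<w : 0 < w) (bound≤ : bound ≤ size) where
        open Compile {bound = bound} section fits block

        compile-sat : ∀ {u u′} → (∀ r → val ⟪ block r ⟫ ≡ registerValue u u′ r) → ∀ c →
          Sat 𝔸 ρ (compile c) ⇔ Holds (λ i → sectionSymbols A listing (section i)) c u u′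
        compile-sat vals (is m≤ r i) rewrite sym (vals r) =
          eqF-sat′ (block r) (numerals (toℕ i) w) (val-numerals 0<w (ℕ.<-≤-trans (Fin.toℕ<n i) (ℕ.≤-trans m≤ bound≤)))
        compile-sat vals (r ≈ᶜ r′) rewrite sym (vals r) | sym (vals r′) = eqF-sat (block r) (block r′)
        compile-sat vals (sucᶜ r r′) rewrite sym (vals r) | sym (vals r′) = sucF-sat (block r) (block r′)
        compile-sat vals (topᶜ i r) rewrite sym (vals r) = mk⇔
          (λ h → trans (cong suc (⇒ (eqF-sat (block r) (tops (fits i))) h)) (trans (val-tops (fits i)) (sym (length-section (section i)))))
          (λ eq → ⇐ (eqF-sat (block r) (tops (fits i))) (ℕ.suc-injective (trans eq (trans (length-section (section i)) (sym (val-tops (fits i)))))))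
        compile-sat vals (readᶜ i ι r) rewrite sym (vals r) = readF-sat (section i) ι (fits i) (block r)
        compile-sat vals (¬ᶜ c) = mk⇔ (λ h p → h (⇐ (compile-sat vals c) p)) (λ h p → h (⇒ (compile-sat vals c) p))
        compile-sat vals (c ∧ᶜ d) = mk⇔ (λ (h , k) → ⇒ (compile-sat vals c) h , ⇒ (compile-sat vals d) k) (λ (h , k) → ⇐ (compile-sat vals c) h , ⇐ (compile-sat vals d) k)
        compile-sat vals (c ∨ᶜ d) = mk⇔ (λ { (inj₁ h) → inj₁ (⇒ (compile-sat vals c) h) ; (inj₂ h) → inj₂ (⇒ (compile-sat vals d) h) })
                                        (λ { (inj₁ h) → inj₁ (⇐ (compile-sat vals c) h) ; (inj₂ h) → inj₂ (⇐ (compile-sat vals d) h) })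
        compile-sat vals (⋁ᶜ k c) = ⋁F-sat k (λ i → compile-sat vals (c i))

-- Finiteness and size bounds

-- The order is carried along `f` to a strict partial order on `Fin m`, where well-foundedness is
-- known.
wellFounded-finite : {V : Set} {m : ℕ} (f : V → Fin m) → Injective _≡_ _≡_ f → {_≺_ : Rel V 0ℓ} → IsLinearOrder _≺_ → WellFounded _≺_
wellFounded-finite {V} {m} f inj {_≺_} lin v = go (spo-wellFounded spo (f v))
  where
  open IsStrictTotalOrder lin using () renaming (trans to ≺-trans; irrefl to ≺-irrefl)
  _⊏_ : Rel (Fin m) 0ℓ
  i ⊏ j = ∃₂ λ u v → f u ≡ i × f v ≡ j × u ≺ v
  spo : IsStrictPartialOrder _≡_ _⊏_
  spo = record
    { isEquivalence = isEquivalence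
    ; irrefl        = λ { refl (u , v , u≡ , v≡ , u≺v) → ≺-irrefl (inj (trans u≡ (sym v≡))) u≺v }
    ; trans         = λ { (u , v , u≡ , v≡ , u≺v) (v′ , w , v′≡ , w≡ , v′≺w) →
                          u , w , u≡ , w≡ , ≺-trans u≺v (subst (_≺ w) (inj (trans v′≡ (sym v≡))) v′≺w) }
    ; <-resp-≈      = (λ { refl h → h }) , (λ { refl h → h }) }
  go : ∀ {v} → Acc _⊏_ (f v) → Acc _≺_ v
  go (acc rs) = acc λ u≺v → go (rs (_ , _ , refl , refl , u≺v))

∃-Vec? : {A : Set} → (∀ {P : A → Set} → (∀ a → Dec (P a)) → Dec (∃ P)) →
         ∀ k {P : Vec A k → Set} → (∀ v → Dec (P v)) → Dec (∃ P)
∃-Vec? ∃? zero    P? = map′ (λ p → [] , p) (λ { ([] , p) → p }) (P? [])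
∃-Vec? ∃? (suc k) P? = map′ (λ (a , v , p) → a ∷ v , p) (λ { (a ∷ v , p) → a , v , p }) (∃? λ a → ∃-Vec? ∃? k λ v → P? (a ∷ v))

module _ {V : Set} {R : Rel V 0ℓ} where

  infixr 5 _▻▻_

  _▻▻_ : ∀ {u v w m n} → Path R u m v → Path R v n w → Path R u (n + m) w
  π ▻▻ []      = π
  π ▻▻ (ρ ▻ e) = (π ▻▻ ρ) ▻ e

  star-path : ∀ {u v} → Star R u v → ∃ λ n → Path R u n v
  star-path ε        = 0 , []
  star-path (e ◅ es) with n , π ← star-path es = n + 1 , ([] ▻ e) ▻▻ π

  path-split : ∀ {u v n} → Path R u n v → ∀ i → i ≤ n → ∃ λ x → Path R u i x × Path R x (n ℕ.∸ i) v
  path-split {n = n} π i i≤n with ℕ.m≤n⇒m<n∨m≡n i≤n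
  path-split {v = v} π i i≤n | inj₂ refl = v , π , subst (λ k → Path R v k v) (sym (ℕ.n∸n≡0 i)) []
  path-split {v = v} {n = suc n} (π ▻ e) i i≤n | inj₁ (s≤s i≤n′) with x , π₁ , ρ ← path-split π i i≤n′ =
    x , π₁ , subst (λ k → Path R x k v) (sym (ℕ.+-∸-assoc 1 i≤n′)) (ρ ▻ e)

  -- A path longer than `m` visits some vertex twice, and the part between the two visits is cut
  -- out.
  path-shorten : ∀ {m} (f : V → Fin m) → Injective _≡_ _≡_ f → ∀ {u v n} → Path R u n v → ∃ λ k → k ≤ m × Path R u k v
  path-shorten {m} f inj {u} {v} {n} = go (<-wellFounded n)
    where
    go : ∀ {n} → Acc _<_ n → Path R u n v → ∃ λ k → k ≤ m × Path R u k v
    go {n} (acc rs) π with n ℕ.≤? m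
    ... | yes n≤m = n , n≤m , π
    ... | no  n≰m with i , j , i<j , eq ← Fin.pigeonhole (ℕ.m≤n⇒m≤1+n (ℕ.≰⇒> n≰m)) (λ (i : Fin (suc n)) → f (proj₁ (path-split π (toℕ i) (ℕ.≤-pred (Fin.toℕ<n i)))))
      with path-split π (toℕ i) (ℕ.≤-pred (Fin.toℕ<n i)) | path-split π (toℕ j) (ℕ.≤-pred (Fin.toℕ<n j))
    ... | x , π₁ , _ | y , _ , ρ₂ with refl ← inj eq = go (rs shorter) (π₁ ▻▻ ρ₂)
      where
      shorter : n ℕ.∸ toℕ j + toℕ i < n
      shorter = ℕ.<-≤-trans (ℕ.+-monoʳ-< (n ℕ.∸ toℕ j) i<j) (ℕ.≤-reflexive (ℕ.m∸n+n≡m (ℕ.≤-pred (Fin.toℕ<n j))))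

path-pad : {V : Set} {R R′ : Rel V 0ℓ} → (∀ {u v} → R u v → R′ u v) → (∀ {v} → R′ v v) →
           ∀ {u v k n} → k ≤ n → Path R u k v → Path R′ u n v
path-pad {R′ = R′} R⇒R′ stutter {u} {v} {k} {n} k≤n π = subst (λ n → Path R′ u n v) (ℕ.m∸n+n≡m k≤n) (convert π ▻▻ wait (n ℕ.∸ k))
  where
  convert : ∀ {k v} → Path _ u k v → Path R′ u k v
  convert []      = []
  convert (π ▻ e) = convert π ▻ R⇒R′ e
  wait : ∀ n → Path R′ v n v
  wait zero    = []
  wait (suc n) = wait n ▻ stutter

-- This replaces the logarithm of `n`: the lower bound on `2 ^ x` controls logarithms of powers of
-- `n`, and the upper bound leads back from powers of two to powers of `n`.
binaryBound : ∀ n → 1 ≤ n → ∃ λ x → n ≤ 2 ^ x × 2 ^ x ≤ 2 * n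
binaryBound (suc zero)    _ = 0 , s≤s z≤n , s≤s z≤n
binaryBound (suc (suc n)) _ with x , n≤ , ≤2n ← binaryBound (suc n) (s≤s z≤n) with ℕ.m≤n⇒m<n∨m≡n n≤
... | inj₁ n<  = x , n< , ℕ.≤-trans ≤2n (ℕ.*-monoʳ-≤ 2 (ℕ.n≤1+n (suc n)))
... | inj₂ n≡ = suc x , subst (λ k → suc (suc n) ≤ 2 * k) n≡ (subst (suc (suc n) ≤_) (sym (lemma n)) (s≤s (s≤s (ℕ.m≤m+n n n)))) ,
                 subst (λ k → 2 * k ≤ 2 * suc (suc n)) n≡ (ℕ.*-monoʳ-≤ 2 (ℕ.n≤1+n (suc n)))
  where
  lemma : ∀ n → 2 * suc n ≡ suc (suc (n + n))
  lemma = solve-∀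

n≤2^n : ∀ n → n ≤ 2 ^ n
n≤2^n zero    = z≤n
n≤2^n (suc n) = ℕ.+-mono-≤ (ℕ.m^n>0 2 n) (ℕ.≤-trans (n≤2^n n) (ℕ.m≤m+n _ 0))

-- Since `B ≤ 2 ^ B`, the left side is at most a power of two with exponent linear in `x * e`, where
-- `2 ^ x ≤ 2 * n ≤ n ^ 2`. The square accounts for the factor 2 in `1 + 2 * e`, the additional 1 in
-- the space bound for the summand 1.
space-bound : ∀ n e κ B .{{_ : NonZero B}} {l} → 2 ≤ n → l ≤ n ^ e → B ^ (κ * suc ⌈log₂ l ⌉) ≤ n ^ ((1 + 2 * e) * (B * κ))
space-bound n e κ B {l} 2≤n l≤ with x , n≤ , ≤2n ← binaryBound n (ℕ.<⇒≤ 2≤n) = begin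
  B ^ (κ * suc ⌈log₂ l ⌉)         ≤⟨ ℕ.^-monoʳ-≤ B (ℕ.*-monoʳ-≤ κ (s≤s log≤)) ⟩
  B ^ (κ * suc (x * e))           ≤⟨ ℕ.^-monoˡ-≤ (κ * suc (x * e)) (n≤2^n B) ⟩
  (2 ^ B) ^ (κ * suc (x * e))     ≡⟨ ℕ.^-*-assoc 2 B (κ * suc (x * e)) ⟩
  2 ^ (B * (κ * suc (x * e)))     ≡⟨ cong (2 ^_) (rearrange B κ x e) ⟩
  2 ^ (suc (x * e) * (B * κ))     ≡⟨ ℕ.^-*-assoc 2 (suc (x * e)) (B * κ) ⟨
  (2 * 2 ^ (x * e)) ^ (B * κ)     ≡⟨ cong (λ k → (2 * k) ^ (B * κ)) (ℕ.^-*-assoc 2 x e) ⟨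
  (2 * (2 ^ x) ^ e) ^ (B * κ)     ≤⟨ ℕ.^-monoˡ-≤ (B * κ) (ℕ.*-mono-≤ 2≤n (ℕ.^-monoˡ-≤ e 2^x≤)) ⟩
  (n * (n ^ 2) ^ e) ^ (B * κ)     ≡⟨ cong (λ k → (n * k) ^ (B * κ)) (ℕ.^-*-assoc n 2 e) ⟩
  (n ^ (1 + 2 * e)) ^ (B * κ)     ≡⟨ ℕ.^-*-assoc n (1 + 2 * e) (B * κ) ⟩
  n ^ ((1 + 2 * e) * (B * κ))     ∎
  where
  open ℕ.≤-Reasoning
  rearrange : ∀ B κ x e → B * (κ * suc (x * e)) ≡ suc (x * e) * (B * κ)
  rearrange = solve-∀
  2^x≤ : 2 ^ x ≤ n ^ 2
  2^x≤ = ℕ.≤-trans ≤2n (ℕ.*-mono-≤ 2≤n (ℕ.≤-reflexive (sym (ℕ.*-identityʳ n))))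
  log≤ : ⌈log₂ l ⌉ ≤ x * e
  log≤ = subst (⌈log₂ l ⌉ ≤_) (⌈log₂2^n⌉≡n (x * e))
    (⌈log₂⌉-mono-≤ (ℕ.≤-trans l≤ (ℕ.≤-trans (ℕ.^-monoˡ-≤ e n≤) (ℕ.≤-reflexive (ℕ.^-*-assoc 2 x e)))))

length-concat-≤ : {A : Set} {m c : ℕ} (F : Fin m → List A) → (∀ i → length (F i) ≤ c) → length (concat (tabulate F)) ≤ m * c
length-concat-≤ {m = zero}  F F≤ = z≤n
length-concat-≤ {m = suc m} F F≤ = ℕ.≤-trans (ℕ.≤-reflexive (List.length-++ (F zero))) (ℕ.+-mono-≤ (F≤ zero) (length-concat-≤ (F ∘ suc) (F≤ ∘ suc)))

finMaximum : ∀ {m} (f : Fin m → ℕ) → ∃ λ b → ∀ i → f i ≤ b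
finMaximum {zero}  f = 0 , λ ()
finMaximum {suc m} f with b , f≤ ← finMaximum (f ∘ suc) = f zero ℕ.⊔ b , λ { zero → ℕ.m≤m⊔n _ b ; (suc i) → ℕ.≤-trans (f≤ i) (ℕ.m≤n⊔m (f zero) b) }

-- The interpreted graph

-- A vertex consists of R registers of W digits and a clock of D digits, most significant digits first.
module Layout {L : Signature} (R W D : ℕ) where
  open Formulas {L}

  private
    K = withSuccessor L

  k : ℕ
  k = R * W + D

  module _ {m : ℕ} where

    tuple : (Fin k → Fin m) → Vec (Term K m) k
    tuple ι = Vec.tabulate (λ i → var (ι i))

    register : (Fin k → Fin m) → Fin R → Vec (Term K m) W
    register ι r = Vec.tabulate (λ j → var (ι (combine r j ↑ˡ D)))

    clock : (Fin k → Fin m) → Vec (Term K m) D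
    clock ι = Vec.tabulate (λ j → var (ι ((R * W) ↑ʳ j)))

    vertex : Vec ℕ R → Term K m → Vec (Term K m) k
    vertex u t = Vec.concat (Vec.map (λ c → numerals c W) u) Vec.++ Vec.replicate D t

  module Decoding (A : FiniteStructure L) (s : Successor (Carrier (proj₁ A))) where
    open IsFinite (proj₂ A) using (size; index)
    open Successor s using (min)
    open Ranking index s
    open Semantics A s

    private
      𝔸 = expand (proj₁ A) s
      ∣A∣ = Carrier (proj₁ A)

    nodeOf : Vec ∣A∣ (R * W) → Vec ℕ R
    nodeOf x = Vec.tabulate (λ r → val (Vec.tabulate (λ j → Vec.lookup x (combine r j))))

    node : Vec ∣A∣ k → Vec ℕ R
    node v = Vec.tabulate (λ r → val (Vec.tabulate (λ j → Vec.lookup v (combine r j ↑ˡ D))))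

    time : Vec ∣A∣ k → ℕ
    time v = val (Vec.tabulate (λ j → Vec.lookup v ((R * W) ↑ʳ j)))

    nodeOf-concat : ∀ (xss : Vec (Vec ∣A∣ W) R) → nodeOf (Vec.concat xss) ≡ Vec.map val xss
    nodeOf-concat xss = trans (Vec.tabulate-cong (λ r → cong val (trans (Vec.tabulate-cong (Vec.lookup-concat xss r)) (Vec.tabulate∘lookup (Vec.lookup xss r)))))
      (trans (Vec.tabulate-∘ val (Vec.lookup xss)) (cong (Vec.map val) (Vec.tabulate∘lookup xss)))

    map-val-injective : ∀ {m w} (xss yss : Vec (Vec ∣A∣ w) m) → Vec.map val xss ≡ Vec.map val yss → xss ≡ yss
    map-val-injective []         []         _  = refl
    map-val-injective (xs ∷ xss) (ys ∷ yss) eq = cong₂ _∷_ (val-injective xs ys (Vec.∷-injectiveˡ eq)) (map-val-injective xss yss (Vec.∷-injectiveʳ eq))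

    nodeOf-injective : ∀ x y → nodeOf x ≡ nodeOf y → x ≡ y
    nodeOf-injective x y eq with xss , refl ← Vec.group R W x | yss , refl ← Vec.group R W y
      = cong Vec.concat (map-val-injective xss yss (trans (sym (nodeOf-concat xss)) (trans eq (nodeOf-concat yss))))

    realise : ∀ {m} {u : Vec ℕ m} → All (_< size ^ W) u → ∃ λ (xss : Vec (Vec ∣A∣ W) m) → Vec.map val xss ≡ u
    realise []       = [] , refl
    realise (m< ∷ b) with v , v≡ ← val-surjective W m< | xss , xss≡ ← realise b = v ∷ xss , cong₂ _∷_ v≡ xss≡

    nodeOf-surjective : ∀ {u} → All (_< size ^ W) u → ∃ λ x → nodeOf x ≡ u
    nodeOf-surjective b with xss , xss≡ ← realise b = Vec.concat xss , trans (nodeOf-concat xss) xss≡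

    node-++ : ∀ x t → node (x Vec.++ t) ≡ nodeOf x
    node-++ x t = Vec.tabulate-cong (λ r → cong val (Vec.tabulate-cong (λ j → Vec.lookup-++ˡ x t (combine r j))))

    time-++ : ∀ (x : Vec ∣A∣ (R * W)) t → time (x Vec.++ t) ≡ val t
    time-++ x t = cong val (trans (Vec.tabulate-cong (Vec.lookup-++ʳ x t)) (Vec.tabulate∘lookup t))

    digits : ℕ → ∀ w → Vec ∣A∣ w
    digits c zero          = []
    digits c (suc zero)    = el c ∷ []
    digits c (suc (suc w)) = min ∷ digits c (suc w)

    registersOf : ∀ {n} → Vec ℕ n → Vec ∣A∣ (n * W)
    registersOf u = Vec.concat (Vec.map (λ c → digits c W) u)

    vertexOf : Vec ℕ R → ∣A∣ → Vec ∣A∣ k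
    vertexOf u t = registersOf u Vec.++ Vec.replicate D t

    module _ {m : ℕ} (ρ : Vec ∣A∣ m) where

      evals-++ : ∀ {v w} (ss : Vec (Term K m) v) (ts : Vec (Term K m) w) → evals 𝔸 ρ (ss Vec.++ ts) ≡ evals 𝔸 ρ ss Vec.++ evals 𝔸 ρ ts
      evals-++ []       ts = refl
      evals-++ (s ∷ ss) ts = cong (eval 𝔸 ρ s ∷_) (evals-++ ss ts)

      evals-numerals : ∀ c w → evals 𝔸 ρ (numerals c w) ≡ digits c w
      evals-numerals c zero          = refl
      evals-numerals c (suc zero)    = cong (_∷ []) (eval-numeral ρ c)
      evals-numerals c (suc (suc w)) = cong (min ∷_) (evals-numerals c (suc w))

      evals-registers : ∀ {n} (u : Vec ℕ n) → evals 𝔸 ρ (Vec.concat (Vec.map (λ c → numerals c W) u)) ≡ registersOf u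
      evals-registers []      = refl
      evals-registers (c ∷ u) = trans (evals-++ (numerals c W) _) (cong₂ Vec._++_ (evals-numerals c W) (evals-registers u))

      evals-vertex : ∀ u t → evals 𝔸 ρ (vertex u t) ≡ vertexOf u (eval 𝔸 ρ t)
      evals-vertex u t = trans (evals-++ (Vec.concat (Vec.map (λ c → numerals c W) u)) _) (cong₂ Vec._++_ (evals-registers u) (evals-replicate ρ D t))

      evals-tabulate : ∀ {w} (g : Fin w → Fin m) → evals 𝔸 ρ (Vec.tabulate (λ i → var (g i))) ≡ Vec.tabulate (λ i → Vec.lookup ρ (g i))
      evals-tabulate {zero}  g = refl
      evals-tabulate {suc w} g = cong (Vec.lookup ρ (g zero) ∷_) (evals-tabulate (λ i → g (suc i)))

      module _ (ι : Fin k → Fin m) (v : Vec ∣A∣ k) (ι≡ : ∀ i → Vec.lookup ρ (ι i) ≡ Vec.lookup v i) where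

        tuple-evals : evals 𝔸 ρ (tuple ι) ≡ v
        tuple-evals = trans (evals-tabulate ι) (trans (Vec.tabulate-cong ι≡) (Vec.tabulate∘lookup v))

        register-val : ∀ r → val (evals 𝔸 ρ (register ι r)) ≡ Vec.lookup (node v) r
        register-val r = trans (cong val (trans (evals-tabulate (λ j → ι (combine r j ↑ˡ D))) (Vec.tabulate-cong (λ j → ι≡ (combine r j ↑ˡ D)))))
          (sym (Vec.lookup∘tabulate (λ r → val (Vec.tabulate (λ j → Vec.lookup v (combine r j ↑ˡ D)))) r))

        clock-val : val (evals 𝔸 ρ (clock ι)) ≡ time v
        clock-val = cong val (trans (evals-tabulate (λ j → ι ((R * W) ↑ʳ j))) (Vec.tabulate-cong (λ j → ι≡ ((R * W) ↑ʳ j))))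

        vertex-sat : ∀ u t → Sat 𝔸 ρ (eqF (tuple ι) (vertex u t)) ⇔ v ≡ vertexOf u (eval 𝔸 ρ t)
        vertex-sat u t = mk⇔
          (λ h → trans (sym tuple-evals) (trans (val-injective _ _ (⇒ (eqF-sat ρ (tuple ι) (vertex u t)) h)) (evals-vertex u t)))
          (λ h → ⇐ (eqF-sat ρ (tuple ι) (vertex u t)) (cong val (trans tuple-evals (trans h (sym (evals-vertex u t))))))

    module _ (0<W : 0 < W) where

      nodeOf-registers : ∀ {u} → All (_< size) u → nodeOf (registersOf u) ≡ u
      nodeOf-registers {u} b = trans (nodeOf-concat (Vec.map (λ c → digits c W) u)) (go b)
        where
        go : ∀ {n} {u : Vec ℕ n} → All (_< size) u → Vec.map val (Vec.map (λ c → digits c W) u) ≡ u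
        go []                   = refl
        go {u = c ∷ _} (c< ∷ b) = cong₂ _∷_ (trans (cong val (sym (evals-numerals [] c W))) (val-numerals [] 0<W c<)) (go b)

      node-vertex : ∀ {u} t → All (_< size) u → node (vertexOf u t) ≡ u
      node-vertex {u} t b = trans (node-++ (registersOf u) (Vec.replicate D t)) (nodeOf-registers b)

    time-vertex : ∀ u t → time (vertexOf u t) ≡ val (Vec.replicate D t)
    time-vertex u t = time-++ (registersOf u) (Vec.replicate D t)

-- The quantifier-free interpretation

module Reduction (L : Signature) (M : Machine) (W D : ℕ) (0<W : 0 < W) (fits : ∀ i → arity (sectionOf L i) ≤′ W) where
  open Program M (length (sectionsʳ L))
  open Formulas {L}
  open Layout {L} 10 W D public

  K : Signature
  K = withSuccessor L

  -- Staying put makes reachability within T steps the same as reachability in exactly T steps.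
  stayᶜ moveᶜ : C
  stayᶜ = keep copyR ∧ᶜ keep modeR ∧ᶜ keep stateR ∧ᶜ keep secR ∧ᶜ keep auxR ∧ᶜ keep dirR ∧ᶜ keep headR ∧ᶜ keep xR ∧ᶜ keep yR ∧ᶜ keep tempR
  moveᶜ = stepᶜ ∨ᶜ stayᶜ

  module _ {m : ℕ} (ι ι′ : Fin k → Fin m) where

    registers : Ref → Vec (Term K m) W
    registers (old r) = register ι r
    registers (new r) = register ι′ r

    open Compile {bound = bound} (sectionOf L) fits registers

    forwardF bridgeF : Formula K m
    forwardF = sucF (clock ι) (clock ι′) ∧' compile moveᶜ
    bridgeF  = eqF (tuple ι) (vertex (startNode 0) minT) ∧' eqF (tuple ι′) (vertex (startNode 1) minT)

    forwardF-qf : QuantifierFree forwardF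
    forwardF-qf = sucF-qf (clock ι) (clock ι′) ∧' compile-qf moveᶜ

    bridgeF-qf : QuantifierFree bridgeF
    bridgeF-qf = eqF-qf (tuple ι) (vertex (startNode 0) minT) ∧' eqF-qf (tuple ι′) (vertex (startNode 1) minT)

  constantNode : Constant → Node
  constantNode x₁ = startNode 0
  constantNode y₁ = startNode 0
  constantNode z₁ = finalNode 0
  constantNode x₂ = startNode 1
  constantNode y₂ = startNode 1
  constantNode z₂ = finalNode 1

  constantTime : Constant → Term K 0
  constantTime x₁ = minT
  constantTime y₁ = maxT
  constantTime z₁ = maxT
  constantTime x₂ = minT
  constantTime y₂ = maxT
  constantTime z₂ = maxT

  module _ (k≢0 : NonZero k) where

    γ : Interpretation K
    γ = record
      { k        = k
      ; k≢0      = k≢0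
      ; ∂        = ¬' ⊥'
      ; edge     = forwardF (_↑ˡ k) (k ↑ʳ_) ∨' forwardF (k ↑ʳ_) (_↑ˡ k) ∨' bridgeF (_↑ˡ k) (k ↑ʳ_) ∨' bridgeF (k ↑ʳ_) (_↑ˡ k)
      ; constant = λ c → record { cases = [] ; default = vertex (constantNode c) (constantTime c) } }

    γ-qf : IsQuantifierFree γ
    γ-qf = record
      { ∂-qf     = ⊤-qf
      ; edge-qf  = forwardF-qf (_↑ˡ k) (k ↑ʳ_) ∨' (forwardF-qf (k ↑ʳ_) (_↑ˡ k) ∨' (bridgeF-qf (_↑ˡ k) (k ↑ʳ_) ∨' bridgeF-qf (k ↑ʳ_) (_↑ˡ k)))
      ; cases-qf = λ _ () }

-- Adjacency, sides and clock values of the interpreted graph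

module Graph (L : Signature) (M : Machine) (W D : ℕ) (0<W : 0 < W) (fits : ∀ i → arity (sectionOf L i) ≤′ W)
  (k≢0 : NonZero (10 * W + D)) (A : FiniteStructure L) (big : Program.bound M (length (sectionsʳ L)) ≤ card A)
  (s : Successor (Carrier (proj₁ A))) where
  open Program M (length (sectionsʳ L))
  open Formulas {L}
  open Reduction L M W D 0<W fits
  open IsFinite (proj₂ A) using (size; index)
  open Successor s using (min; max)
  open Ranking index s
  open Semantics A s
  open Decoding A s

  𝔹 : FiniteStructure K
  𝔹 = successorExpansion A s

  ∣A∣ : Set
  ∣A∣ = Carrier (proj₁ A)

  symbols : Fin #sec → List InputSymbol
  symbols i = sectionSymbols A listing (sectionOf L i)

  Forward Bridge Edge : Rel (Vec ∣A∣ k) 0ℓ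
  Forward u v = time v ≡ suc (time u) × Holds symbols moveᶜ (node u) (node v)
  Bridge u v  = u ≡ vertexOf (startNode 0) min × v ≡ vertexOf (startNode 1) min
  Edge u v    = Forward u v ⊎ Forward v u ⊎ Bridge u v ⊎ Bridge v u

  module _ {m : ℕ} (ρ : Vec ∣A∣ m) (ι ι′ : Fin k → Fin m) (u v : Vec ∣A∣ k)
    (ι≡ : ∀ i → Vec.lookup ρ (ι i) ≡ Vec.lookup u i) (ι′≡ : ∀ i → Vec.lookup ρ (ι′ i) ≡ Vec.lookup v i) where

    registers-val : ∀ r → val (evals (proj₁ 𝔹) ρ (registers ι ι′ r)) ≡ registerValue (node u) (node v) r
    registers-val (old r) = register-val ρ ι u ι≡ r
    registers-val (new r) = register-val ρ ι′ v ι′≡ r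

    forward-sat : Sat (proj₁ 𝔹) ρ (forwardF ι ι′) ⇔ Forward u v
    forward-sat = mk⇔
      (λ (t , h) → trans (sym v-time) (trans (⇒ (sucF-sat ρ (clock ι) (clock ι′)) t) (cong suc u-time)) , ⇒ compiled h)
      (λ (t , h) → ⇐ (sucF-sat ρ (clock ι) (clock ι′)) (trans v-time (trans t (cong suc (sym u-time)))) , ⇐ compiled h)
      where
      u-time = clock-val ρ ι u ι≡
      v-time = clock-val ρ ι′ v ι′≡
      compiled = compile-sat ρ (sectionOf L) fits (registers ι ι′) 0<W big {node u} {node v} registers-val moveᶜ

    bridge-sat : Sat (proj₁ 𝔹) ρ (bridgeF ι ι′) ⇔ Bridge u v
    bridge-sat = mk⇔
      (λ (h , h′) → ⇒ (vertex-sat ρ ι u ι≡ (startNode 0) minT) h , ⇒ (vertex-sat ρ ι′ v ι′≡ (startNode 1) minT) h′)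
      (λ (h , h′) → ⇐ (vertex-sat ρ ι u ι≡ (startNode 0) minT) h , ⇐ (vertex-sat ρ ι′ v ι′≡ (startNode 1) minT) h′)

  inDomain : ConstantsInDomain 𝔹 (γ k≢0)
  inDomain _ ()

  G : Structure Γ₆
  G = interpret 𝔹 (γ k≢0) inDomain

  V : Set
  V = Carrier G

  tupleOf : V → Vec ∣A∣ k
  tupleOf = Refinement.value

  mk : Vec ∣A∣ k → V
  mk v = v , Irrelevant.[ (λ ()) ]

  adj-sat : ∀ u v → Adj G u v ⇔ Edge (tupleOf u) (tupleOf v)
  adj-sat u v = mk⇔
    (λ { (inj₁ h)               → inj₁ (⇒ fwd h)
       ; (inj₂ (inj₁ h))        → inj₂ (inj₁ (⇒ bwd h))
       ; (inj₂ (inj₂ (inj₁ h))) → inj₂ (inj₂ (inj₁ (⇒ bridge h)))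
       ; (inj₂ (inj₂ (inj₂ h))) → inj₂ (inj₂ (inj₂ (⇒ bridge⁻ h))) })
    (λ { (inj₁ h)               → inj₁ (⇐ fwd h)
       ; (inj₂ (inj₁ h))        → inj₂ (inj₁ (⇐ bwd h))
       ; (inj₂ (inj₂ (inj₁ h))) → inj₂ (inj₂ (inj₁ (⇐ bridge h)))
       ; (inj₂ (inj₂ (inj₂ h))) → inj₂ (inj₂ (inj₂ (⇐ bridge⁻ h))) })
    where
    ρ : Vec ∣A∣ (k + k)
    ρ = tupleOf u Vec.++ tupleOf v
    l : ∀ i → Vec.lookup ρ (i ↑ˡ k) ≡ Vec.lookup (tupleOf u) i
    l = Vec.lookup-++ˡ (tupleOf u) (tupleOf v)
    r : ∀ i → Vec.lookup ρ (k ↑ʳ i) ≡ Vec.lookup (tupleOf v) i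
    r = Vec.lookup-++ʳ (tupleOf u) (tupleOf v)
    fwd     = forward-sat ρ (_↑ˡ k) (k ↑ʳ_) (tupleOf u) (tupleOf v) l r
    bwd     = forward-sat ρ (k ↑ʳ_) (_↑ˡ k) (tupleOf v) (tupleOf u) r l
    bridge  = bridge-sat ρ (_↑ˡ k) (k ↑ʳ_) (tupleOf u) (tupleOf v) l r
    bridge⁻ = bridge-sat ρ (k ↑ʳ_) (_↑ˡ k) (tupleOf v) (tupleOf u) r l

  constantOf : Constant → V
  constantOf c = funI G c []

  constantOf-tuple : ∀ c → tupleOf (constantOf c) ≡ vertexOf (constantNode c) (eval (proj₁ 𝔹) [] (constantTime c))
  constantOf-tuple c = evals-vertex [] (constantNode c) (constantTime c)

  small : ∀ {m} → m ≤ bound → (i : Fin m) → toℕ i < size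
  small m≤ i = ℕ.<-≤-trans (Fin.toℕ<n i) (ℕ.≤-trans m≤ big)

  startNode-small : ∀ (c : Fin 2) → All (_< size) (startNode (toℕ c))
  startNode-small c = small dir≤ c ∷ z ∷ small state≤ (Machine.start M) ∷ z ∷ z ∷ z ∷ z ∷ z ∷ z ∷ z ∷ []
    where z = small mode≤ zero

  finalNode-small : ∀ (c : Fin 2) → All (_< size) (finalNode (toℕ c))
  finalNode-small c = small dir≤ c ∷ small mode≤ (suc (suc (suc zero))) ∷ z ∷ z ∷ z ∷ z ∷ z ∷ z ∷ z ∷ z ∷ []
    where z = small mode≤ zero

  constant-small : ∀ c → All (_< size) (constantNode c)
  constant-small x₁ = startNode-small zero
  constant-small y₁ = startNode-small zero
  constant-small z₁ = finalNode-small zero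
  constant-small x₂ = startNode-small (suc zero)
  constant-small y₂ = startNode-small (suc zero)
  constant-small z₂ = finalNode-small (suc zero)

  node-constant : ∀ c → node (tupleOf (constantOf c)) ≡ constantNode c
  node-constant c = trans (cong node (constantOf-tuple c)) (node-vertex 0<W (eval (proj₁ 𝔹) [] (constantTime c)) (constant-small c))

  time-constant : ∀ c → time (tupleOf (constantOf c)) ≡ val (Vec.replicate D (eval (proj₁ 𝔹) [] (constantTime c)))
  time-constant c = trans (cong time (constantOf-tuple c)) (time-vertex (constantNode c) (eval (proj₁ 𝔹) [] (constantTime c)))

  side : V → ℕ
  side v = Vec.lookup (node (tupleOf v)) copyR

  _↝_ : Rel V 0ℓ
  u ↝ v = Forward (tupleOf u) (tupleOf v)

  step-copy : ∀ {u u′} → Holds symbols stepᶜ u u′ → Vec.lookup u′ copyR ≡ Vec.lookup u copyR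
  step-copy (inj₁ (_ , _ , _ , _ , _ , _ , _ , _ , _ , _ , _ , eq)) = eq
  step-copy (inj₂ (inj₁ (_ , (eq , _) , _)))                       = eq
  step-copy (inj₂ (inj₂ (inj₁ (_ , (eq , _) , _))))                = eq
  step-copy (inj₂ (inj₂ (inj₂ (_ , _ , eq , _))))                  = eq

  move-copy : ∀ {u u′} → Holds symbols moveᶜ u u′ → Vec.lookup u′ copyR ≡ Vec.lookup u copyR
  move-copy (inj₁ h)        = step-copy h
  move-copy (inj₂ (eq , _)) = eq

  ↝-side : ∀ {u v} → u ↝ v → side v ≡ side u
  ↝-side (_ , h) = move-copy h

  ↝-time : ∀ {u v} → u ↝ v → time (tupleOf v) ≡ suc (time (tupleOf u))
  ↝-time (t , _) = t

  ↝⇒Adj : ∀ {u v} → u ↝ v → Adj G u v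
  ↝⇒Adj {u} {v} h = ⇐ (adj-sat u v) (inj₁ h)

  constant₁ : ∀ {u} → tupleOf u ≡ vertexOf (startNode 0) min → u ≡ constantOf x₁
  constant₁ eq = cong mk (trans eq (sym (constantOf-tuple x₁)))

  constant₂ : ∀ {u} → tupleOf u ≡ vertexOf (startNode 1) min → u ≡ constantOf x₂
  constant₂ eq = cong mk (trans eq (sym (constantOf-tuple x₂)))

  Edge-sym : ∀ {u v} → Edge u v → Edge v u
  Edge-sym (inj₁ f)               = inj₂ (inj₁ f)
  Edge-sym (inj₂ (inj₁ f))        = inj₁ f
  Edge-sym (inj₂ (inj₂ (inj₁ b))) = inj₂ (inj₂ (inj₂ b))
  Edge-sym (inj₂ (inj₂ (inj₂ b))) = inj₂ (inj₂ (inj₁ b))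

  EdgeCases : Rel V 0ℓ
  EdgeCases u v = (side u ≡ side v × (u ↝ v ⊎ v ↝ u)) ⊎
    ((u ≡ constantOf x₁ × v ≡ constantOf x₂) ⊎ (u ≡ constantOf x₂ × v ≡ constantOf x₁))

  edge-cases : ∀ u v → Edge (tupleOf u) (tupleOf v) → EdgeCases u v
  edge-cases u v (inj₁ f)                     = inj₁ (sym (↝-side {u} {v} f) , inj₁ f)
  edge-cases u v (inj₂ (inj₁ f))              = inj₁ (↝-side {v} {u} f , inj₂ f)
  edge-cases u v (inj₂ (inj₂ (inj₁ (p , q)))) = inj₂ (inj₁ (constant₁ p , constant₂ q))
  edge-cases u v (inj₂ (inj₂ (inj₂ (p , q)))) = inj₂ (inj₂ (constant₂ q , constant₁ p))

  adj-cases : ∀ {u v} → Adj G u v → EdgeCases u v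
  adj-cases {u} {v} h = edge-cases u v (⇒ (adj-sat u v) h)

  bridge : Adj G (constantOf x₁) (constantOf x₂)
  bridge = ⇐ (adj-sat (constantOf x₁) (constantOf x₂)) (inj₂ (inj₂ (inj₁ (constantOf-tuple x₁ , constantOf-tuple x₂))))

  side-constant : ∀ c → side (constantOf c) ≡ Vec.lookup (constantNode c) copyR
  side-constant c = cong (λ u → Vec.lookup u copyR) (node-constant c)

  sides≢ : side (constantOf x₁) ≢ side (constantOf x₂)
  sides≢ eq = ℕ.0≢1+n (trans (sym (side-constant x₁)) (trans eq (side-constant x₂)))

  no-loop : ∀ u → ¬ EdgeCases u u
  no-loop u (inj₁ (_ , inj₁ f))   = ℕ.1+n≢n (sym (↝-time {u} {u} f))
  no-loop u (inj₁ (_ , inj₂ f))   = ℕ.1+n≢n (sym (↝-time {u} {u} f))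
  no-loop u (inj₂ (inj₁ (p , q))) = sides≢ (cong side (trans (sym p) q))
  no-loop u (inj₂ (inj₂ (p , q))) = sides≢ (cong side (trans (sym q) p))

  isGraph : IsGraph G
  isGraph = record
    { symmetric   = λ u v h → ⇐ (adj-sat v u) (Edge-sym (⇒ (adj-sat u v) h))
    ; irreflexive = λ u h → no-loop u (adj-cases {u} {u} h) }

  search∃ : ∀ {P : V → Set} → (∀ v → Dec (P v)) → Dec (∃ P)
  search∃ P? = map′ (λ (t , p) → mk t , p) (λ (v , p) → tupleOf v , p) (∃-Vec? ∃-element? k (λ t → P? (mk t)))
    where
    open Inverse index using (to; from; strictlyInverseʳ)
    ∃-element? : ∀ {P : ∣A∣ → Set} → (∀ a → Dec (P a)) → Dec (∃ P)
    ∃-element? {P} P? = map′ (λ (i , p) → from i , p) (λ (a , p) → to a , subst P (sym (strictlyInverseʳ a)) p) (Fin.any? λ i → P? (from i))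

  position : ∀ {w} → Vec ∣A∣ w → Fin (size ^ w)
  position v = Fin.fromℕ< (val-< v)

  position-injective : ∀ {w} {u v : Vec ∣A∣ w} → position u ≡ position v → u ≡ v
  position-injective {u = u} {v} eq = val-injective u v (Fin.fromℕ<-injective (val u) (val v) (val-< u) (val-< v) eq)

  ≺-wellFounded : {_≺_ : Rel V 0ℓ} → IsLinearOrder _≺_ → WellFounded _≺_
  ≺-wellFounded = wellFounded-finite (λ v → position (tupleOf v)) (λ eq → cong mk (position-injective eq))

  _~?_ : ∀ u v → Dec (Adj G u v)
  u ~? v = Sat? (proj₂ 𝔹) (tupleOf u Vec.++ tupleOf v) (Interpretation.edge (γ k≢0))

-- Acceptance is equivalent to the sentence

module Correctness (L : Signature) (M : Machine) (W D : ℕ) (0<W : 0 < W) (fits : ∀ i → arity (sectionOf L i) ≤′ W)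
  (k≢0 : NonZero (10 * W + D)) (A : FiniteStructure L) (big : Program.bound M (length (sectionsʳ L)) ≤ card A)
  (s : Successor (Carrier (proj₁ A))) (ℓ : ℕ) (codes≤N : Coding.B (Machine.#symbols M) ^ ℓ ≤ card A ^ W)
  (space : ∀ (c : Config M (encode A (Ranking.listing (IsFinite.index (proj₂ A)) s))) → Reachable M c → Config.workHead c < ℓ)
  (long : card A ^ (10 * W) < card A ^ D) where
  open Program M (length (sectionsʳ L))
  open Formulas {L} using (minT; maxT)
  open Reduction L M W D 0<W fits
  open Graph L M W D 0<W fits k≢0 A big s
  open IsFinite (proj₂ A) using (size; index)
  open Successor s using (min; max)
  open Ranking index s
  open Formulas.Semantics A s using (length-section)
  open Decoding A s

  w : List Bool
  w = encode A listing

  size≢0 : NonZero size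
  size≢0 = IsFinite.nonEmpty (proj₂ A)

  nonempty : ∀ i → 0 < length (symbols i)
  nonempty i = subst (0 <_) (sym (length-section (sectionOf L i))) (ℕ.m^n>0 size {{size≢0}} (arity (sectionOf L i)))

  bound≤N : bound ≤ size ^ W
  bound≤N = ℕ.≤-trans big (ℕ.≤-trans (ℕ.≤-reflexive (sym (ℕ.*-identityʳ size))) (ℕ.^-monoʳ-≤ size {{size≢0}} 0<W))

  section≤N : ∀ i → length (symbols i) ≤ size ^ W
  section≤N i = ℕ.≤-trans (ℕ.≤-reflexive (length-section (sectionOf L i))) (ℕ.^-monoʳ-≤ size {{size≢0}} (ℕ.≤′⇒≤ (fits i)))

  open Simulation M w (length (sectionsʳ L)) symbols (tape-sections A listing) nonempty using (Invariant; sound; invariant-start; invariant-final)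
  open Completeness M w (length (sectionsʳ L)) symbols (tape-sections A listing) nonempty (size ^ W) ℓ bound≤N section≤N codes≤N space using (_⇛_; _,_; complete; fin<)

  T : ℕ
  T = val (Vec.replicate D max)

  Steps Moves : Rel (Vec ∣A∣ (10 * W)) 0ℓ
  Steps x y = Holds symbols stepᶜ (nodeOf x) (nodeOf y)
  Moves x y = Holds symbols moveᶜ (nodeOf x) (nodeOf y)

  stay-refl : ∀ u → Holds symbols stayᶜ u u
  stay-refl u = refl , refl , refl , refl , refl , refl , refl , refl , refl , refl

  stay-≡ : ∀ u u′ → Holds symbols stayᶜ u u′ → u′ ≡ u
  stay-≡ (_ ∷ _ ∷ _ ∷ _ ∷ _ ∷ _ ∷ _ ∷ _ ∷ _ ∷ _ ∷ []) (_ ∷ _ ∷ _ ∷ _ ∷ _ ∷ _ ∷ _ ∷ _ ∷ _ ∷ _ ∷ [])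
    (refl , refl , refl , refl , refl , refl , refl , refl , refl , refl) = refl

  -- Runs of nodes become runs of tuples. The bound carried by each step makes its target the
  -- content of some tuple.
  lift-run : ∀ {u u′} → Star _⇛_ u u′ → ∀ x → nodeOf x ≡ u → ∃ λ y → nodeOf y ≡ u′ × Star Steps x y
  lift-run ε x eq = x , eq , ε
  lift-run ((st , bounded) ◅ run) x refl with y , refl ← nodeOf-surjective bounded
    with z , z≡ , run′ ← lift-run run y refl = z , z≡ , st ◅ run′

  states≤T : size ^ (10 * W) ≤ T
  states≤T = ℕ.≤-pred (subst (size ^ (10 * W) <_) (sym (val-max D)) long)

  wait-path : ∀ x → Path Moves x T x
  wait-path x = path-pad {R = Steps} inj₁ (λ {v} → inj₂ (stay-refl (nodeOf v))) z≤n []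

  -- The accepting run is shortened to at most as many steps as there are register contents, a
  -- number not exceeding `T`, and is then prolonged to exactly `T` by staying put.
  accept-path : Accepts M w → ∀ (c : Fin 2) → Path Moves (registersOf (startNode (toℕ c))) T (registersOf (finalNode (toℕ c)))
  accept-path accepts c
    with y , y≡ , run ← lift-run (complete (fin< dir≤ c) accepts) (registersOf (startNode (toℕ c))) (nodeOf-registers 0<W (startNode-small c))
    with _ , π ← star-path run
    with n , n≤ , ρ ← path-shorten position position-injective π
    = subst (Path Moves _ T) (nodeOf-injective y _ (trans y≡ (sym (nodeOf-registers 0<W (finalNode-small c)))))
        (path-pad inj₁ (λ {v} → inj₂ (stay-refl (nodeOf v))) (ℕ.≤-trans n≤ states≤T) ρ)

  -- Attaches the clock values 0, ..., `n` to the points of the path; all of them fit into `D`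
  -- digits.
  timed : ∀ {x y n} → Path Moves x n y → n < size ^ D → ∀ t → val t ≡ n → Path _↝_ (mk (x Vec.++ Vec.replicate D min)) n (mk (y Vec.++ t))
  timed {x} [] _ t t≡ = subst (λ t → Path _↝_ (mk (x Vec.++ Vec.replicate D min)) 0 (mk (x Vec.++ t)))
    (val-injective (Vec.replicate D min) t (trans (val-min D) (sym t≡))) []
  timed (_▻_ {n} {y} {z} π e) n< t t≡ with t′ , t′≡ ← val-surjective D (ℕ.<-trans (ℕ.n<1+n n) n<) =
    timed π (ℕ.<-trans (ℕ.n<1+n n) n<) t′ t′≡ ▻
    (trans (time-++ z t) (trans t≡ (cong suc (sym (trans (time-++ y t′) t′≡)))) ,
     subst (λ u → Holds symbols moveᶜ u (node (z Vec.++ t))) (sym (node-++ y t′)) (subst (λ u → Holds symbols moveᶜ (nodeOf y) u) (sym (node-++ z t)) e))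

  timed-vertices : ∀ {u u′} → Path Moves (registersOf u) T (registersOf u′) → Path _↝_ (mk (vertexOf u min)) T (mk (vertexOf u′ max))
  timed-vertices π = timed π (val-< (Vec.replicate D max)) (Vec.replicate D max) refl

  constant≡ : ∀ c → mk (vertexOf (constantNode c) (eval (proj₁ 𝔹) [] (constantTime c))) ≡ constantOf c
  constant≡ c = cong mk (sym (constantOf-tuple c))

  constant-path : ∀ c c′ → Path _↝_ (mk (vertexOf (constantNode c) (eval (proj₁ 𝔹) [] (constantTime c)))) T
                                    (mk (vertexOf (constantNode c′) (eval (proj₁ 𝔹) [] (constantTime c′)))) →
                  Path _↝_ (constantOf c) T (constantOf c′)
  constant-path c c′ π = subst (λ u → Path _↝_ u T (constantOf c′)) (constant≡ c) (subst (Path _↝_ _ T) (constant≡ c′) π)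

  xy₁ : Path _↝_ (constantOf x₁) T (constantOf y₁)
  xy₁ = constant-path x₁ y₁ (timed-vertices {startNode 0} {startNode 0} (wait-path (registersOf (startNode 0))))

  xy₂ : Path _↝_ (constantOf x₂) T (constantOf y₂)
  xy₂ = constant-path x₂ y₂ (timed-vertices {startNode 1} {startNode 1} (wait-path (registersOf (startNode 1))))

  xz₁ : Accepts M w → Path _↝_ (constantOf x₁) T (constantOf z₁)
  xz₁ accepts = constant-path x₁ z₁ (timed-vertices {startNode 0} {finalNode 0} (accept-path accepts zero))

  xz₂ : Accepts M w → Path _↝_ (constantOf x₂) T (constantOf z₂)
  xz₂ accepts = constant-path x₂ z₂ (timed-vertices {startNode 1} {finalNode 1} (accept-path accepts (suc zero)))

  -- Only forward edges occur here, so every move is a program step or a stay; this is where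
  -- directedness of the path recovered from `Ψ` is used.
  path-invariant : ∀ {u v n} → Path _↝_ u n v → Invariant (node (tupleOf u)) → Invariant (node (tupleOf v))
  path-invariant []                     inv = inv
  path-invariant (π ▻ (_ , inj₁ st))  inv = sound (path-invariant π inv) st
  path-invariant (_▻_ {v = v} {w′} π (_ , inj₂ st)) inv = subst Invariant (sym (stay-≡ (node (tupleOf v)) (node (tupleOf w′)) st)) (path-invariant π inv)

  path-accepts : ∀ c c′ i → constantNode c ≡ startNode i → constantNode c′ ≡ finalNode i → ∀ {n} → Path _↝_ (constantOf c) n (constantOf c′) → Accepts M w
  path-accepts c c′ i c≡ c′≡ π = invariant-final (subst Invariant (trans (node-constant c′) c′≡)
    (path-invariant π (subst Invariant (sym (trans (node-constant c) c≡)) (invariant-start i))))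

  time-x : ∀ c → constantTime c ≡ minT → time (tupleOf (constantOf c)) ≡ 0
  time-x c c≡ = trans (time-constant c) (trans (cong (λ t → val (Vec.replicate D (eval (proj₁ 𝔹) [] t))) c≡) (val-min D))

  time-z : ∀ c → constantTime c ≡ maxT → time (tupleOf (constantOf c)) ≡ T
  time-z c c≡ = trans (time-constant c) (cong (λ t → val (Vec.replicate D (eval (proj₁ 𝔹) [] t))) c≡)

  T≡suc : T ≡ suc (ℕ.pred T)
  T≡suc = sym (ℕ.suc-pred T {{ℕ.>-nonZero (ℕ.≤-trans (ℕ.m^n>0 size {{size≢0}} (10 * W)) states≤T)}})

  -- G is written out so that ψ is never compared with another unfolding of itself.
  module _ (_≺_ : Rel (Carrier (interpret (successorExpansion A s) (Reduction.γ L M W D 0<W fits k≢0) (Graph.inDomain L M W D 0<W fits k≢0 A big s))) 0ℓ)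
    (bft : IsBFT (interpret (successorExpansion A s) (Reduction.γ L M W D 0<W fits k≢0) (Graph.inDomain L M W D 0<W fits k≢0 A big s)) _≺_) where
    open Traversal (interpret (successorExpansion A s) (Reduction.γ L M W D 0<W fits k≢0) (Graph.inDomain L M W D 0<W fits k≢0 A big s))
      isGraph _~?_ search∃ _≺_ bft (≺-wellFounded (IsBFT.isLinear bft)) using (Ψ; Ψ⇔ψ; module Criterion)
    open Criterion side (λ v → time (tupleOf v)) _↝_
      (λ {u} {v} → adj-cases {u} {v}) (λ {u} {v} → ↝-time {u} {v}) (λ {u} {v} → ↝-side {u} {v}) (λ {u} {v} → ↝⇒Adj {u} {v})
      bridge sides≢ (trans (side-constant z₁) (sym (side-constant x₁))) (trans (side-constant z₂) (sym (side-constant x₂)))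
      (time-x x₁ refl) (time-x x₂ refl) (trans (time-z z₁ refl) T≡suc) (trans (time-z z₂ refl) T≡suc)
      (subst (λ n → Path _↝_ (constantOf x₁) n (constantOf y₁)) T≡suc xy₁)
      (subst (λ n → Path _↝_ (constantOf x₂) n (constantOf y₂)) T≡suc xy₂) using (paths⇒Ψ; Ψ⇒path)

    accepts⇒Ψ : Accepts M w → Ψ
    accepts⇒Ψ accepts = paths⇒Ψ (subst (λ n → Path _↝_ (constantOf x₁) n (constantOf z₁)) T≡suc (xz₁ accepts))
                                (subst (λ n → Path _↝_ (constantOf x₂) n (constantOf z₂)) T≡suc (xz₂ accepts))

    Ψ⇒accepts : Ψ → Accepts M w
    Ψ⇒accepts h = [ path-accepts x₁ z₁ 0 refl refl , path-accepts x₂ z₂ 1 refl refl ]′ (Ψ⇒path h)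

    accepts⇔ψ : Accepts M w ⇔
      (expandOrder (interpret (successorExpansion A s) (Reduction.γ L M W D 0<W fits k≢0) (Graph.inDomain L M W D 0<W fits k≢0 A big s)) _≺_ ⊨ ψ)
    accepts⇔ψ = mk⇔ (λ h → ⇒ Ψ⇔ψ (accepts⇒Ψ h)) (λ h → Ψ⇒accepts (⇐ Ψ⇔ψ h))

Reducible : {L : Signature} → Query L → Set₁
Reducible {L} Q =
    Σ (Interpretation (withSuccessor L)) λ γ → IsQuantifierFree γ ×
    ∃ λ (N : ℕ) → (A : FiniteStructure L) → N ≤ card A →
    (s : Successor (Carrier (proj₁ A))) →
    Σ (ConstantsInDomain (successorExpansion A s) γ) λ def →
    let G = interpret (successorExpansion A s) γ def in
    IsGraph G ×
    ((_≺_ : Rel (Carrier G) 0ℓ) → IsBFT G _≺_ →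
    Member Q A ⇔ (expandOrder G _≺_ ⊨ ψ))

module _ (L : Signature) (Q : Query L) (M : Machine) (decides : Decides M Q)
  (W D : ℕ) (0<W : 0 < W) (fits : ∀ i → arity (sectionOf L i) ≤′ W) (k≢0 : NonZero (10 * W + D))
  (ℓ : ℕ → ℕ) (space : ∀ w (c : Config M w) → Reachable M c → Config.workHead c < ℓ (length w))
  (large : ∀ (A : FiniteStructure L) → Program.bound M (length (sectionsʳ L)) ≤ card A → (s : Successor (Carrier (proj₁ A))) →
    Coding.B (Machine.#symbols M) ^ ℓ (length (encode A (Ranking.listing (IsFinite.index (proj₂ A)) s))) ≤ card A ^ W × card A ^ (10 * W) < card A ^ D) where

  reducible : Reducible Q
  reducible = Reduction.γ L M W D 0<W fits k≢0 , Reduction.γ-qf L M W D 0<W fits k≢0 , Program.bound M (length (sectionsʳ L)) , λ A big s →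
    Graph.inDomain L M W D 0<W fits k≢0 A big s , Graph.isGraph L M W D 0<W fits k≢0 A big s , λ _≺_ bft →
    mk⇔ (λ m → ⇒ (accepts⇔ψ A big s _≺_ bft) (⇐ (accepts⇔member A s) m)) (λ h → ⇒ (accepts⇔member A s) (⇐ (accepts⇔ψ A big s _≺_ bft) h))
    where
    input : (A : FiniteStructure L) → Successor (Carrier (proj₁ A)) → List Bool
    input A s = encode A (Ranking.listing (IsFinite.index (proj₂ A)) s)
    -- The machine decides the query for encodings along every linear order, in particular along the
    -- one underlying the successor expansion.
    accepts⇔member : ∀ A s → Accepts M (input A s) ⇔ Member Q A
    accepts⇔member A s = decides A (Successor._≺_ s) (Successor.isLinear s) _ (Ranking.isIncreasingListing (IsFinite.index (proj₂ A)) s)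
    accepts⇔ψ = λ A big s → Correctness.accepts⇔ψ L M W D 0<W fits k≢0 A big s (ℓ (length (input A s)))
      (proj₁ (large A big s)) (space (input A s)) (proj₂ (large A big s))

-- Choice of the numbers of digits

module Parameters (L : Signature) (M : Machine) (κ : ℕ) where
  open Program M (length (sectionsʳ L)) using (B; #sec; bound; sec≤)

  -- An input has length at most n ^ suc α, so a stack is coded by a number below n ^ exponent;
  -- the clock outlasts every run without repetitions of register contents.
  α exponent W D : ℕ
  α        = proj₁ (finMaximum (λ i → arity (sectionOf L i)))
  exponent = (1 + 2 * suc α) * (B * κ)
  W        = suc (α + exponent)
  D        = suc (10 * W)

  0<W : 0 < W
  0<W = s≤s z≤n

  k≢0 : NonZero (10 * W + D)
  k≢0 = ℕ.>-nonZero (ℕ.m≤n⇒m≤o+n (10 * W) (s≤s z≤n))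

  arity≤α : ∀ i → arity (sectionOf L i) ≤ α
  arity≤α = proj₂ (finMaximum (λ i → arity (sectionOf L i)))

  fits : ∀ i → arity (sectionOf L i) ≤′ W
  fits i = ℕ.≤⇒≤′ (ℕ.≤-trans (arity≤α i) (ℕ.m≤n⇒m≤1+n (ℕ.m≤m+n α exponent)))

  module _ (A : FiniteStructure L) (big : bound ≤ card A) (s : Successor (Carrier (proj₁ A))) where
    open IsFinite (proj₂ A) using (size; index)
    open Ranking index s using (listing)
    open Formulas.Semantics A s using (length-section)

    w : List Bool
    w = encode A listing

    2≤size : 2 ≤ size
    2≤size = ℕ.≤-trans (s≤s (s≤s z≤n)) big

    length-input : length w ≤ size ^ suc α
    length-input = begin
      length w                                                                  ≤⟨ ℕ.m≤n+m (length w) 2 ⟩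
      2 + length w                                                              ≡⟨ length-tapeSymbols w ⟨
      length (tapeSymbols w)                                                    ≡⟨ cong length (tape-sections A listing) ⟩
      length (concat (tabulate (λ i → sectionSymbols A listing (sectionOf L i)))) ≤⟨ length-concat-≤ (λ i → sectionSymbols A listing (sectionOf L i)) section≤ ⟩
      -- The number of sections is below `bound`, hence at most the size, and is absorbed into one
      -- more power.
      #sec * size ^ α                                                           ≤⟨ ℕ.*-monoˡ-≤ (size ^ α) (ℕ.≤-trans sec≤ big) ⟩
      size ^ suc α                                                              ∎
      where
      open ℕ.≤-Reasoning
      section≤ : ∀ i → length (sectionSymbols A listing (sectionOf L i)) ≤ size ^ α
      section≤ i = ℕ.≤-trans (ℕ.≤-reflexive (length-section (sectionOf L i))) (ℕ.^-monoʳ-≤ size {{IsFinite.nonEmpty (proj₂ A)}} (arity≤α i))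

    codes≤ : B ^ (κ * suc ⌈log₂ length w ⌉) ≤ size ^ W
    codes≤ = ℕ.≤-trans (space-bound size (suc α) κ B 2≤size length-input)
      (ℕ.^-monoʳ-≤ size {{IsFinite.nonEmpty (proj₂ A)}} (ℕ.m≤n⇒m≤1+n (ℕ.m≤n+m exponent α)))

    long : size ^ (10 * W) < size ^ D
    long = ℕ.^-monoʳ-< size 2≤size (ℕ.n<1+n (10 * W))

theorem5 : (L : Signature) (Q : Query L) → NLDecidable Q →
    Σ (Interpretation (withSuccessor L)) λ γ → IsQuantifierFree γ ×
    ∃ λ (N : ℕ) → (A : FiniteStructure L) → N ≤ card A →
    (s : Successor (Carrier (proj₁ A))) →
    Σ (ConstantsInDomain (successorExpansion A s) γ) λ def →
    let G = interpret (successorExpansion A s) γ def in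
    IsGraph G ×
    ((_≺_ : Rel (Carrier G) 0ℓ) → IsBFT G _≺_ →
    Member Q A ⇔ (expandOrder G _≺_ ⊨ ψ))
theorem5 L Q (M , (κ , space) , decides) =
  reducible L Q M decides W D 0<W fits k≢0 (λ l → κ * suc ⌈log₂ l ⌉) space (λ A big s → codes≤ A big s , long A big s)
  where open Parameters L M κ
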